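{- Let $N$ be a finite set with $|N|\geq 3$. Let $\theta\in\mathbb{R}^{\mathcal{P}(N)}$ be a coefficient vector with $\sum_{S\subseteq N}\theta(S)=0$ and $\sum_{L:\,\emptyset\neq L\subset N}\theta(L)=-1$. Then the inequality $0\leq\langle\theta,m\rangle$ is facet-defining for the cone $\mathcal{E}(N)$ of exact games if and only if $\theta=\theta_{\mathcal{S}}$ for some indecomposable min-semi-balanced system $\mathcal{S}$ on $N$.
   Context: $N$ is a finite set, $\mathcal{P}(N)$ is its power set, and $\subset$ denotes strict inclusion. For $S\subseteq N$, $\chi_S\in\mathbb{R}^N$ is the incidence vector of $S$. A constant vector in $\mathbb{R}^N$ is a vector $[r,\ldots,r]$ with $r\in\mathbb{R}$. A linear combination with real coefficients is affine if its coefficients sum to $1$, conic if all coefficients are $\geq 0$, and semi-conic if at most one coefficient is strictly negative. Set systems. A non-trivial set system on $N$ is a system $\mathcal{S}$ with $\emptyset\neq\mathcal{S}\subseteq\mathcal{P}(N)\setminus\{\emptyset,N\}$. It is balanced (on $N$) if $\chi_N$ is a conic combination of $\{\chi_S: S\in\mathcal{S}\}$ with all coefficients non-zero. It is semi-balanced (on $N$) if some constant vector in $\mathbb{R}^N$ is a semi-conic combination of $\{\chi_S: S\in\mathcal{S}\}$ with all coefficients non-zero. It is min-semi-balanced if it is semi-balanced and no semi-balanced $\mathcal{C}\subset\mathcal{S}$ exists. It is purely min-semi-balanced if it is min-semi-balanced and not balanced. A set $T\in\mathcal{S}$ is exceptional within a non-trivial set system $\mathcal{S}$ if there is a linear combination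 $\sum_{S\in\mathcal{S}}\lambda_S\chi_S$ yielding a constant vector in $\mathbb{R}^N$ with $\lambda_T<0$ and $\lambda_S\geq 0$ for $S\in\mathcal{S}\setminus\{T\}$. A purely min-semi-balanced system $\mathcal{S}$ has a decomposition if there is $E\subseteq N$, $E\notin\mathcal{S}\cup\{\emptyset,N\}$, such that $E$ is exceptional within $\mathcal{S}\cup\{E\}$. An indecomposable min-semi-balanced system is a purely min-semi-balanced system having no decomposition. Coefficient vectors. For a min-semi-balanced $\mathcal{S}$ there is a unique affine semi-conic combination $\sum_{S\in\mathcal{S}}\lambda_S\chi_S$ yielding a constant vector $[r,\ldots,r]$. The vector $\theta_{\mathcal{S}}\in\mathbb{R}^{\mathcal{P}(N)}$ is defined by $\theta_{\mathcal{S}}(S)=-\lambda_S$ for $S\in\mathcal{S}$, $\theta_{\mathcal{S}}(N)=r$, $\theta_{\mathcal{S}}(\emptyset)=1-r$, and $\theta_{\mathcal{S}}(L)=0$ for other $L\subseteq N$. Games. A game over $N$ is $m\in\mathbb{R}^{\mathcal{P}(N)}$ with $m(\emptyset)=0$. Its core is $C(m)=\{x\in\mathbb{R}^N:\sum_{i\in N}x_i=m(N),\ \sum_{i\in S}x_i\geq m(S)\ \forall S\subseteq N\}$. The game $m$ is exact if for each $S\subseteq N$ there is $x\in C(m)$ with $\sum_{i\in S}x_i=m(S)$. The set $\mathcal{E}(N)$ of exact games over $N$ is a polyhedral cone, full-dimensional when regarded in $\mathbb{R}^{\mathcal{P}(N)\setminus\{\emptyset\}}$. Write $\langle\theta,m\rangle=\sum_{S\subseteq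 N}\theta(S)m(S)$. The inequality $0\leq\langle\theta,m\rangle$ is facet-defining for $\mathcal{E}(N)$ if it is valid for all $m\in\mathcal{E}(N)$ and $\{m\in\mathcal{E}(N):\langle\theta,m\rangle=0\}$ is a facet, i.e. a face of dimension $\dim\mathcal{E}(N)-1$. -}

module Defs where

open import Algebra.Bundles using (CommutativeRing)
open import Data.Bool.Base using (if_then_else_)
open import Data.Fin.Base using (Fin)
open import Data.Fin.Subset using (Subset; inside; outside; ⊥; ⊤; Nonempty)
import Data.Fin.Subset as Sub
open import Data.Fin.Subset.Properties using (nonempty?; _⊂?_)
open import Data.Nat.Base using (ℕ; zero; suc)
open import Data.Product using (Σ; ∃-syntax; _×_)
open import Data.Vec.Base using ([]; _∷_; lookup)
open import Data.Vec.Functional using (Vector)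
open import Function.Base using (_∘_)
open import Level using (0ℓ) renaming (suc to lsuc)
open import Relation.Binary.Core using (Rel)
open import Relation.Binary.PropositionalEquality.Core using (_≡_)
open import Relation.Binary.Structures using (IsTotalOrder)
open import Relation.Nullary using (¬_; does; _×-dec_)
open import Relation.Unary using (Pred; Decidable; Satisfiable; _∈_; _∉_; _⊂_; _∪_; ｛_｝)

-- The axioms of the real numbers, up to a setoid equality.  Assuming excluded
-- middle, all models are isomorphic to ℝ.
record CompleteOrderedField : Set₁ where
  infix 4 _≤_ _<_
  field
    commutativeRing : CommutativeRing 0ℓ 0ℓ

  open CommutativeRing commutativeRing public

  field
    _≤_          : Rel Carrier 0ℓ
    isTotalOrder : IsTotalOrder _≈_ _≤_
    1≉0          : 1# ≉ 0#
    inverse      : ∀ x → x ≉ 0# → ∃[ y ] x * y ≈ 1#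
    +-monoˡ-≤    : ∀ {x y} z → x ≤ y → x + z ≤ y + z
    *-nonNeg     : ∀ {x y} → 0# ≤ x → 0# ≤ y → 0# ≤ x * y

  _<_ : Rel Carrier 0ℓ
  x < y = x ≤ y × x ≉ y

  UpperBound : Pred Carrier 0ℓ → Pred Carrier 0ℓ
  UpperBound P b = ∀ x → x ∈ P → x ≤ b

  field
    supremum : (P : Pred Carrier 0ℓ) → Satisfiable P → Satisfiable (UpperBound P) →
               ∃[ s ] s ∈ UpperBound P × (∀ b → b ∈ UpperBound P → s ≤ b)

-- The finite set N is Fin n; within Subset n, ∅ is ⊥ and N is ⊤.
module ExactGames (ℝ : CompleteOrderedField) (n : ℕ) where

  open CompleteOrderedField ℝ
  open import Algebra.Properties.CommutativeMonoid.Sum +-commutativeMonoid using (sum)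

  ------------------------------------------------------------------------
  -- Vectors in ℝ^N and in ℝ^𝒫(N)

  Point : Set
  Point = Fin n → Carrier

  SetFunction : Set
  SetFunction = Subset n → Carrier

  -- Sum over all subsets of a k-element set.
  ∑ : ∀ {k} → (Subset k → Carrier) → Carrier
  ∑ {zero}  f = f []
  ∑ {suc k} f = ∑ (f ∘ (outside ∷_)) + ∑ (f ∘ (inside ∷_))

  ∑-such-that : {P : Pred (Subset n) 0ℓ} → Decidable P → SetFunction → Carrier
  ∑-such-that P? f = ∑ λ S → if does (P? S) then f S else 0#

  ProperNonempty : Pred (Subset n) 0ℓ
  ProperNonempty L = Nonempty L × L Sub.⊂ ⊤

  properNonempty? : Decidable ProperNonempty
  properNonempty? L = nonempty? L ×-dec (L ⊂? ⊤)

  χ : Subset n → Point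
  χ S i = if lookup S i then 1# else 0#

  ⟨_,_⟩ : SetFunction → SetFunction → Carrier
  ⟨ θ , m ⟩ = ∑ λ S → θ S * m S

  ------------------------------------------------------------------------
  -- Set systems

  SetSystem : Set₁
  SetSystem = Pred (Subset n) 0ℓ

  NonTrivial : SetSystem → Set
  NonTrivial 𝒮 = Satisfiable 𝒮 × ⊥ ∉ 𝒮 × ⊤ ∉ 𝒮

  -- A family of coefficients (λ_S) indexed by S ∈ 𝒮 is represented by its
  -- extension by zero to all subsets of N, so that sums over 𝒮 become sums
  -- over 𝒫(N).
  Coefficients : SetSystem → Pred SetFunction 0ℓ
  Coefficients 𝒮 c = ∀ S → S ∉ 𝒮 → c S ≈ 0#

  _Yields_ : SetFunction → Point → Set
  c Yields x = ∀ i → ∑ (λ S → c S * χ S i) ≈ x i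

  constant : Carrier → Point
  constant r _ = r

  AllNonZeroOn : SetSystem → Pred SetFunction 0ℓ
  AllNonZeroOn 𝒮 c = ∀ S → S ∈ 𝒮 → c S ≉ 0#

  Affine : Pred SetFunction 0ℓ
  Affine c = ∑ c ≈ 1#

  Conic : Pred SetFunction 0ℓ
  Conic c = ∀ S → 0# ≤ c S

  SemiConic : Pred SetFunction 0ℓ
  SemiConic c = ∀ S T → c S < 0# → c T < 0# → S ≡ T

  Balanced : SetSystem → Set
  Balanced 𝒮 = NonTrivial 𝒮 ×
    ∃[ c ] Coefficients 𝒮 c × Conic c × AllNonZeroOn 𝒮 c × c Yields χ ⊤

  SemiBalanced : SetSystem → Set
  SemiBalanced 𝒮 = NonTrivial 𝒮 ×
    ∃[ c ] ∃[ r ] Coefficients 𝒮 c × SemiConic c × AllNonZeroOn 𝒮 c × c Yields constant r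

  MinSemiBalanced : SetSystem → Set₁
  MinSemiBalanced 𝒮 = SemiBalanced 𝒮 ×
    ¬ (Σ SetSystem λ 𝒞 → SemiBalanced 𝒞 × 𝒞 ⊂ 𝒮)

  PurelyMinSemiBalanced : SetSystem → Set₁
  PurelyMinSemiBalanced 𝒮 = MinSemiBalanced 𝒮 × ¬ Balanced 𝒮

  _ExceptionalWithin_ : Subset n → SetSystem → Set
  T ExceptionalWithin 𝒮 = NonTrivial 𝒮 × T ∈ 𝒮 ×
    ∃[ c ] ∃[ r ] Coefficients 𝒮 c × c Yields constant r ×
      c T < 0# × (∀ S → S ∈ 𝒮 → ¬ S ≡ T → 0# ≤ c S)

  HasDecomposition : SetSystem → Set
  HasDecomposition 𝒮 =
    ∃[ E ] E ∉ (𝒮 ∪ ｛ ⊥ ｝ ∪ ｛ ⊤ ｝) × E ExceptionalWithin (𝒮 ∪ ｛ E ｝)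

  IndecomposableMinSemiBalanced : SetSystem → Set₁
  IndecomposableMinSemiBalanced 𝒮 = PurelyMinSemiBalanced 𝒮 × ¬ HasDecomposition 𝒮

  -- θ = θ_𝒮, for min-semi-balanced 𝒮.  The pair (c , r) is then unique, so the
  -- existential quantifiers act as a definite description.
  _IsThetaOf_ : SetFunction → SetSystem → Set
  θ IsThetaOf 𝒮 =
    ∃[ c ] ∃[ r ] Coefficients 𝒮 c × Affine c × SemiConic c × c Yields constant r ×
      (∀ S → S ∈ 𝒮 → θ S ≈ - c S) ×
      θ ⊤ ≈ r ×
      θ ⊥ ≈ 1# - r ×
      (∀ L → L ∉ (𝒮 ∪ ｛ ⊥ ｝ ∪ ｛ ⊤ ｝) → θ L ≈ 0#)

  ------------------------------------------------------------------------
  -- Games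

  Game : Pred SetFunction 0ℓ
  Game m = m ⊥ ≈ 0#

  sumOver : Subset n → Point → Carrier
  sumOver S x = sum λ i → if lookup S i then x i else 0#

  Core : SetFunction → Pred Point 0ℓ
  Core m x = sum x ≈ m ⊤ × (∀ S → m S ≤ sumOver S x)

  Exact : Pred SetFunction 0ℓ
  Exact m = Game m × (∀ S → ∃[ x ] x ∈ Core m × sumOver S x ≈ m S)

  ------------------------------------------------------------------------
  -- Dimension and facets

  AffinelyIndependent : ∀ {k} → Vector SetFunction k → Set
  AffinelyIndependent {k} v = (a : Vector Carrier k) → sum a ≈ 0# →
    (∀ S → sum (λ j → a j * v j S) ≈ 0#) → ∀ j → a j ≈ 0#

  HasIndependentPoints : Pred SetFunction 0ℓ → ℕ → Set
  HasIndependentPoints A k =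
    Σ (Vector SetFunction k) λ v → (∀ j → v j ∈ A) × AffinelyIndependent v

  -- The affine hull of A has dimension d.
  HasDimension : Pred SetFunction 0ℓ → ℕ → Set
  HasDimension A d = HasIndependentPoints A (suc d) × ¬ HasIndependentPoints A (suc (suc d))

  ValidFor : Pred SetFunction 0ℓ → Pred SetFunction 0ℓ
  ValidFor A θ = ∀ m → m ∈ A → 0# ≤ ⟨ θ , m ⟩

  TightFace : Pred SetFunction 0ℓ → SetFunction → Pred SetFunction 0ℓ
  TightFace A θ m = m ∈ A × ⟨ θ , m ⟩ ≈ 0#

  FacetDefining : Pred SetFunction 0ℓ → SetFunction → Set
  FacetDefining A θ = ValidFor A θ ×
    ∃[ d ] HasDimension (TightFace A θ) d × HasDimension A (suc d)

{-# OPTIONS --safe #-}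

-- Put u = −θ.  By the Farkas lemma, the inequalities valid for exact games are
-- generated by the vectors u with ∑ u_S χ_S = 0 and at most one negative
-- coefficient at a proper nonempty set, and θ defines a facet iff every linear
-- form vanishing on the tight games is, apart from its coefficient at ∅, a
-- multiple of θ.  If such a u defines a facet, then the support of u must be
-- min-semi-balanced and indecomposable, because otherwise u is a sum of two
-- valid inequalities; it is not balanced, because then the tight games would
-- satisfy a further equation m(G ∪ {p}) = m(G) + m({p}).  Conversely, let 𝒮 be
-- indecomposable with coefficients u and ∑_T d_T = b u, where d_T has T as its
-- only possible negative set.  The sets E ∉ 𝒮 are eliminated one after another
-- by distributing d_E over the other d_T, which leaves vectors supported on 𝒮;
-- these are multiples of u by minimality, and indecomposability shows that
-- nothing had to be eliminated.
module Submission where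

open import Algebra.Bundles.Raw using (RawRing)
open import Algebra.Solver.Ring.AlmostCommutativeRing using (fromCommutativeRing; _-Raw-AlmostCommutative⟶_)
open import Axiom.ExcludedMiddle using (ExcludedMiddle)
open import Data.Bool.Base using (Bool; if_then_else_; true; false; not; _∨_)
import Data.Bool.Properties as Bool
open import Data.Fin.Base using (Fin; zero; suc; punchIn; splitAt; _↑ˡ_; _↑ʳ_)
import Data.Fin.Properties as Fin
open import Data.Fin.Subset using (Subset; inside; outside; ⊥; ⊤; ⁅_⁆; ∁)
import Data.Fin.Subset as Sub
import Data.Fin.Subset.Properties as Subₚ
open import Data.List.Base as List using (List)
open import Data.List.Membership.Propositional using () renaming (_∈_ to _∈ˡ_)
open import Data.List.Membership.Propositional.Properties
  using (∈-map⁺; ∈-++⁺ˡ; ∈-++⁺ʳ; ∈-cartesianProduct⁺)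
open import Data.List.Properties using (length-map)
open import Data.List.Relation.Unary.All as All using (All)
import Data.List.Relation.Unary.All.Properties as All
open import Data.List.Relation.Unary.Any using (here; there)
open import Data.Maybe.Base using (Maybe; just; nothing; map)
open import Data.Nat.Base as ℕ using (ℕ; zero; suc; s≤s; z≤n)
import Data.Nat.Properties as ℕₚ
open import Data.Product using (Σ; ∃-syntax; _×_; _,_; proj₁; proj₂)
open import Data.Sum.Base using (_⊎_; inj₁; inj₂; [_,_]′)
open import Data.Vec.Base using ([]; _∷_; lookup)
open import Data.Vec.Functional as Vector using (Vector; insertAt; removeAt)
open import Data.Vec.Functional.Properties using (insertAt-lookup; insertAt-punchIn)
import Data.Vec.Properties as Vec
open import Function.Base using (_∘_)
open import Function.Bundles using (_⇔_; mk⇔)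
open import Level using (0ℓ)
open import Relation.Binary.Consequences using (dec⇒weaklyDec)
open import Relation.Binary.PropositionalEquality.Core as ≡ using (_≡_; _≢_)
open import Relation.Binary.Structures using (IsTotalOrder)
open import Relation.Nullary using (¬_; Dec; yes; no; contradiction; does)
open import Relation.Nullary.Decidable using (dec-true; dec-false; decidable-stable)
open import Relation.Unary using (Pred; _∈_; _∉_; _∪_; ｛_｝)
open import Defs

-- Exactness is an existential condition: for each T some core element must attain m(T). Adjoining
-- one candidate core element per T makes the exact games the projection of a cone cut out by
-- finitely many linear inequalities, and the Farkas multipliers that belong to the T-th candidate
-- form a single vector d_T. This is why valid inequalities split into summands indexed by T, each
-- with T as its only possible negative set. The normalisation of θ enters as a linear form, the sum
-- of the coefficients at proper nonempty sets. It is nonnegative on all generators and vanishes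
-- only on those that are zero away from ∅, so summands cannot cancel each other completely. The
-- obstacle in the converse is that d_E may be negative at some E ∉ 𝒮, compensated by other
-- summands, whereas indecomposability excludes this only for vectors supported on 𝒮 and E. Other
-- sets outside 𝒮 have to be cleared away before it applies. Dimensions are counted through
-- annihilating linear forms, so that no independent family of exact games has to be written down.

-- Ordered-field arithmetic and a ring solver with integer coefficients.

module Field (ℝ : CompleteOrderedField) where

  open CompleteOrderedField ℝ hiding (zero)
  open import Algebra.Properties.Ring ring public
    using (-‿distribˡ-*; -‿distribʳ-*; -1*x≈-x)
  open import Algebra.Properties.AbelianGroup +-abelianGroup public
    using () renaming (⁻¹-∙-comm to -‿+-comm; ⁻¹-involutive to -‿involutive; ε⁻¹≈ε to -0≈0)
  open import Algebra.Properties.Semiring.Mult.TCOptimised semiring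
    using (×1-homo-*; ×-homo-+; 1+×) renaming (_×_ to _×′_)
  open import Relation.Binary.Reasoning.Setoid setoid

  module ≤ = IsTotalOrder isTotalOrder

  -- Ring solver coefficients: (a , b) stands for the integer a − b.
  private
    ⟦_⟧ᵈ : ℕ × ℕ → Carrier
    ⟦ a , zero  ⟧ᵈ = a ×′ 1#
    ⟦ a , suc b ⟧ᵈ = a ×′ 1# - suc b ×′ 1#

    ⟦⟧ᵈ-diff : ∀ a b → ⟦ a , b ⟧ᵈ ≈ a ×′ 1# - b ×′ 1#
    ⟦⟧ᵈ-diff a zero    = sym (trans (+-congˡ -0≈0) (+-identityʳ _))
    ⟦⟧ᵈ-diff a (suc b) = refl

    open import Algebra.Solver.Ring.NaturalCoefficients.Default commutativeSemiring
      using () renaming (solve to solveˢ; _:+_ to _⊕_; _:*_ to _⊗_; _:=_ to _⊜_)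

    -- Calls of `solve` are closed by `refl`, which compares normal forms definitionally; each
    -- integer therefore needs a single representation, with at most one nonzero component.
    reduce : ℕ → ℕ → ℕ × ℕ
    reduce zero    b       = zero , b
    reduce (suc a) zero    = suc a , zero
    reduce (suc a) (suc b) = reduce a b

    reduce-sound : ∀ a b → ⟦ reduce a b ⟧ᵈ ≈ a ×′ 1# - b ×′ 1#
    reduce-sound zero    b       = ⟦⟧ᵈ-diff zero b
    reduce-sound (suc a) zero    = ⟦⟧ᵈ-diff (suc a) zero
    reduce-sound (suc a) (suc b) = begin
      ⟦ reduce a b ⟧ᵈ                        ≈⟨ reduce-sound a b ⟩
      a ×′ 1# - b ×′ 1#                      ≈⟨ +-congʳ (trans (sym (+-identityʳ _)) (+-congˡ (sym (-‿inverseʳ 1#)))) ⟩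
      (a ×′ 1# + (1# - 1#)) - b ×′ 1#        ≈⟨ solveˢ 4 (λ x u v y → (x ⊕ (u ⊕ v)) ⊕ y ⊜ (u ⊕ x) ⊕ (v ⊕ y)) refl _ _ _ _ ⟩
      (1# + a ×′ 1#) + (- 1# - b ×′ 1#)      ≈⟨ +-congˡ (-‿+-comm _ _) ⟩
      (1# + a ×′ 1#) - (1# + b ×′ 1#)        ≈⟨ +-cong (1+× a 1#) (-‿cong (1+× b 1#)) ⟨
      suc a ×′ 1# - suc b ×′ 1#              ∎

    differences : RawRing 0ℓ 0ℓ
    differences = record
      { Carrier = ℕ × ℕ
      ; _≈_ = _≡_
      ; _+_ = λ (a , b) (c , d) → reduce (a ℕ.+ c) (b ℕ.+ d)
      ; _*_ = λ (a , b) (c , d) → reduce (a ℕ.* c ℕ.+ b ℕ.* d) (a ℕ.* d ℕ.+ b ℕ.* c)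
      ; -_  = λ (a , b) → b , a
      ; 0#  = 0 , 0
      ; 1#  = 1 , 0
      }

    +-homo : ∀ p q → ⟦ RawRing._+_ differences p q ⟧ᵈ ≈ ⟦ p ⟧ᵈ + ⟦ q ⟧ᵈ
    +-homo (a , b) (c , d) = begin
      ⟦ reduce (a ℕ.+ c) (b ℕ.+ d) ⟧ᵈ                 ≈⟨ reduce-sound (a ℕ.+ c) (b ℕ.+ d) ⟩
      (a ℕ.+ c) ×′ 1# - (b ℕ.+ d) ×′ 1#               ≈⟨ +-cong (×-homo-+ 1# a c) (-‿cong (×-homo-+ 1# b d)) ⟩
      (a ×′ 1# + c ×′ 1#) - (b ×′ 1# + d ×′ 1#)       ≈⟨ +-congˡ (-‿+-comm _ _) ⟨
      (a ×′ 1# + c ×′ 1#) + (- (b ×′ 1#) - d ×′ 1#)   ≈⟨ solveˢ 4 (λ x y z w → (x ⊕ y) ⊕ (z ⊕ w) ⊜ (x ⊕ z) ⊕ (y ⊕ w)) refl _ _ _ _ ⟩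
      (a ×′ 1# - b ×′ 1#) + (c ×′ 1# - d ×′ 1#)       ≈⟨ +-cong (⟦⟧ᵈ-diff a b) (⟦⟧ᵈ-diff c d) ⟨
      ⟦ a , b ⟧ᵈ + ⟦ c , d ⟧ᵈ                         ∎

    -‿homo : ∀ p → ⟦ RawRing.-_ differences p ⟧ᵈ ≈ - ⟦ p ⟧ᵈ
    -‿homo (a , b) = begin
      ⟦ b , a ⟧ᵈ                ≈⟨ ⟦⟧ᵈ-diff b a ⟩
      b ×′ 1# - a ×′ 1#        ≈⟨ +-congʳ (-‿involutive _) ⟨
      - - (b ×′ 1#) - a ×′ 1#  ≈⟨ -‿+-comm _ _ ⟩
      - (- (b ×′ 1#) + a ×′ 1#) ≈⟨ -‿cong (+-comm _ _) ⟩
      - (a ×′ 1# - b ×′ 1#)    ≈⟨ -‿cong (⟦⟧ᵈ-diff a b) ⟨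
      - ⟦ a , b ⟧ᵈ             ∎

    *-homo : ∀ p q → ⟦ RawRing._*_ differences p q ⟧ᵈ ≈ ⟦ p ⟧ᵈ * ⟦ q ⟧ᵈ
    *-homo (a , b) (c , d) = begin
      ⟦ reduce (a ℕ.* c ℕ.+ b ℕ.* d) (a ℕ.* d ℕ.+ b ℕ.* c) ⟧ᵈ
        ≈⟨ reduce-sound (a ℕ.* c ℕ.+ b ℕ.* d) (a ℕ.* d ℕ.+ b ℕ.* c) ⟩
      (a ℕ.* c ℕ.+ b ℕ.* d) ×′ 1# - (a ℕ.* d ℕ.+ b ℕ.* c) ×′ 1#
        ≈⟨ +-cong (homo a c b d) (-‿cong (homo a d b c)) ⟩
      (A * C + B * D) - (A * D + B * C)
        ≈⟨ +-congˡ (-‿+-comm _ _) ⟨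
      (A * C + B * D) + (- (A * D) - B * C)
        ≈⟨ +-cong (+-congˡ neg*neg) (+-cong (-‿distribʳ-* A D) (-‿distribˡ-* B C)) ⟩
      (A * C + - B * - D) + (A * - D + - B * C)
        ≈⟨ solveˢ 4 (λ x y z w → (x ⊗ z ⊕ y ⊗ w) ⊕ (x ⊗ w ⊕ y ⊗ z) ⊜ (x ⊕ y) ⊗ (z ⊕ w)) refl A (- B) C (- D) ⟩
      (A - B) * (C - D)
        ≈⟨ *-cong (⟦⟧ᵈ-diff a b) (⟦⟧ᵈ-diff c d) ⟨
      ⟦ a , b ⟧ᵈ * ⟦ c , d ⟧ᵈ ∎
      where
      A = a ×′ 1#
      B = b ×′ 1#
      C = c ×′ 1#
      D = d ×′ 1#
      homo : ∀ a c b d → (a ℕ.* c ℕ.+ b ℕ.* d) ×′ 1# ≈ (a ×′ 1#) * (c ×′ 1#) + (b ×′ 1#) * (d ×′ 1#)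
      homo a c b d = trans (×-homo-+ 1# (a ℕ.* c) (b ℕ.* d)) (+-cong (×1-homo-* a c) (×1-homo-* b d))
      neg*neg : B * D ≈ - B * - D
      neg*neg = begin
        B * D        ≈⟨ -‿involutive _ ⟨
        - - (B * D)  ≈⟨ -‿cong (-‿distribʳ-* B D) ⟩
        - (B * - D)  ≈⟨ -‿distribˡ-* B (- D) ⟩
        - B * - D    ∎

    morphism : differences -Raw-AlmostCommutative⟶ fromCommutativeRing commutativeRing
    morphism = record
      { ⟦_⟧ = ⟦_⟧ᵈ
      ; +-homo = +-homo
      ; *-homo = *-homo
      ; -‿homo = -‿homo
      ; 0-homo = refl
      ; 1-homo = refl
      }

    coefficient-eq : ∀ p q → Maybe (⟦ p ⟧ᵈ ≈ ⟦ q ⟧ᵈ)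
    coefficient-eq (a , b) (c , d) = map sound (dec⇒weaklyDec ℕₚ._≟_ (a ℕ.+ d) (c ℕ.+ b))
      where
      cancel : ∀ x y → (x + y) - y ≈ x
      cancel x y = trans (+-assoc _ _ _) (trans (+-congˡ (-‿inverseʳ y)) (+-identityʳ x))
      rearrange : ∀ x y z → x - y ≈ (x + z) - (y + z)
      rearrange x y z = begin
        x - y                    ≈⟨ +-congʳ (cancel x z) ⟨
        ((x + z) - z) - y        ≈⟨ +-assoc _ _ _ ⟩
        (x + z) + (- z - y)      ≈⟨ +-congˡ (trans (-‿+-comm z y) (-‿cong (+-comm z y))) ⟩
        (x + z) - (y + z)        ∎
      sound : a ℕ.+ d ≡ c ℕ.+ b → ⟦ a , b ⟧ᵈ ≈ ⟦ c , d ⟧ᵈ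
      sound eq = begin
        ⟦ a , b ⟧ᵈ         ≈⟨ ⟦⟧ᵈ-diff a b ⟩
        a ×′ 1# - b ×′ 1#  ≈⟨ rearrange _ _ (d ×′ 1#) ⟩
        (a ×′ 1# + d ×′ 1#) - (b ×′ 1# + d ×′ 1#)
          ≈⟨ +-cong (trans (sym (×-homo-+ 1# a d)) (trans (reflexive (≡.cong (_×′ 1#) eq)) (×-homo-+ 1# c b)))
                    (-‿cong (+-comm _ _)) ⟩
        (c ×′ 1# + b ×′ 1#) - (d ×′ 1# + b ×′ 1#) ≈⟨ rearrange _ _ (b ×′ 1#) ⟨
        c ×′ 1# - d ×′ 1#  ≈⟨ ⟦⟧ᵈ-diff c d ⟨
        ⟦ c , d ⟧ᵈ ∎

  open import Algebra.Solver.Ring differences (fromCommutativeRing commutativeRing) morphism coefficient-eq public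
    using (solve; Polynomial; _:+_; _:*_; _:-_; :-_; _:=_; con)

  -- `⟦_⟧ᵈ` omits the subtraction when the second component is zero, so these constants evaluate
  -- definitionally to `0#` and `1#`.
  :0 :1 : ∀ {k} → Polynomial k
  :0 = con (0 , 0)
  :1 = con (1 , 0)

  ≤-resp : ∀ {x x′ y y′} → x ≈ x′ → y ≈ y′ → x ≤ y → x′ ≤ y′
  ≤-resp x≈x′ y≈y′ x≤y = ≤.trans (≤.reflexive (sym x≈x′)) (≤.trans x≤y (≤.reflexive y≈y′))

  ≤-respˡ : ∀ {x x′ y} → x ≈ x′ → x ≤ y → x′ ≤ y
  ≤-respˡ x≈x′ = ≤-resp x≈x′ refl

  ≤-respʳ : ∀ {x y y′} → y ≈ y′ → x ≤ y → x ≤ y′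
  ≤-respʳ = ≤-resp refl

  +-mono-≤ : ∀ {x y z w} → x ≤ y → z ≤ w → x + z ≤ y + w
  +-mono-≤ {x} {y} {z} {w} x≤y z≤w =
    ≤.trans (+-monoˡ-≤ z x≤y) (≤-resp (+-comm z y) (+-comm w y) (+-monoˡ-≤ y z≤w))

  neg-mono-≤ : ∀ {x y} → x ≤ y → - y ≤ - x
  neg-mono-≤ {x} {y} x≤y = ≤-resp
    (solve 2 (λ x y → x :+ (:- x :- y) := :- y) refl x y)
    (solve 2 (λ x y → y :+ (:- x :- y) := :- x) refl x y)
    (+-monoˡ-≤ (- x - y) x≤y)

  x≤y⇒0≤y-x : ∀ {x y} → x ≤ y → 0# ≤ y - x
  x≤y⇒0≤y-x {x} {y} x≤y = ≤-respˡ (-‿inverseʳ x) (+-monoˡ-≤ (- x) x≤y)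

  x≤y⇒x-y≤0 : ∀ {x y} → x ≤ y → x - y ≤ 0#
  x≤y⇒x-y≤0 {x} {y} x≤y = ≤-respʳ (-‿inverseʳ y) (+-monoˡ-≤ (- y) x≤y)

  0≤y-x⇒x≤y : ∀ {x y} → 0# ≤ y - x → x ≤ y
  0≤y-x⇒x≤y {x} {y} p = ≤-resp (+-identityˡ x)
    (solve 2 (λ x y → (y :- x) :+ x := y) refl x y) (+-monoˡ-≤ x p)

  x-y≤0⇒x≤y : ∀ {x y} → x - y ≤ 0# → x ≤ y
  x-y≤0⇒x≤y {x} {y} p = ≤-resp (solve 2 (λ x y → (x :- y) :+ y := x) refl x y) (+-identityˡ y) (+-monoˡ-≤ y p)

  0≤⇒-≤0 : ∀ {x} → 0# ≤ x → - x ≤ 0#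
  0≤⇒-≤0 p = ≤-respʳ -0≈0 (neg-mono-≤ p)

  ≤0⇒0≤- : ∀ {x} → x ≤ 0# → 0# ≤ - x
  ≤0⇒0≤- p = ≤-respˡ -0≈0 (neg-mono-≤ p)

  0≤-⇒≤0 : ∀ {x} → 0# ≤ - x → x ≤ 0#
  0≤-⇒≤0 p = ≤-respˡ (-‿involutive _) (0≤⇒-≤0 p)

  -≤0⇒0≤ : ∀ {x} → - x ≤ 0# → 0# ≤ x
  -≤0⇒0≤ p = ≤-respʳ (-‿involutive _) (≤0⇒0≤- p)

  +-nonNeg : ∀ {x y} → 0# ≤ x → 0# ≤ y → 0# ≤ x + y
  +-nonNeg p q = ≤-respˡ (+-identityˡ 0#) (+-mono-≤ p q)

  +-nonPos : ∀ {x y} → x ≤ 0# → y ≤ 0# → x + y ≤ 0#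
  +-nonPos p q = ≤-respʳ (+-identityˡ 0#) (+-mono-≤ p q)

  nonNeg-sum-zeroˡ : ∀ {x y} → 0# ≤ x → 0# ≤ y → x + y ≈ 0# → x ≈ 0#
  nonNeg-sum-zeroˡ {x} {y} p q x+y≈0 =
    ≤.antisym (≤-resp (+-identityʳ x) x+y≈0 (+-mono-≤ ≤.refl q)) p

  nonNeg-sum-zeroʳ : ∀ {x y} → 0# ≤ x → 0# ≤ y → x + y ≈ 0# → y ≈ 0#
  nonNeg-sum-zeroʳ p q x+y≈0 = nonNeg-sum-zeroˡ q p (trans (+-comm _ _) x+y≈0)

  nonPos-sum-zeroˡ : ∀ {x y} → x ≤ 0# → y ≤ 0# → x + y ≈ 0# → x ≈ 0#
  nonPos-sum-zeroˡ {x} {y} p q x+y≈0 =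
    ≤.antisym p (≤-resp x+y≈0 (+-identityʳ x) (+-mono-≤ ≤.refl q))

  nonPos-sum-zeroʳ : ∀ {x y} → x ≤ 0# → y ≤ 0# → x + y ≈ 0# → y ≈ 0#
  nonPos-sum-zeroʳ p q x+y≈0 = nonPos-sum-zeroˡ q p (trans (+-comm _ _) x+y≈0)

  *-nonNeg-nonPos : ∀ {x y} → 0# ≤ x → y ≤ 0# → x * y ≤ 0#
  *-nonNeg-nonPos p q = 0≤-⇒≤0 (≤-respʳ (sym (-‿distribʳ-* _ _)) (*-nonNeg p (≤0⇒0≤- q)))

  *-nonPos-nonPos : ∀ {x y} → x ≤ 0# → y ≤ 0# → 0# ≤ x * y
  *-nonPos-nonPos {x} {y} p q = ≤-respʳ
    (solve 2 (λ x y → (:- x) :* (:- y) := x :* y) refl x y) (*-nonNeg (≤0⇒0≤- p) (≤0⇒0≤- q))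

  0≤x*x : ∀ x → 0# ≤ x * x
  0≤x*x x with ≤.total 0# x
  ... | inj₁ 0≤x = *-nonNeg 0≤x 0≤x
  ... | inj₂ x≤0 = *-nonPos-nonPos x≤0 x≤0

  0≤1 : 0# ≤ 1#
  0≤1 = ≤-respʳ (*-identityʳ 1#) (0≤x*x 1#)

  ≰⇒> : ∀ {x y} → ¬ (x ≤ y) → y < x
  ≰⇒> {x} {y} x≰y with ≤.total x y
  ... | inj₁ x≤y = contradiction x≤y x≰y
  ... | inj₂ y≤x = y≤x , λ y≈x → x≰y (≤.reflexive (sym y≈x))

  <⇒≱ : ∀ {x y} → x < y → ¬ (y ≤ x)
  <⇒≱ (x≤y , x≉y) y≤x = x≉y (≤.antisym x≤y y≤x)

  x*y≈0⇒y≈0 : ∀ {x y} → x ≉ 0# → x * y ≈ 0# → y ≈ 0#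
  x*y≈0⇒y≈0 {x} {y} x≉0 xy≈0 with inverse x x≉0
  ... | x⁻¹ , x*x⁻¹≈1 = begin
    y               ≈⟨ *-identityˡ y ⟨
    1# * y          ≈⟨ *-congʳ x*x⁻¹≈1 ⟨
    x * x⁻¹ * y     ≈⟨ solve 3 (λ x z y → x :* z :* y := z :* (x :* y)) refl x x⁻¹ y ⟩
    x⁻¹ * (x * y)   ≈⟨ *-congˡ xy≈0 ⟩
    x⁻¹ * 0#        ≈⟨ zeroʳ x⁻¹ ⟩
    0#              ∎

  x*y≈0⇒x≈0 : ∀ {x y} → y ≉ 0# → x * y ≈ 0# → x ≈ 0#
  x*y≈0⇒x≈0 y≉0 xy≈0 = x*y≈0⇒y≈0 y≉0 (trans (*-comm _ _) xy≈0)

  *-pos : ∀ {x y} → 0# < x → 0# < y → 0# < x * y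
  *-pos (0≤x , 0≉x) (0≤y , 0≉y) =
    *-nonNeg 0≤x 0≤y , λ 0≈xy → 0≉y (sym (x*y≈0⇒y≈0 (λ x≈0 → 0≉x (sym x≈0)) (sym 0≈xy)))

  positive-inverse : ∀ {x} → 0# < x → ∃[ y ] 0# < y × x * y ≈ 1#
  positive-inverse {x} (0≤x , 0≉x) with inverse x (λ x≈0 → 0≉x (sym x≈0))
  ... | y , xy≈1 with ≤.total 0# y
  ... | inj₁ 0≤y = y , (0≤y , λ 0≈y → 1≉0 (trans (sym xy≈1) (trans (*-congˡ (sym 0≈y)) (zeroʳ x)))) , xy≈1
  ... | inj₂ y≤0 = contradiction (≤.antisym (≤-respˡ xy≈1 (*-nonNeg-nonPos 0≤x y≤0)) 0≤1) 1≉0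

  0<1 : 0# < 1#
  0<1 = 0≤1 , λ 0≈1 → 1≉0 (sym 0≈1)

  <⇒≉ : ∀ {x} → 0# < x → x ≉ 0#
  <⇒≉ (_ , 0≉x) x≈0 = 0≉x (sym x≈0)

  x-y≈0⇒x≈y : ∀ {x y} → x - y ≈ 0# → x ≈ y
  x-y≈0⇒x≈y {x} {y} p = begin
    x            ≈⟨ solve 2 (λ x y → x := (x :- y) :+ y) refl x y ⟩
    (x - y) + y  ≈⟨ +-congʳ p ⟩
    0# + y       ≈⟨ +-identityˡ y ⟩
    y            ∎

-- Sums over subsets and the pairing of set functions.

module Sums (ℝ : CompleteOrderedField) (n : ℕ) where

  open CompleteOrderedField ℝ hiding (zero)
  open ExactGames ℝ n
  open Field ℝ
  open import Algebra.Properties.Semiring.Sum semiring using (sum) renaming (∑-distrib-+ to sum-distrib-+)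
  open import Relation.Binary.Reasoning.Setoid setoid

  -- ∑ is defined by recursion on its implicit size, which therefore cannot be
  -- inferred; hence the specialisation to the size n below.
  module Generic where

    ∑-cong : ∀ {k} {f g : Subset k → Carrier} → (∀ S → f S ≈ g S) → ∑ f ≈ ∑ g
    ∑-cong {zero}  f≈g = f≈g []
    ∑-cong {suc k} f≈g = +-cong (∑-cong (f≈g ∘ (outside ∷_))) (∑-cong (f≈g ∘ (inside ∷_)))

    ∑-zero : ∀ {k} {f : Subset k → Carrier} → (∀ S → f S ≈ 0#) → ∑ f ≈ 0#
    ∑-zero {zero}  f≈0 = f≈0 []
    ∑-zero {suc k} f≈0 = trans (+-cong (∑-zero (f≈0 ∘ (outside ∷_))) (∑-zero (f≈0 ∘ (inside ∷_)))) (+-identityˡ 0#)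

    ∑-distrib-+ : ∀ {k} (f g : Subset k → Carrier) → ∑ (λ S → f S + g S) ≈ ∑ f + ∑ g
    ∑-distrib-+ {zero}  f g = refl
    ∑-distrib-+ {suc k} f g = trans
      (+-cong (∑-distrib-+ (f ∘ (outside ∷_)) (g ∘ (outside ∷_))) (∑-distrib-+ (f ∘ (inside ∷_)) (g ∘ (inside ∷_))))
      (solve 4 (λ a b c d → (a :+ b) :+ (c :+ d) := (a :+ c) :+ (b :+ d)) refl _ _ _ _)

    *-distribˡ-∑ : ∀ {k} a (f : Subset k → Carrier) → a * ∑ f ≈ ∑ (λ S → a * f S)
    *-distribˡ-∑ {zero}  a f = refl
    *-distribˡ-∑ {suc k} a f = trans (distribˡ a _ _)
      (+-cong (*-distribˡ-∑ a (f ∘ (outside ∷_))) (*-distribˡ-∑ a (f ∘ (inside ∷_))))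

    ∑-comm : ∀ {k l} (f : Subset k → Subset l → Carrier) →
             ∑ (λ S → ∑ (f S)) ≈ ∑ (λ T → ∑ (λ S → f S T))
    ∑-comm {zero}  f = refl
    ∑-comm {suc k} f = trans
      (+-cong (∑-comm (f ∘ (outside ∷_))) (∑-comm (f ∘ (inside ∷_))))
      (sym (∑-distrib-+ (λ T → ∑ (λ S → f (outside ∷ S) T)) (λ T → ∑ (λ S → f (inside ∷ S) T))))

    ∑-sum-comm : ∀ {k l} (f : Subset k → Fin l → Carrier) →
                 ∑ (λ S → sum (f S)) ≈ sum (λ i → ∑ (λ S → f S i))
    ∑-sum-comm {zero}  f = refl
    ∑-sum-comm {suc k} f = trans
      (+-cong (∑-sum-comm (f ∘ (outside ∷_))) (∑-sum-comm (f ∘ (inside ∷_))))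
      (sym (sum-distrib-+ (λ i → ∑ (λ S → f (outside ∷ S) i)) (λ i → ∑ (λ S → f (inside ∷ S) i))))

    ∑-nonNeg : ∀ {k} {f : Subset k → Carrier} → (∀ S → 0# ≤ f S) → 0# ≤ ∑ f
    ∑-nonNeg {zero}  p = p []
    ∑-nonNeg {suc k} p = +-nonNeg (∑-nonNeg (p ∘ (outside ∷_))) (∑-nonNeg (p ∘ (inside ∷_)))

    ∑-nonPos : ∀ {k} {f : Subset k → Carrier} → (∀ S → f S ≤ 0#) → ∑ f ≤ 0#
    ∑-nonPos {zero}  p = p []
    ∑-nonPos {suc k} p = +-nonPos (∑-nonPos (p ∘ (outside ∷_))) (∑-nonPos (p ∘ (inside ∷_)))

    ∑-nonNeg-zero : ∀ {k} {f : Subset k → Carrier} → (∀ S → 0# ≤ f S) → ∑ f ≈ 0# → ∀ S → f S ≈ 0#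
    ∑-nonNeg-zero {zero}  p eq [] = eq
    ∑-nonNeg-zero {suc k} p eq (false ∷ S) = ∑-nonNeg-zero (p ∘ (outside ∷_))
      (nonNeg-sum-zeroˡ (∑-nonNeg (p ∘ (outside ∷_))) (∑-nonNeg (p ∘ (inside ∷_))) eq) S
    ∑-nonNeg-zero {suc k} p eq (true ∷ S) = ∑-nonNeg-zero (p ∘ (inside ∷_))
      (nonNeg-sum-zeroʳ (∑-nonNeg (p ∘ (outside ∷_))) (∑-nonNeg (p ∘ (inside ∷_))) eq) S

    ∑-nonPos-zero : ∀ {k} {f : Subset k → Carrier} → (∀ S → f S ≤ 0#) → ∑ f ≈ 0# → ∀ S → f S ≈ 0#
    ∑-nonPos-zero {zero}  p eq [] = eq
    ∑-nonPos-zero {suc k} p eq (false ∷ S) = ∑-nonPos-zero (p ∘ (outside ∷_))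
      (nonPos-sum-zeroˡ (∑-nonPos (p ∘ (outside ∷_))) (∑-nonPos (p ∘ (inside ∷_))) eq) S
    ∑-nonPos-zero {suc k} p eq (true ∷ S) = ∑-nonPos-zero (p ∘ (inside ∷_))
      (nonPos-sum-zeroʳ (∑-nonPos (p ∘ (outside ∷_))) (∑-nonPos (p ∘ (inside ∷_))) eq) S

    ∑-single : ∀ {k} {f : Subset k → Carrier} T → (∀ S → S ≢ T → f S ≈ 0#) → ∑ f ≈ f T
    ∑-single [] p = refl
    ∑-single (false ∷ T) p = trans
      (+-cong (∑-single T (λ S S≢T → p (outside ∷ S) (S≢T ∘ Vec.∷-injectiveʳ))) (∑-zero (λ S → p (inside ∷ S) λ ())))
      (+-identityʳ _)
    ∑-single (true ∷ T) p = trans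
      (+-cong (∑-zero (λ S → p (outside ∷ S) λ ())) (∑-single T (λ S S≢T → p (inside ∷ S) (S≢T ∘ Vec.∷-injectiveʳ))))
      (+-identityˡ _)

  ∑-cong : ∀ {f g : SetFunction} → (∀ S → f S ≈ g S) → ∑ f ≈ ∑ g
  ∑-cong = Generic.∑-cong

  ∑-zero : ∀ {f : SetFunction} → (∀ S → f S ≈ 0#) → ∑ f ≈ 0#
  ∑-zero = Generic.∑-zero

  ∑-distrib-+ : ∀ (f g : SetFunction) → ∑ (λ S → f S + g S) ≈ ∑ f + ∑ g
  ∑-distrib-+ = Generic.∑-distrib-+

  *-distribˡ-∑ : ∀ a (f : SetFunction) → a * ∑ f ≈ ∑ (λ S → a * f S)
  *-distribˡ-∑ = Generic.*-distribˡ-∑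

  ∑-comm : ∀ (f : Subset n → SetFunction) → ∑ (λ S → ∑ (f S)) ≈ ∑ (λ T → ∑ (λ S → f S T))
  ∑-comm = Generic.∑-comm

  ∑-sum-comm : ∀ {l} (f : Subset n → Fin l → Carrier) → ∑ (λ S → sum (f S)) ≈ sum (λ i → ∑ (λ S → f S i))
  ∑-sum-comm = Generic.∑-sum-comm

  ∑-nonNeg : ∀ {f : SetFunction} → (∀ S → 0# ≤ f S) → 0# ≤ ∑ f
  ∑-nonNeg = Generic.∑-nonNeg

  ∑-nonPos : ∀ {f : SetFunction} → (∀ S → f S ≤ 0#) → ∑ f ≤ 0#
  ∑-nonPos = Generic.∑-nonPos

  ∑-nonNeg-zero : ∀ {f : SetFunction} → (∀ S → 0# ≤ f S) → ∑ f ≈ 0# → ∀ S → f S ≈ 0#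
  ∑-nonNeg-zero = Generic.∑-nonNeg-zero

  ∑-nonPos-zero : ∀ {f : SetFunction} → (∀ S → f S ≤ 0#) → ∑ f ≈ 0# → ∀ S → f S ≈ 0#
  ∑-nonPos-zero = Generic.∑-nonPos-zero

  ∑-single : ∀ {f : SetFunction} T → (∀ S → S ≢ T → f S ≈ 0#) → ∑ f ≈ f T
  ∑-single = Generic.∑-single

  infix 4 _≟_
  _≟_ : (S T : Subset n) → Dec (S ≡ T)
  _≟_ = Vec.≡-dec Bool._≟_

  single : Subset n → Carrier → SetFunction
  single T a S = if does (S ≟ T) then a else 0#

  single-same : ∀ T a → single T a T ≈ a
  single-same T a with T ≟ T
  ... | yes _  = refl
  ... | no T≢T = contradiction ≡.refl T≢T

  single-other : ∀ {S T} a → S ≢ T → single T a S ≈ 0#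
  single-other {S} {T} a S≢T with S ≟ T
  ... | yes S≡T = contradiction S≡T S≢T
  ... | no _    = refl

  ⟨⟩-distrib-+ : ∀ f g m → ⟨ (λ S → f S + g S) , m ⟩ ≈ ⟨ f , m ⟩ + ⟨ g , m ⟩
  ⟨⟩-distrib-+ f g m = trans (∑-cong (λ S → distribʳ (m S) (f S) (g S)))
    (∑-distrib-+ (λ S → f S * m S) (λ S → g S * m S))

  ⟨⟩-scale : ∀ a f m → ⟨ (λ S → a * f S) , m ⟩ ≈ a * ⟨ f , m ⟩
  ⟨⟩-scale a f m = trans (∑-cong (λ S → *-assoc a (f S) (m S))) (sym (*-distribˡ-∑ a (λ S → f S * m S)))

  ⟨⟩-neg : ∀ f m → ⟨ (λ S → - f S) , m ⟩ ≈ - ⟨ f , m ⟩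
  ⟨⟩-neg f m = trans (∑-cong (λ S → *-congʳ (sym (-1*x≈-x (f S))))) (trans (⟨⟩-scale (- 1#) f m) (-1*x≈-x _))

  ⟨⟩-distrib-- : ∀ f g m → ⟨ (λ S → f S - g S) , m ⟩ ≈ ⟨ f , m ⟩ - ⟨ g , m ⟩
  ⟨⟩-distrib-- f g m = trans (⟨⟩-distrib-+ f (λ S → - g S) m) (+-congˡ (⟨⟩-neg g m))

  ⟨⟩-comm : ∀ f g → ⟨ f , g ⟩ ≈ ⟨ g , f ⟩
  ⟨⟩-comm f g = ∑-cong (λ S → *-comm (f S) (g S))

  ⟨single,⟩ : ∀ T a m → ⟨ single T a , m ⟩ ≈ a * m T
  ⟨single,⟩ T a m = trans
    (∑-single T (λ S S≢T → trans (*-congʳ (single-other a S≢T)) (zeroˡ _)))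
    (*-congʳ (single-same T a))

  ⟨⟩-∑ : ∀ (d : Subset n → SetFunction) m → ∑ (λ T → ⟨ d T , m ⟩) ≈ ⟨ (λ S → ∑ (λ T → d T S)) , m ⟩
  ⟨⟩-∑ d m = trans (∑-comm (λ T S → d T S * m S)) (∑-cong (λ S → begin
    ∑ (λ T → d T S * m S)  ≈⟨ ∑-cong (λ T → *-comm (d T S) (m S)) ⟩
    ∑ (λ T → m S * d T S)  ≈⟨ *-distribˡ-∑ (m S) (λ T → d T S) ⟨
    m S * ∑ (λ T → d T S)  ≈⟨ *-comm _ _ ⟩
    ∑ (λ T → d T S) * m S  ∎))

  -- `⟨ f , f ⟩` is a sum of squares. This is what shows that a vector orthogonal to a space
  -- containing it vanishes.
  ⟨⟩-definite : ∀ f → ⟨ f , f ⟩ ≈ 0# → ¬ (∃[ S ] f S ≉ 0#)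
  ⟨⟩-definite f f·f≈0 (S , fS≉0) =
    fS≉0 (x*y≈0⇒y≈0 fS≉0 (∑-nonNeg-zero (λ S → 0≤x*x (f S)) f·f≈0 S))

-- The Farkas lemma.

-- Bartl's algebraic proof of the Farkas lemma: the linear functionals live on a
-- type with just the operation x ⊞ a · y, and the cone is an arbitrary
-- predicate closed under conic combinations.
module FarkasLemma (em : ExcludedMiddle 0ℓ) (ℝ : CompleteOrderedField)
  {X : Set} (_⊞_·_ : X → CompleteOrderedField.Carrier ℝ → X → X) (x₀ : X) where

  open CompleteOrderedField ℝ hiding (zero)
  open Field ℝ
  open import Relation.Binary.Reasoning.Setoid setoid

  record Functional : Set where
    field
      apply  : X → Carrier
      linear : ∀ x a y → apply (x ⊞ a · y) ≈ apply x + a * apply y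

  open Functional public

  record ConvexCone (P : Functional → Set) : Set where
    field
      resp  : ∀ f g → (∀ x → apply f x ≈ apply g x) → P f → P g
      zero⁺ : ∀ f → (∀ x → apply f x ≈ 0#) → P f
      plus  : ∀ f g a → 0# ≤ a → P f → P g →
              ∀ h → (∀ x → apply h x ≈ apply f x + a * apply g x) → P h

  combine : Functional → Carrier → Functional → Functional
  combine f a g = record
    { apply = λ x → apply f x + a * apply g x
    ; linear = λ x b y → begin
        apply f (x ⊞ b · y) + a * apply g (x ⊞ b · y)
          ≈⟨ +-cong (linear f x b y) (*-congˡ (linear g x b y)) ⟩
        (apply f x + b * apply f y) + a * (apply g x + b * apply g y)
          ≈⟨ solve 6 (λ p q r s a b → (p :+ b :* q) :+ a :* (r :+ b :* s) := (p :+ a :* r) :+ b :* (q :+ a :* s)) refl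
               (apply f x) (apply f y) (apply g x) (apply g y) a b ⟩
        (apply f x + a * apply g x) + b * (apply f y + a * apply g y) ∎
    }

  farkas-list : ∀ k {P} → ConvexCone P → (gs : List Functional) → List.length gs ≡ k → All P gs → ∀ γ →
                (∀ x → All (λ g → apply g x ≤ 0#) gs → apply γ x ≤ 0#) → P γ
  farkas-list _ cone List.[] _ _ γ γ≤0 = ConvexCone.zero⁺ cone γ λ x →
    ≤.antisym (γ≤0 x All.[])
      (-≤0⇒0≤ (≤-respˡ
        (trans (linear γ x (- 1# - 1#) x)
          (solve 1 (λ y → y :+ (:- :1 :- :1) :* y := :- y) refl (apply γ x)))
        -- `X` has no negation; the negative of `x` is formed as `x` minus twice `x`.
        (γ≤0 (x ⊞ (- 1# - 1#) · x) All.[])))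
  farkas-list (suc k) {P} cone (α List.∷ gs) length≡ (Pα All.∷ Pgs) γ γ≤0
    with em {P = ∃[ x ] All (λ g → apply g x ≤ 0#) gs × ¬ (apply γ x ≤ 0#)}
  ... | no ∄x = farkas-list k cone gs (ℕₚ.suc-injective length≡) Pgs γ λ x gx≤0 → stable x λ γx≰0 → ∄x (x , gx≤0 , γx≰0)
    where
    stable : ∀ x → ¬ ¬ (apply γ x ≤ 0#) → apply γ x ≤ 0#
    stable x ¬¬p with ≤.total (apply γ x) 0#
    ... | inj₁ p = p
    ... | inj₂ 0≤γx with em {P = apply γ x ≤ 0#}
    ... | yes p = p
    ... | no ¬p = contradiction ¬p ¬¬p
  ... | yes (z , gz≤0 , γz≰0) =
    ConvexCone.plus cone γ′ α (apply γ z * κ) (*-nonNeg 0≤γz 0≤κ) Pγ′ Pα γ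
      (λ x → solve 3 (λ p t q → p := (p :+ (:- t) :* q) :+ t :* q) refl (apply γ x) (apply γ z * κ) (apply α x))
    where
    0≤γz : 0# ≤ apply γ z
    0≤γz = proj₁ (≰⇒> γz≰0)
    -- `z` meets all constraints of the tail while `γ z ≤ 0` fails, so it must be the constraint `α`
    -- that fails at `z`.
    0<αz : 0# < apply α z
    0<αz = ≰⇒> λ αz≤0 → γz≰0 (γ≤0 z (αz≤0 All.∷ gz≤0))
    κ : Carrier
    κ = proj₁ (positive-inverse 0<αz)
    0≤κ : 0# ≤ κ
    0≤κ = proj₁ (proj₁ (proj₂ (positive-inverse 0<αz)))
    αz*κ≈1 : apply α z * κ ≈ 1#
    αz*κ≈1 = proj₂ (proj₂ (positive-inverse 0<αz))
    -- g composed with the projection along z to the kernel of α.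
    project : Functional → Functional
    project g = combine g (- (apply g z * κ)) α
    γ′ : Functional
    γ′ = project γ
    shift : X → X
    shift x = x ⊞ (- (apply α x * κ)) · z
    project-shift : ∀ g x → apply g (shift x) ≈ apply (project g) x
    project-shift g x = trans (linear g x _ z)
      (solve 4 (λ p q κ r → p :+ (:- (q :* κ)) :* r := p :+ (:- (r :* κ)) :* q) refl (apply g x) (apply α x) κ (apply g z))
    α-shift : ∀ x → apply α (shift x) ≈ 0#
    α-shift x = begin
      apply α (shift x)                            ≈⟨ linear α x _ z ⟩
      apply α x + - (apply α x * κ) * apply α z
        ≈⟨ solve 3 (λ q κ r → q :+ (:- (q :* κ)) :* r := q :- q :* (r :* κ)) refl (apply α x) κ (apply α z) ⟩
      apply α x - apply α x * (apply α z * κ)      ≈⟨ +-congˡ (-‿cong (*-congˡ αz*κ≈1)) ⟩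
      apply α x - apply α x * 1#                   ≈⟨ solve 1 (λ q → q :- q :* :1 := :0) refl (apply α x) ⟩
      0#                                           ∎
    Pproject : ∀ hs → All P hs → All (λ g → apply g z ≤ 0#) hs → All P (List.map project hs)
    Pproject List.[] _ _ = All.[]
    Pproject (h List.∷ hs) (Ph All.∷ Phs) (hz≤0 All.∷ hsz≤0) =
      ConvexCone.plus cone h α (- (apply h z * κ))
        (≤0⇒0≤- (≤-respˡ (*-comm _ _) (*-nonNeg-nonPos 0≤κ hz≤0))) Ph Pα (project h) (λ _ → refl)
      All.∷ Pproject hs Phs hsz≤0
    γ′≤0 : ∀ x → All (λ g → apply g x ≤ 0#) (List.map project gs) → apply γ′ x ≤ 0#
    γ′≤0 x gx≤0 = ≤-respˡ (project-shift γ x) (γ≤0 (shift x)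
      (≤.reflexive (α-shift x) All.∷
       All.map (λ {g} → ≤-respˡ (sym (project-shift g x))) (All.map⁻ gx≤0)))
    Pγ′ : P γ′
    Pγ′ = farkas-list k cone (List.map project gs) (≡.trans (length-map project gs) (ℕₚ.suc-injective length≡)) (Pproject gs Pgs gz≤0) γ′ γ′≤0

  farkas : ∀ {J : Set} (js : List J) → (∀ j → j ∈ˡ js) → (φ : J → Functional) →
           ∀ {P} → ConvexCone P → (∀ j → P (φ j)) → ∀ γ →
           (∀ x → (∀ j → apply (φ j) x ≤ 0#) → apply γ x ≤ 0#) → P γ
  farkas js complete φ cone Pφ γ γ≤0 =
    farkas-list _ cone (List.map φ js) ≡.refl (All.map⁺ (All.tabulate λ {j} _ → Pφ j)) γ
      λ x φx≤0 → γ≤0 x λ j → All.lookup (All.map⁻ φx≤0) (complete j)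

-- Subsets as bit vectors.

lookup-differs : ∀ {k} {S T : Subset k} → S ≢ T → ∃[ i ] lookup S i ≢ lookup T i
lookup-differs {S = []} {[]} S≢T = contradiction ≡.refl S≢T
lookup-differs {S = a ∷ S} {b ∷ T} S≢T with a Bool.≟ b
... | no a≢b = zero , a≢b
... | yes ≡.refl with lookup-differs {S = S} {T} (S≢T ∘ ≡.cong (a ∷_))
... | i , p = suc i , p

lookup-⊥ : ∀ {k} (i : Fin k) → lookup ⊥ i ≡ false
lookup-⊥ i = Vec.lookup-replicate i false

lookup-⊤ : ∀ {k} (i : Fin k) → lookup ⊤ i ≡ true
lookup-⊤ i = Vec.lookup-replicate i true

≢⊥⇒member : ∀ {k} {S : Subset k} → S ≢ ⊥ → ∃[ i ] lookup S i ≡ true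
≢⊥⇒member {S = S} S≢⊥ with lookup-differs S≢⊥
... | i , p with lookup S i in eq
... | true  = i , eq
... | false = contradiction (≡.sym (lookup-⊥ i)) p

≢⊤⇒nonmember : ∀ {k} {S : Subset k} → S ≢ ⊤ → ∃[ i ] lookup S i ≡ false
≢⊤⇒nonmember {S = S} S≢⊤ with lookup-differs S≢⊤
... | i , p with lookup S i in eq
... | false = i , eq
... | true  = contradiction (≡.sym (lookup-⊤ i)) p

member⇒≢⊥ : ∀ {k} {S : Subset k} i → lookup S i ≡ true → S ≢ ⊥
member⇒≢⊥ i i∈S ≡.refl with () ← ≡.trans (≡.sym i∈S) (lookup-⊥ i)

nonmember⇒≢⊤ : ∀ {k} {S : Subset k} i → lookup S i ≡ false → S ≢ ⊤
nonmember⇒≢⊤ i i∉S ≡.refl with () ← ≡.trans (≡.sym i∉S) (lookup-⊤ i)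

subsets : ∀ k → List (Subset k)
subsets zero    = [] List.∷ List.[]
subsets (suc k) = List.map (outside ∷_) (subsets k) List.++ List.map (inside ∷_) (subsets k)

∈-subsets : ∀ {k} (S : Subset k) → S ∈ˡ subsets k
∈-subsets []          = here ≡.refl
∈-subsets (false ∷ S) = ∈-++⁺ˡ (∈-map⁺ (outside ∷_) (∈-subsets S))
∈-subsets (true ∷ S)  = ∈-++⁺ʳ (List.map (outside ∷_) (subsets _)) (∈-map⁺ (inside ∷_) (∈-subsets S))

-- Valid inequalities for exact games.

module Games (em : ExcludedMiddle 0ℓ) (ℝ : CompleteOrderedField) (n : ℕ) where

  open CompleteOrderedField ℝ hiding (zero)
  open ExactGames ℝ n
  open Field ℝ
  open Sums ℝ n
  open import Algebra.Properties.Semiring.Sum semiring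
    using (sum; sum-cong-≋; sum-replicate-zero; *-distribˡ-sum) renaming (∑-distrib-+ to sum-distrib-+)
  open import Relation.Binary.Reasoning.Setoid setoid

  infix 4 _≋_
  _≋_ : SetFunction → SetFunction → Set
  f ≋ g = ∀ S → S ≢ ⊥ → f S ≈ g S

  Proper : Subset n → Set
  Proper S = S ≢ ⊥ × S ≢ ⊤

  ⟨⟩-cong : ∀ {f g m} → f ≋ g → Game m → ⟨ f , m ⟩ ≈ ⟨ g , m ⟩
  ⟨⟩-cong {f} {g} {m} f≋g m⊥≈0 = ∑-cong λ S → pointwise S (S ≟ ⊥)
    where
    pointwise : ∀ S → Dec (S ≡ ⊥) → f S * m S ≈ g S * m S
    pointwise S (yes ≡.refl) = trans (*-congˡ m⊥≈0) (trans (zeroʳ _) (sym (trans (*-congˡ m⊥≈0) (zeroʳ _))))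
    pointwise S (no S≢⊥)     = *-congʳ (f≋g S S≢⊥)

  χ-in : ∀ {S i} → lookup S i ≡ true → χ S i ≈ 1#
  χ-in eq rewrite eq = refl

  χ-out : ∀ {S i} → lookup S i ≡ false → χ S i ≈ 0#
  χ-out eq rewrite eq = refl

  χ⁻ : Fin n → SetFunction
  χ⁻ i S = χ S i

  sumOver-χ : ∀ S x → sumOver S x ≈ sum (λ i → χ S i * x i)
  sumOver-χ S x = sum-cong-≋ λ i → pointwise i (lookup S i)
    where
    pointwise : ∀ i b → (if b then x i else 0#) ≈ (if b then 1# else 0#) * x i
    pointwise i true  = sym (*-identityˡ _)
    pointwise i false = sym (zeroˡ _)

  sumOver-linear : ∀ S x a y → sumOver S (λ i → x i + a * y i) ≈ sumOver S x + a * sumOver S y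
  sumOver-linear S x a y = begin
    sumOver S (λ i → x i + a * y i)                            ≈⟨ sumOver-χ S _ ⟩
    sum (λ i → χ S i * (x i + a * y i))
      ≈⟨ sum-cong-≋ (λ i → solve 4 (λ c p a q → c :* (p :+ a :* q) := c :* p :+ a :* (c :* q)) refl (χ S i) (x i) a (y i)) ⟩
    sum (λ i → χ S i * x i + a * (χ S i * y i))                ≈⟨ sum-distrib-+ _ (λ i → a * (χ S i * y i)) ⟩
    sum (λ i → χ S i * x i) + sum (λ i → a * (χ S i * y i))    ≈⟨ +-congˡ (*-distribˡ-sum a (λ i → χ S i * y i)) ⟨
    sum (λ i → χ S i * x i) + a * sum (λ i → χ S i * y i)      ≈⟨ +-cong (sumOver-χ S x) (*-congˡ (sumOver-χ S y)) ⟨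
    sumOver S x + a * sumOver S y                              ∎

  sum-zero : ∀ {k} {f : Fin k → Carrier} → (∀ i → f i ≈ 0#) → sum f ≈ 0#
  sum-zero {k} p = trans (sum-cong-≋ p) (sum-replicate-zero k)

  sum-single : ∀ {k} {f : Fin k → Carrier} i → (∀ j → j ≢ i → f j ≈ 0#) → sum f ≈ f i
  sum-single {suc k} zero    p = trans (+-congˡ (sum-zero (λ j → p (suc j) λ ()))) (+-identityʳ _)
  sum-single {suc k} (suc i) p = trans
    (+-cong (p zero λ ()) (sum-single i (λ j j≢i → p (suc j) (j≢i ∘ Fin.suc-injective)))) (+-identityˡ _)

  sumOver-⊥ : ∀ x → sumOver ⊥ x ≈ 0#
  sumOver-⊥ x = sum-zero λ i → reflexive (≡.cong (λ b → if b then x i else 0#) (lookup-⊥ i))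

  sumOver-⊤ : ∀ x → sumOver ⊤ x ≈ sum x
  sumOver-⊤ x = sum-cong-≋ λ i → reflexive (≡.cong (λ b → if b then x i else 0#) (lookup-⊤ i))

  sumOver-zero : ∀ S → sumOver S (λ _ → 0#) ≈ 0#
  sumOver-zero S = trans (sumOver-χ S _) (sum-zero {f = λ i → χ S i * 0#} λ i → zeroʳ _)

  unit : Fin n → Point
  unit i j = if does (j Fin.≟ i) then 1# else 0#

  sumOver-unit : ∀ S i → sumOver S (unit i) ≈ χ S i
  sumOver-unit S i = begin
    sumOver S (unit i)             ≈⟨ sumOver-χ S (unit i) ⟩
    sum (λ j → χ S j * unit i j)   ≈⟨ sum-single i (λ j j≢i → trans (*-congˡ (other j j≢i)) (zeroʳ _)) ⟩
    χ S i * unit i i               ≈⟨ trans (*-congˡ same) (*-identityʳ _) ⟩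
    χ S i                          ∎
    where
    same : unit i i ≈ 1#
    same with i Fin.≟ i
    ... | yes _  = refl
    ... | no i≢i = contradiction ≡.refl i≢i
    other : ∀ j → j ≢ i → unit i j ≈ 0#
    other j j≢i with j Fin.≟ i
    ... | yes j≡i = contradiction j≡i j≢i
    ... | no _    = refl

  -- `χ⁻ i` is the additive game of the i-th unit point, so `u` annihilates all additive games.
  Bal : SetFunction → Set
  Bal u = ∀ i → ⟨ u , χ⁻ i ⟩ ≈ 0#

  Bal-sumOver : ∀ {u} → Bal u → ∀ x → ∑ (λ S → u S * sumOver S x) ≈ 0#
  Bal-sumOver {u} bal x = begin
    ∑ (λ S → u S * sumOver S x)
      ≈⟨ ∑-cong (λ S → trans (*-congˡ (sumOver-χ S x)) (*-distribˡ-sum (u S) (λ i → χ S i * x i))) ⟩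
    ∑ (λ S → sum (λ i → u S * (χ S i * x i)))
      ≈⟨ ∑-sum-comm (λ S i → u S * (χ S i * x i)) ⟩
    sum (λ i → ∑ (λ S → u S * (χ S i * x i)))
      ≈⟨ sum-zero (λ i → trans
           (∑-cong (λ S → solve 3 (λ a b c → a :* (b :* c) := c :* (a :* b)) refl (u S) (χ S i) (x i)))
           (trans (sym (*-distribˡ-∑ (x i) (λ S → u S * χ S i))) (trans (*-congˡ (bal i)) (zeroʳ _)))) ⟩
    0# ∎

  -- The coefficient at ∅ is arbitrary, since m(∅) = 0 for every game m.
  record InK (T : Subset n) (u : SetFunction) : Set where
    constructor _,_
    field
      bal    : Bal u
      nonNeg : ∀ S → Proper S → S ≢ T → 0# ≤ u S

  open InK public

  Valid : SetFunction → Set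
  Valid u = ∀ m → Exact m → ⟨ u , m ⟩ ≤ 0#

  Tight : SetFunction → SetFunction → Set
  Tight u m = Exact m × ⟨ u , m ⟩ ≈ 0#

  -- Since `u` annihilates additive games, `m` may be shifted by any `x`. When `x` lies in the core,
  -- the differences are nonpositive, and they vanish at ⊥ and ⊤ if `m` is a game.
  ⟨⟩-excess : ∀ {u} → Bal u → ∀ m x → ⟨ u , m ⟩ ≈ ∑ (λ S → u S * (m S - sumOver S x))
  ⟨⟩-excess {u} bal m x = begin
    ⟨ u , m ⟩                               ≈⟨ trans (sym (+-identityʳ _)) (+-congˡ (sym -0≈0)) ⟩
    ⟨ u , m ⟩ - 0#                          ≈⟨ +-congˡ (-‿cong (Bal-sumOver bal x)) ⟨
    ⟨ u , m ⟩ - ⟨ u , (λ S → sumOver S x) ⟩ ≈⟨ +-cong (⟨⟩-comm u m) (-‿cong (⟨⟩-comm u _)) ⟩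
    ⟨ m , u ⟩ - ⟨ (λ S → sumOver S x) , u ⟩ ≈⟨ ⟨⟩-distrib-- m (λ S → sumOver S x) u ⟨
    ⟨ (λ S → m S - sumOver S x) , u ⟩       ≈⟨ ⟨⟩-comm _ u ⟩
    ∑ (λ S → u S * (m S - sumOver S x))     ∎

  excess-⊥ : ∀ m → Game m → ∀ x → m ⊥ - sumOver ⊥ x ≈ 0#
  excess-⊥ m m⊥≈0 x = trans (+-cong m⊥≈0 (-‿cong (sumOver-⊥ x))) (-‿inverseʳ 0#)

  excess-⊤ : ∀ m x → Core m x → m ⊤ - sumOver ⊤ x ≈ 0#
  excess-⊤ m x (eff , _) = trans (+-congˡ (-‿cong (trans (sumOver-⊤ x) eff))) (-‿inverseʳ _)

  -- A core element that attains `m T` cancels the one proper coefficient of unknown sign. The bound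
  -- is kept termwise because a vanishing sum will later force every term to vanish.
  excess-term : ∀ {T u m x} → InK T u → Game m → Core m x → sumOver T x ≈ m T →
                ∀ S → u S * (m S - sumOver S x) ≤ 0#
  excess-term {T} {u} {m} {x} (_ , u≥0) m⊥≈0 core tight S with S ≟ ⊥ | S ≟ ⊤ | S ≟ T
  ... | yes ≡.refl | _ | _ = ≤.reflexive (trans (*-congˡ (excess-⊥ m m⊥≈0 x)) (zeroʳ _))
  ... | no _ | yes ≡.refl | _ = ≤.reflexive (trans (*-congˡ (excess-⊤ m x core)) (zeroʳ _))
  ... | no _ | no _ | yes ≡.refl = ≤.reflexive (trans (*-congˡ (trans (+-congˡ (-‿cong tight)) (-‿inverseʳ _))) (zeroʳ _))
  ... | no S≢⊥ | no S≢⊤ | no S≢T = *-nonNeg-nonPos (u≥0 S (S≢⊥ , S≢⊤) S≢T) (x≤y⇒x-y≤0 (proj₂ core S))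

  InK⇒Valid : ∀ {T u} → InK T u → Valid u
  InK⇒Valid {T} {u} u∈K m (m⊥≈0 , exact) with exact T
  ... | x , core , tight = ≤-respˡ (sym (⟨⟩-excess (bal u∈K) m x))
    (∑-nonPos (excess-term u∈K m⊥≈0 core tight))

  Bal-+ : ∀ u a v → Bal u → Bal v → Bal (λ S → u S + a * v S)
  Bal-+ u a v u-bal v-bal i = trans (⟨⟩-distrib-+ u (λ S → a * v S) (χ⁻ i))
    (trans (+-cong (u-bal i) (trans (⟨⟩-scale a v (χ⁻ i)) (trans (*-congˡ (v-bal i)) (zeroʳ a)))) (+-identityˡ 0#))

  InK-+ : ∀ {T u v a} → InK T u → InK T v → 0# ≤ a → InK T (λ S → u S + a * v S)
  InK-+ {u = u} {v} {a} (u-bal , u≥0) (v-bal , v≥0) 0≤a =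
    Bal-+ u a v u-bal v-bal , λ S proper S≢T → +-nonNeg (u≥0 S proper S≢T) (*-nonNeg 0≤a (v≥0 S proper S≢T))

  InK-scale : ∀ {T v a} → InK T v → 0# ≤ a → InK T (λ S → a * v S)
  InK-scale {T} {v} {a} (v-bal , v≥0) 0≤a =
    (λ i → trans (⟨⟩-scale a v (χ⁻ i)) (trans (*-congˡ (v-bal i)) (zeroʳ a))) ,
    λ S proper S≢T → *-nonNeg 0≤a (v≥0 S proper S≢T)

  InK-resp : ∀ {T u v} → u ≋ v → InK T u → InK T v
  InK-resp u≋v (u-bal , u≥0) =
    (λ i → trans (⟨⟩-cong (λ S S≢⊥ → sym (u≋v S S≢⊥)) (χ-out {⊥} {i} (lookup-⊥ i))) (u-bal i)) ,
    λ S proper S≢T → ≤-respʳ (u≋v S (proj₁ proper)) (u≥0 S proper S≢T)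

  -- A point (m , x) is a game m with a candidate core element x T for each T ⊆ N.

  Extended : Set
  Extended = SetFunction × (Subset n → Point)

  _⊞_·_ : Extended → Carrier → Extended → Extended
  (m , x) ⊞ a · (m′ , x′) = (λ S → m S + a * m′ S) , (λ T i → x T i + a * x′ T i)

  open FarkasLemma em ℝ _⊞_·_ ((λ _ → 0#) , (λ _ _ → 0#))

  excess : Carrier → Subset n → Subset n → Functional
  excess a T S = record
    { apply  = λ (m , x) → a * (m S - sumOver S (x T))
    ; linear = λ (m , x) b (m′ , x′) → trans
        (*-congˡ (+-congˡ (-‿cong (sumOver-linear S (x T) b (x′ T)))))
        (solve 6 (λ a b p q r s → a :* ((p :+ b :* q) :- (r :+ b :* s)) := a :* (p :- r) :+ b :* (a :* (q :- s))) refl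
          a b (m S) (m′ S) (sumOver S (x T)) (sumOver S (x′ T)))
    }

  pairing : SetFunction → Functional
  pairing u = record
    { apply  = λ (m , _) → ⟨ u , m ⟩
    ; linear = λ (m , _) a (m′ , _) → trans (⟨⟩-comm u _) (trans (⟨⟩-distrib-+ m (λ S → a * m′ S) u)
        (+-cong (⟨⟩-comm m u) (trans (⟨⟩-scale a m′ u) (*-congˡ (⟨⟩-comm m′ u)))))
    }

  -- The coordinates at which x T is required to attain equality.
  Equality : Subset n → Subset n → Set
  Equality T S = S ≡ ⊥ ⊎ S ≡ ⊤ ⊎ S ≡ T

  equality? : ∀ T S → Dec (Equality T S)
  equality? T S = em

  Constraint : Set
  Constraint = Subset n × Subset n × Bool

  -- An equation is imposed by two opposite inequalities: `true` selects the core inequality at `S`,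
  -- `false` its reverse. Where no equality is required the reverse gets the coefficient zero, so
  -- that it becomes trivial and the index type stays uniform.
  direction : Constraint → Carrier
  direction (T , S , true)  = 1#
  direction (T , S , false) = if does (equality? T S) then - 1# else 0#

  constraint : Constraint → Functional
  constraint c@(T , S , _) = excess (direction c) T S

  constraints : List Constraint
  constraints = List.cartesianProduct (subsets n) (List.cartesianProduct (subsets n) (true List.∷ false List.∷ List.[]))

  ∈-constraints : ∀ c → c ∈ˡ constraints
  ∈-constraints (T , S , b) = ∈-cartesianProduct⁺ (∈-subsets T) (∈-cartesianProduct⁺ (∈-subsets S) (∈-bools b))
    where
    ∈-bools : ∀ b → b ∈ˡ (true List.∷ false List.∷ List.[])
    ∈-bools true  = here ≡.refl
    ∈-bools false = there (here ≡.refl)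

  feasible⇒Exact : ∀ {m x} → (∀ c → apply (constraint c) (m , x) ≤ 0#) → Exact m
  feasible⇒Exact {m} {x} feasible =
    trans (sym (attained ⊥ ⊥ (inj₁ ≡.refl))) (sumOver-⊥ (x ⊥)) ,
    λ T → x T , (trans (sym (sumOver-⊤ (x T))) (attained T ⊤ (inj₂ (inj₁ ≡.refl))) , lower T) ,
          attained T T (inj₂ (inj₂ ≡.refl))
    where
    lower : ∀ T S → m S ≤ sumOver S (x T)
    lower T S = x-y≤0⇒x≤y (≤-respˡ (*-identityˡ _) (feasible (T , S , true)))
    upper : ∀ T S → Equality T S → sumOver S (x T) ≤ m S
    upper T S eq with equality? T S | feasible (T , S , false)
    ... | yes _ | p = 0≤y-x⇒x≤y (-≤0⇒0≤ (≤-respˡ (-1*x≈-x _) p))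
    ... | no ¬eq | _ = contradiction eq ¬eq
    attained : ∀ T S → Equality T S → sumOver S (x T) ≈ m S
    attained T S eq = ≤.antisym (upper T S eq) (lower T S)

  Exact⇒feasible : ∀ {m} (exact : Exact m) c → apply (constraint c) (m , (λ T → proj₁ (proj₂ exact T))) ≤ 0#
  Exact⇒feasible {m} (m⊥≈0 , exact) (T , S , true) =
    *-nonNeg-nonPos 0≤1 (x≤y⇒x-y≤0 (proj₂ (proj₁ (proj₂ (exact T))) S))
  Exact⇒feasible {m} (m⊥≈0 , exact) (T , S , false) with equality? T S
  ... | no _ = ≤.reflexive (zeroˡ _)
  ... | yes eq = ≤.reflexive (trans (*-congˡ (vanishes eq)) (zeroʳ _))
    where
    x = proj₁ (exact T)
    vanishes : Equality T S → m S - sumOver S x ≈ 0#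
    vanishes (inj₁ ≡.refl)        = excess-⊥ m m⊥≈0 x
    vanishes (inj₂ (inj₁ ≡.refl)) = excess-⊤ m x (proj₁ (proj₂ (exact T)))
    vanishes (inj₂ (inj₂ ≡.refl)) = trans (+-congˡ (-‿cong (proj₂ (proj₂ (exact T))))) (-‿inverseʳ _)

  private
    total : (Subset n → SetFunction) → Extended → Carrier
    total d (m , x) = ∑ λ T → ∑ λ S → d T S * (m S - sumOver S (x T))

    -- The conic combinations of the constraints, given by their coefficients. At the equality
    -- coordinates both directions are available, hence no sign is prescribed there.
    Decomposes : Functional → Set
    Decomposes f = Σ (Subset n → SetFunction) λ d →
      (∀ T S → ¬ Equality T S → 0# ≤ d T S) × (∀ y → apply f y ≈ total d y)

    total-plus : ∀ d e a y → total d y + a * total e y ≈ total (λ T S → d T S + a * e T S) y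
    total-plus d e a (m , x) = sym (begin
      ∑ (λ T → ∑ λ S → (d T S + a * e T S) * ex T S)
        ≈⟨ ∑-cong (λ T → trans (∑-cong (λ S → distribʳ (ex T S) (d T S) (a * e T S)))
             (trans (∑-distrib-+ (λ S → d T S * ex T S) (λ S → a * e T S * ex T S))
               (+-congˡ (trans (∑-cong (λ S → *-assoc a (e T S) (ex T S))) (sym (*-distribˡ-∑ a (λ S → e T S * ex T S))))))) ⟩
      ∑ (λ T → ∑ (λ S → d T S * ex T S) + a * ∑ (λ S → e T S * ex T S))
        ≈⟨ ∑-distrib-+ (λ T → ∑ (λ S → d T S * ex T S)) (λ T → a * ∑ (λ S → e T S * ex T S)) ⟩
      ∑ (λ T → ∑ (λ S → d T S * ex T S)) + ∑ (λ T → a * ∑ (λ S → e T S * ex T S))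
        ≈⟨ +-congˡ (*-distribˡ-∑ a (λ T → ∑ (λ S → e T S * ex T S))) ⟨
      total d (m , x) + a * total e (m , x) ∎)
      where
      ex : Subset n → Subset n → Carrier
      ex T S = m S - sumOver S (x T)

    decomposes-cone : ConvexCone Decomposes
    decomposes-cone = record
      { resp  = λ f g f≈g (d , d≥0 , f≈d) → d , d≥0 , λ y → trans (sym (f≈g y)) (f≈d y)
      ; zero⁺ = λ f f≈0 → (λ _ _ → 0#) , (λ _ _ _ → ≤.refl) , λ y → trans (f≈0 y)
          (sym (∑-zero λ T → ∑-zero λ S → zeroˡ _))
      ; plus  = λ f g a 0≤a (d , d≥0 , f≈d) (e , e≥0 , g≈e) h h≈ →
          (λ T S → d T S + a * e T S) ,
          (λ T S neq → +-nonNeg (d≥0 T S neq) (*-nonNeg 0≤a (e≥0 T S neq))) ,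
          λ y → trans (h≈ y) (trans (+-cong (f≈d y) (*-congˡ (g≈e y))) (total-plus d e a y))
      }

    constraint-decomposes : ∀ c → Decomposes (constraint c)
    constraint-decomposes c@(T₀ , S₀ , b) = d , d≥0 , λ (m , x) → sym (begin
      total d (m , x)
        ≈⟨ ∑-single T₀ (λ T T≢T₀ → ∑-zero (λ S → trans (*-congʳ (d-other T S T≢T₀)) (zeroˡ _))) ⟩
      ∑ (λ S → d T₀ S * (m S - sumOver S (x T₀)))
        ≈⟨ ∑-cong (λ S → *-congʳ (d-same S)) ⟩
      ⟨ single S₀ (direction c) , (λ S → m S - sumOver S (x T₀)) ⟩
        ≈⟨ ⟨single,⟩ S₀ (direction c) (λ S → m S - sumOver S (x T₀)) ⟩
      direction c * (m S₀ - sumOver S₀ (x T₀)) ∎)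
      where
      d : Subset n → SetFunction
      d T S = if does (T ≟ T₀) then single S₀ (direction c) S else 0#
      d-same : ∀ S → d T₀ S ≈ single S₀ (direction c) S
      d-same S with T₀ ≟ T₀
      ... | yes _ = refl
      ... | no ≢refl = contradiction ≡.refl ≢refl
      d-other : ∀ T S → T ≢ T₀ → d T S ≈ 0#
      d-other T S T≢T₀ with T ≟ T₀
      ... | yes T≡ = contradiction T≡ T≢T₀
      ... | no _ = refl
      direction≥0 : ∀ b → ¬ Equality T₀ S₀ → 0# ≤ direction (T₀ , S₀ , b)
      direction≥0 true  neq = 0≤1
      direction≥0 false neq with equality? T₀ S₀
      ... | yes eq = contradiction eq neq
      ... | no _ = ≤.refl
      d≥0 : ∀ T S → ¬ Equality T S → 0# ≤ d T S
      d≥0 T S neq with T ≟ T₀ | S ≟ S₀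
      ... | no _ | _ = ≤.refl
      ... | yes _ | no _ = ≤.refl
      ... | yes ≡.refl | yes ≡.refl = direction≥0 b neq

  -- Compare coefficients in the Farkas certificate of `pairing u`. The variables of `x T` occur in
  -- it only through `d T`, and in `pairing u` not at all, so `d T` is balanced; the coefficients of
  -- `m` give the sum.
  Valid⇒decomposition : ∀ {u} → Valid u →
    Σ (Subset n → SetFunction) λ d → (∀ T → InK T (d T)) × (∀ S → u S ≈ ∑ (λ T → d T S))
  Valid⇒decomposition {u} valid =
    d , (λ T → bal′ T , λ S (S≢⊥ , S≢⊤) S≢T → d≥0 T S [ S≢⊥ , [ S≢⊤ , S≢T ]′ ]′) , coordinate
    where
    decomposition : Decomposes (pairing u)
    decomposition = farkas constraints ∈-constraints constraint decomposes-cone constraint-decomposes (pairing u)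
      (λ (m , x) feasible → valid m (feasible⇒Exact {m} {x} feasible))
    d : Subset n → SetFunction
    d = proj₁ decomposition
    d≥0 : ∀ T S → ¬ Equality T S → 0# ≤ d T S
    d≥0 = proj₁ (proj₂ decomposition)
    u≈d : ∀ y → apply (pairing u) y ≈ total d y
    u≈d = proj₂ (proj₂ decomposition)
    coordinate : ∀ S → u S ≈ ∑ (λ T → d T S)
    coordinate S = begin
      u S                    ≈⟨ trans (⟨⟩-comm u (single S 1#)) (trans (⟨single,⟩ S 1# u) (*-identityˡ _)) ⟨
      ⟨ u , single S 1# ⟩    ≈⟨ u≈d (single S 1# , λ _ _ → 0#) ⟩
      ∑ (λ T → ∑ λ R → d T R * (single S 1# R - sumOver R (λ _ → 0#)))
        ≈⟨ ∑-cong (λ T → ∑-cong (λ R → trans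
             (*-congˡ (trans (+-congˡ (trans (-‿cong (sumOver-zero R)) -0≈0)) (+-identityʳ _))) (*-comm _ _))) ⟩
      ∑ (λ T → ⟨ single S 1# , d T ⟩)
        ≈⟨ ∑-cong (λ T → trans (⟨single,⟩ S 1# (d T)) (*-identityˡ _)) ⟩
      ∑ (λ T → d T S) ∎
    bal′ : ∀ T → Bal (d T)
    bal′ T i = begin
      ⟨ d T , χ⁻ i ⟩            ≈⟨ -‿involutive _ ⟨
      - - ⟨ d T , χ⁻ i ⟩        ≈⟨ -‿cong (begin
        - ⟨ d T , χ⁻ i ⟩        ≈⟨ ⟨⟩-neg (d T) (χ⁻ i) ⟨
        ∑ (λ S → - d T S * χ S i)
          ≈⟨ ∑-cong (λ S → trans (solve 2 (λ p q → (:- p) :* q := p :* (:0 :- q)) refl (d T S) (χ S i))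
               (*-congˡ (+-congˡ (-‿cong (sym (trans (reflexive (≡.cong (sumOver S) x-same)) (sumOver-unit S i))))))) ⟩
        ∑ (λ S → d T S * (0# - sumOver S (x T)))
          ≈⟨ ∑-single T (λ T′ T′≢T → ∑-zero (λ S → trans (*-congˡ (trans (+-congˡ (trans
               (-‿cong (trans (reflexive (≡.cong (sumOver S) (x-other T′≢T))) (sumOver-zero S))) -0≈0)) (+-identityʳ _))) (zeroʳ _))) ⟨
        total d ((λ _ → 0#) , x)  ≈⟨ u≈d ((λ _ → 0#) , x) ⟨
        ⟨ u , (λ _ → 0#) ⟩        ≈⟨ ∑-zero (λ S → zeroʳ _) ⟩
        0# ∎) ⟩
      - 0#                      ≈⟨ -0≈0 ⟩
      0#                        ∎
      where
      x : Subset n → Point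
      -- A single nonzero candidate isolates the equation for `d T` at the point `i`.
      x T′ = if does (T′ ≟ T) then unit i else (λ _ → 0#)
      x-same : x T ≡ unit i
      x-same with T ≟ T
      ... | yes _ = ≡.refl
      ... | no ≢refl = contradiction ≡.refl ≢refl
      x-other : ∀ {T′} → T′ ≢ T → x T′ ≡ (λ _ → 0#)
      x-other {T′} T′≢T with T′ ≟ T
      ... | yes T≡ = contradiction T≡ T′≢T
      ... | no _ = ≡.refl

  -- Adding the inequality that `u` pairs nonnegatively with `m` to the constraints of exact games
  -- leaves, by validity of `u`, exactly the face; `a` is the Farkas multiplier of this additional
  -- constraint. The predicate `P` remembers only this multiplier and absorbs the others into an
  -- inequality on feasible points.
  nonPos-on-face⇒Valid : ∀ {u η} → (∀ m → Tight u m → ⟨ η , m ⟩ ≤ 0#) → Valid u →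
    ∃[ a ] 0# ≤ a × Valid (λ S → η S + a * u S)
  nonPos-on-face⇒Valid {u} {η} η≤0 valid = let (a , 0≤a , p) = Pη in
    a , 0≤a , λ m exact →
      ≤-respˡ (sym (trans (⟨⟩-distrib-+ η (λ S → a * u S) m) (+-congˡ (⟨⟩-scale a u m))))
        (p m (λ T → proj₁ (proj₂ exact T)) (Exact⇒feasible exact))
    where
    constraints′ : List (Maybe Constraint)
    constraints′ = nothing List.∷ List.map just constraints
    complete : ∀ c → c ∈ˡ constraints′
    complete nothing  = here ≡.refl
    complete (just c) = there (∈-map⁺ just (∈-constraints c))
    constraint′ : Maybe Constraint → Functional
    constraint′ nothing  = pairing (λ S → - u S)
    constraint′ (just c) = constraint c
    P : Functional → Set
    P f = ∃[ a ] 0# ≤ a × (∀ m x → (∀ c → apply (constraint c) (m , x) ≤ 0#) → apply f (m , x) + a * ⟨ u , m ⟩ ≤ 0#)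
    cone : ConvexCone P
    cone = record
      { resp  = λ f g f≈g (a , 0≤a , p) → a , 0≤a , λ m x feasible → ≤-respˡ (+-congʳ (f≈g (m , x))) (p m x feasible)
      ; zero⁺ = λ f f≈0 → 0# , ≤.refl , λ m x _ → ≤.reflexive (trans (+-cong (f≈0 _) (zeroˡ _)) (+-identityˡ 0#))
      ; plus  = λ f g b 0≤b (a , 0≤a , p) (a′ , 0≤a′ , q) h h≈ →
          a + b * a′ , +-nonNeg 0≤a (*-nonNeg 0≤b 0≤a′) , λ m x feasible → ≤-respˡ
            (trans
              (solve 6 (λ f g b a a′ t → (f :+ a :* t) :+ b :* (g :+ a′ :* t) := (f :+ b :* g) :+ (a :+ b :* a′) :* t) refl
                (apply f (m , x)) (apply g (m , x)) b a a′ ⟨ u , m ⟩)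
              (+-congʳ (sym (h≈ (m , x)))))
            (+-nonPos (p m x feasible) (*-nonNeg-nonPos 0≤b (q m x feasible)))
      }
    Pconstraint′ : ∀ c → P (constraint′ c)
    Pconstraint′ nothing  = 1# , 0≤1 , λ m x _ → ≤.reflexive
      (trans (+-cong (⟨⟩-neg u m) (*-identityˡ _)) (-‿inverseˡ _))
    Pconstraint′ (just c) = 0# , ≤.refl , λ m x feasible →
      ≤-respˡ (sym (trans (+-congˡ (zeroˡ _)) (+-identityʳ _))) (feasible c)
    Pη : P (pairing η)
    Pη = farkas constraints′ complete constraint′ cone Pconstraint′ (pairing η)
      λ (m , x) feasible → let exact = feasible⇒Exact {m} {x} (λ c → feasible (just c)) in
        η≤0 m (exact , ≤.antisym (valid m exact) (-≤0⇒0≤ (≤-respˡ (⟨⟩-neg u m) (feasible nothing))))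

-- Singletons, unions and a pigeonhole argument.

lookup-⁅⁆-same : ∀ {k} (p : Fin k) → lookup ⁅ p ⁆ p ≡ true
lookup-⁅⁆-same p = Vec.[]=⇒lookup (Subₚ.x∈⁅x⁆ p)

lookup-⁅⁆-other : ∀ {k} {p i : Fin k} → i ≢ p → lookup ⁅ p ⁆ i ≡ false
lookup-⁅⁆-other {p = p} {i} i≢p = Bool.¬-not λ eq → i≢p (Subₚ.x∈⁅y⁆⇒x≡y p (Vec.lookup⇒[]= i ⁅ p ⁆ eq))

lookup-∪ : ∀ {k} (S T : Subset k) i → lookup (S Sub.∪ T) i ≡ lookup S i ∨ lookup T i
lookup-∪ S T i = Vec.lookup-zipWith _∨_ i S T

three-points : ∀ {k} → 3 ℕ.≤ k → Σ (Fin k) λ p → Σ (Fin k) λ q → Σ (Fin k) λ r → p ≢ q × p ≢ r × q ≢ r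
three-points (s≤s (s≤s (s≤s z≤n))) = zero , suc zero , suc (suc zero) , (λ ()) , (λ ()) , (λ ())

-- Among three points two lie on the same side of `S`. A singleton in a two-element set has no such
-- pair, so here `3 ≤ k` is used to the full.
two-on-one-side : ∀ {k} → 3 ℕ.≤ k → (S : Subset k) → ∃[ p ] ∃[ q ] p ≢ q × lookup S p ≡ lookup S q
two-on-one-side 3≤k S with three-points 3≤k
... | p , q , r , p≢q , p≢r , q≢r with lookup S p in eqp | lookup S q in eqq | lookup S r in eqr
... | true  | true  | _     = p , q , p≢q , ≡.trans eqp (≡.sym eqq)
... | false | false | _     = p , q , p≢q , ≡.trans eqp (≡.sym eqq)
... | true  | false | true  = p , r , p≢r , ≡.trans eqp (≡.sym eqr)
... | false | true  | false = p , r , p≢r , ≡.trans eqp (≡.sym eqr)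
... | true  | false | false = q , r , q≢r , ≡.trans eqq (≡.sym eqr)
... | false | true  | true  = q , r , q≢r , ≡.trans eqq (≡.sym eqr)

-- Positivity, perturbation and extremality in the cones `InK T`.

module Cone (em : ExcludedMiddle 0ℓ) (ℝ : CompleteOrderedField) (n : ℕ) (3≤n : 3 ℕ.≤ n) where

  open CompleteOrderedField ℝ hiding (zero)
  open ExactGames ℝ n
  open Field ℝ
  open Sums ℝ n
  open Games em ℝ n
  open import Relation.Binary.Reasoning.Setoid setoid

  ≮⇒≥ : ∀ {x y} → ¬ (x < y) → y ≤ x
  ≮⇒≥ {x} {y} x≮y with ≤.total y x
  ... | inj₁ y≤x = y≤x
  ... | inj₂ x≤y with em {P = x ≈ y}
  ... | yes x≈y = ≤.reflexive (sym x≈y)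
  ... | no x≉y  = contradiction (x≤y , x≉y) x≮y

  ≈-stable : ∀ {x y} → ¬ ¬ (x ≈ y) → x ≈ y
  ≈-stable = decidable-stable em

  proper? : ∀ S → Dec (Proper S)
  proper? S = em

  Proper⇒ProperNonempty : ∀ {S} → Proper S → ProperNonempty S
  Proper⇒ProperNonempty {S} (S≢⊥ , S≢⊤) with ≢⊥⇒member S≢⊥ | ≢⊤⇒nonmember S≢⊤
  ... | i , i∈S | j , j∉S =
    (i , Vec.lookup⇒[]= i S i∈S) ,
    (λ _ → Subₚ.∈⊤) , j , Subₚ.∈⊤ , λ j∈S → contradiction (≡.trans (≡.sym (Vec.[]=⇒lookup j∈S)) j∉S) λ ()

  ¬Proper⇒¬ProperNonempty : ∀ {S} → ¬ Proper S → ¬ ProperNonempty S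
  ¬Proper⇒¬ProperNonempty ¬proper ((i , i∈S) , S⊂⊤) = ¬proper
    ((λ { ≡.refl → Subₚ.∉⊥ i∈S }) , λ { ≡.refl → Subₚ.⊂-irref ≡.refl S⊂⊤ })

  ⊥-improper : ¬ Proper ⊥
  ⊥-improper (⊥≢⊥ , _) = ⊥≢⊥ ≡.refl

  ⊤-improper : ¬ Proper ⊤
  ⊤-improper (_ , ⊤≢⊤) = ⊤≢⊤ ≡.refl

  -- `∑ (mask f)` is by definition `∑-such-that properNonempty? f`, the sum in the normalisation of
  -- θ.
  mask : SetFunction → SetFunction
  mask f S = if does (properNonempty? S) then f S else 0#

  mask-proper : ∀ f {S} → Proper S → mask f S ≈ f S
  mask-proper f {S} proper = reflexive
    (≡.cong (λ b → if b then f S else 0#) (dec-true (properNonempty? S) (Proper⇒ProperNonempty proper)))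

  mask-improper : ∀ f {S} → ¬ Proper S → mask f S ≈ 0#
  mask-improper f {S} ¬proper = reflexive
    (≡.cong (λ b → if b then f S else 0#) (dec-false (properNonempty? S) (¬Proper⇒¬ProperNonempty ¬proper)))

  𝟙 : SetFunction
  𝟙 = mask (λ _ → 1#)

  𝟙-game : Game 𝟙
  𝟙-game = mask-improper (λ _ → 1#) ⊥-improper

  -- A linear form that proves to be positive on every element of `InK T` that is nonzero somewhere
  -- away from ⊥. The normalisation of θ says that its negative has size one.
  size : SetFunction → Carrier
  size u = ⟨ u , 𝟙 ⟩

  size-cong : ∀ {u v} → u ≋ v → size u ≈ size v
  size-cong u≋v = ⟨⟩-cong u≋v 𝟙-game

  size-scale : ∀ a u → size (λ S → a * u S) ≈ a * size u
  size-scale a u = ⟨⟩-scale a u 𝟙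

  size-+ : ∀ u a v → size (λ S → u S + a * v S) ≈ size u + a * size v
  size-+ u a v = trans (⟨⟩-distrib-+ u (λ S → a * v S) 𝟙) (+-congˡ (⟨⟩-scale a v 𝟙))

  ∑-mask : ∀ f → ∑ (mask f) ≈ size f
  ∑-mask f = ∑-cong λ S → pointwise S (proper? S)
    where
    pointwise : ∀ S → Dec (Proper S) → mask f S ≈ f S * 𝟙 S
    pointwise S (yes proper) = trans (mask-proper f proper)
      (sym (trans (*-congˡ (mask-proper (λ _ → 1#) proper)) (*-identityʳ _)))
    pointwise S (no ¬proper) = trans (mask-improper f ¬proper)
      (sym (trans (*-congˡ (mask-improper (λ _ → 1#) ¬proper)) (zeroʳ _)))

  ⊥≢⊤ : ⊥ {n} ≢ ⊤
  ⊥≢⊤ = let i = proj₁ (three-points 3≤n) in nonmember⇒≢⊤ i (lookup-⊥ i)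

  improper : ∀ {S} → ¬ Proper S → S ≡ ⊥ ⊎ S ≡ ⊤
  improper {S} ¬proper with S ≟ ⊥ | S ≟ ⊤
  ... | yes p | _     = inj₁ p
  ... | no _  | yes q = inj₂ q
  ... | no p  | no q  = contradiction (p , q) ¬proper

  ∑-split : ∀ f → ∑ f ≈ f ⊥ + f ⊤ + size f
  ∑-split f = begin
    ∑ f                                                          ≈⟨ ∑-cong (λ S → pointwise S (proper? S)) ⟩
    ∑ (λ S → (single ⊥ (f ⊥) S + single ⊤ (f ⊤) S) + mask f S)   ≈⟨ ∑-distrib-+ _ (mask f) ⟩
    ∑ (λ S → single ⊥ (f ⊥) S + single ⊤ (f ⊤) S) + ∑ (mask f)   ≈⟨ +-cong (∑-distrib-+ (single ⊥ (f ⊥)) (single ⊤ (f ⊤))) (∑-mask f) ⟩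
    ∑ (single ⊥ (f ⊥)) + ∑ (single ⊤ (f ⊤)) + size f             ≈⟨ +-congʳ (+-cong (∑-of-single ⊥) (∑-of-single ⊤)) ⟩
    f ⊥ + f ⊤ + size f                                           ∎
    where
    ∑-of-single : ∀ T → ∑ (single T (f T)) ≈ f T
    ∑-of-single T = trans (∑-single T (λ S S≢T → single-other (f T) S≢T)) (single-same T (f T))
    pointwise : ∀ S → Dec (Proper S) → f S ≈ (single ⊥ (f ⊥) S + single ⊤ (f ⊤) S) + mask f S
    pointwise S (yes proper) = sym (trans
      (+-cong (trans (+-cong (single-other _ (proj₁ proper)) (single-other _ (proj₂ proper))) (+-identityˡ 0#)) (mask-proper f proper))
      (+-identityˡ _))
    pointwise S (no ¬proper) with improper ¬proper
    ... | inj₁ ≡.refl = sym (trans (+-cong (trans (+-cong (single-same ⊥ _) (single-other _ ⊥≢⊤)) (+-identityʳ _))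
                               (mask-improper f ¬proper)) (+-identityʳ _))
    ... | inj₂ ≡.refl = sym (trans (+-cong (trans (+-cong (single-other _ (⊥≢⊤ ∘ ≡.sym)) (single-same ⊤ _)) (+-identityˡ _))
                               (mask-improper f ¬proper)) (+-identityʳ _))

  0≤χ : ∀ S i → 0# ≤ χ S i
  0≤χ S i with lookup S i
  ... | true  = 0≤1
  ... | false = ≤.refl

  0≤1-χ : ∀ S i → 0# ≤ 1# - χ S i
  0≤1-χ S i with lookup S i
  ... | true  = ≤.reflexive (sym (-‿inverseʳ 1#))
  ... | false = ≤-respʳ (sym (trans (+-congˡ -0≈0) (+-identityʳ 1#))) 0≤1

  -- An improper `T` leaves no proper set that may be negative, so any proper set, here a singleton,
  -- can take over the exceptional role.
  InK-proper : ∀ {T u} → InK T u → ∃[ T′ ] Proper T′ × InK T′ u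
  InK-proper {T} {u} u∈K with proper? T | three-points 3≤n
  ... | yes proper | _ = T , proper , u∈K
  ... | no ¬proper | p , q , _ , p≢q , _ =
    ⁅ p ⁆ , (member⇒≢⊥ p (lookup-⁅⁆-same p) , nonmember⇒≢⊤ q (lookup-⁅⁆-other (p≢q ∘ ≡.sym))) ,
    (bal u∈K , λ S properS _ → nonNeg u∈K S properS λ { ≡.refl → ¬proper properS })

  module _ {T u} (u∈K : InK T u) {i j} (i∈T : lookup T i ≡ true) (j∉T : lookup T j ≡ false) where

    -- For i ∈ T and j ∉ T this weighs S by 0 if i ∈ S and j ∉ S (so T gets
    -- weight 0) and positively otherwise, if S is proper and nonempty.
    private
      weight : SetFunction
      weight S = (𝟙 S - χ S i) + χ S j

      -- `weight` differs from `𝟙` by additive games, which `u` annihilates.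
      size-weight : size u ≈ ⟨ u , weight ⟩
      size-weight = sym (begin
        ⟨ u , weight ⟩                                 ≈⟨ ⟨⟩-comm u weight ⟩
        ⟨ weight , u ⟩                                 ≈⟨ ⟨⟩-distrib-+ (λ S → 𝟙 S - χ S i) (χ⁻ j) u ⟩
        ⟨ (λ S → 𝟙 S - χ S i) , u ⟩ + ⟨ χ⁻ j , u ⟩     ≈⟨ +-cong (⟨⟩-distrib-- 𝟙 (χ⁻ i) u) (trans (⟨⟩-comm (χ⁻ j) u) (bal u∈K j)) ⟩
        ⟨ 𝟙 , u ⟩ - ⟨ χ⁻ i , u ⟩ + 0#                  ≈⟨ +-identityʳ _ ⟩
        ⟨ 𝟙 , u ⟩ - ⟨ χ⁻ i , u ⟩                       ≈⟨ +-cong (⟨⟩-comm 𝟙 u) (-‿cong (trans (⟨⟩-comm (χ⁻ i) u) (bal u∈K i))) ⟩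
        ⟨ u , 𝟙 ⟩ - 0#                                 ≈⟨ trans (+-congˡ -0≈0) (+-identityʳ _) ⟩
        ⟨ u , 𝟙 ⟩                                      ∎)

      weight-proper : ∀ {S} → Proper S → weight S ≈ (1# - χ S i) + χ S j
      weight-proper proper = +-congʳ (+-congʳ (mask-proper (λ _ → 1#) proper))

      weight-T : Proper T → weight T ≈ 0#
      weight-T proper = trans (weight-proper proper) (trans (+-cong (+-congˡ (-‿cong (χ-in {T} i∈T))) (χ-out {T} j∉T))
        (trans (+-identityʳ _) (-‿inverseʳ 1#)))

      weight-improper : ∀ {S} → ¬ Proper S → weight S ≈ 0#
      weight-improper {S} ¬proper = trans (+-congʳ (+-congʳ (mask-improper (λ _ → 1#) ¬proper))) (cancel (improper ¬proper))
        where
        cancel : S ≡ ⊥ ⊎ S ≡ ⊤ → (0# - χ S i) + χ S j ≈ 0#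
        cancel (inj₁ ≡.refl) = trans (+-cong (+-congˡ (-‿cong (χ-out {⊥} (lookup-⊥ i)))) (χ-out {⊥} (lookup-⊥ j)))
          (trans (+-identityʳ _) (-‿inverseʳ 0#))
        cancel (inj₂ ≡.refl) = trans (+-cong (+-congˡ (-‿cong (χ-in {⊤} (lookup-⊤ i)))) (χ-in {⊤} (lookup-⊤ j)))
          (trans (+-congʳ (+-identityˡ _)) (-‿inverseˡ 1#))

      weighted-nonNeg : ∀ S → 0# ≤ u S * weight S
      weighted-nonNeg S with proper? S | S ≟ T
      ... | no ¬proper | _          = ≤.reflexive (sym (trans (*-congˡ (weight-improper ¬proper)) (zeroʳ _)))
      ... | yes proper | yes ≡.refl = ≤.reflexive (sym (trans (*-congˡ (weight-T proper)) (zeroʳ _)))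
      ... | yes proper | no S≢T     = *-nonNeg (nonNeg u∈K S proper S≢T)
        (≤-respʳ (sym (weight-proper proper)) (+-nonNeg (0≤1-χ S i) (0≤χ S j)))

    size-nonNeg′ : 0# ≤ size u
    size-nonNeg′ = ≤-respʳ (sym size-weight) (∑-nonNeg weighted-nonNeg)

    -- The weighted terms are nonnegative with sum zero, and either alternative makes the weight of
    -- `S` nonzero.
    size-zero-vanishes : size u ≈ 0# → ∀ {S} → Proper S → lookup S i ≡ false ⊎ lookup S j ≡ true → u S ≈ 0#
    size-zero-vanishes size≈0 {S} proper separated =
      x*y≈0⇒x≈0 weight≉0 (∑-nonNeg-zero weighted-nonNeg (trans (sym size-weight) size≈0) S)
      where
      positive : lookup S i ≡ false ⊎ lookup S j ≡ true → (1# - χ S i) + χ S j ≈ 0# → 1# ≈ 0#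
      positive (inj₁ i∉S) eq = trans (sym (trans (+-congˡ (trans (-‿cong (χ-out {S} i∉S)) -0≈0)) (+-identityʳ 1#)))
        (nonNeg-sum-zeroˡ (0≤1-χ S i) (0≤χ S j) eq)
      positive (inj₂ j∈S) eq = trans (sym (χ-in {S} j∈S)) (nonNeg-sum-zeroʳ (0≤1-χ S i) (0≤χ S j) eq)
      weight≉0 : weight S ≉ 0#
      weight≉0 eq = 1≉0 (positive separated (trans (sym (weight-proper proper)) eq))

  size-nonNeg : ∀ {T u} → InK T u → 0# ≤ size u
  size-nonNeg u∈K with InK-proper u∈K
  ... | T′ , (T′≢⊥ , T′≢⊤) , u∈K′ =
    size-nonNeg′ u∈K′ (proj₂ (≢⊥⇒member T′≢⊥)) (proj₂ (≢⊤⇒nonmember T′≢⊤))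

  -- At a point outside `T`, balancedness involves only the coefficient of ⊤; once this is zero, at
  -- a point of `T` it involves only that of `T`.
  Bal-vanishing : ∀ {u T} → Bal u → Proper T → (∀ S → Proper S → S ≢ T → u S ≈ 0#) → ∀ S → S ≢ ⊥ → u S ≈ 0#
  Bal-vanishing {u} {T} u-bal (T≢⊥ , T≢⊤) vanishes S S≢⊥ with ≢⊥⇒member T≢⊥ | ≢⊤⇒nonmember T≢⊤
  ... | i , i∈T | j , j∉T = value (S ≟ ⊤) (S ≟ T)
    where
    u⊤≈0 : u ⊤ ≈ 0#
    u⊤≈0 = begin
      u ⊤            ≈⟨ trans (*-congˡ (χ-in {⊤} (lookup-⊤ j))) (*-identityʳ _) ⟨
      u ⊤ * χ ⊤ j    ≈⟨ ∑-single ⊤ (λ S S≢⊤ → term S S≢⊤ (S ≟ ⊥) (S ≟ T)) ⟨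
      ⟨ u , χ⁻ j ⟩   ≈⟨ u-bal j ⟩
      0#             ∎
      where
      term : ∀ S → S ≢ ⊤ → Dec (S ≡ ⊥) → Dec (S ≡ T) → u S * χ S j ≈ 0#
      term S _ (yes ≡.refl) _ = trans (*-congˡ (χ-out {⊥} (lookup-⊥ j))) (zeroʳ _)
      term S _ (no _) (yes ≡.refl) = trans (*-congˡ (χ-out {T} j∉T)) (zeroʳ _)
      term S S≢⊤ (no S≢⊥) (no S≢T) = trans (*-congʳ (vanishes S (S≢⊥ , S≢⊤) S≢T)) (zeroˡ _)
    uT≈0 : u T ≈ 0#
    uT≈0 = begin
      u T            ≈⟨ trans (*-congˡ (χ-in {T} i∈T)) (*-identityʳ _) ⟨
      u T * χ T i    ≈⟨ ∑-single T (λ S S≢T → term S S≢T (S ≟ ⊥) (S ≟ ⊤)) ⟨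
      ⟨ u , χ⁻ i ⟩   ≈⟨ u-bal i ⟩
      0#             ∎
      where
      term : ∀ S → S ≢ T → Dec (S ≡ ⊥) → Dec (S ≡ ⊤) → u S * χ S i ≈ 0#
      term S _ (yes ≡.refl) _ = trans (*-congˡ (χ-out {⊥} (lookup-⊥ i))) (zeroʳ _)
      term S _ (no _) (yes ≡.refl) = trans (*-congʳ u⊤≈0) (zeroˡ _)
      term S S≢T (no S≢⊥) (no S≢⊤) = trans (*-congʳ (vanishes S (S≢⊥ , S≢⊤) S≢T)) (zeroˡ _)
    value : Dec (S ≡ ⊤) → Dec (S ≡ T) → u S ≈ 0#
    value (yes ≡.refl) _ = u⊤≈0
    value (no _) (yes ≡.refl) = uT≈0
    value (no S≢⊤) (no S≢T) = vanishes S (S≢⊥ , S≢⊤) S≢T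

  -- For `S ≢ T`, a point in which they differ is used as `i` if it lies in `T` and as `j`
  -- otherwise, which gives `S` a positive weight. `Bal-vanishing` settles the coefficients at `T`
  -- and ⊤.
  size-zero : ∀ {T u} → InK T u → size u ≈ 0# → ∀ S → S ≢ ⊥ → u S ≈ 0#
  size-zero {u = u} u∈K size≈0 with InK-proper u∈K
  ... | T , proper@(T≢⊥ , T≢⊤) , u∈K′ = Bal-vanishing (bal u∈K′) proper λ S properS S≢T → vanishes S properS (lookup-differs S≢T)
    where
    vanishes : ∀ S → Proper S → (∃[ i ] lookup S i ≢ lookup T i) → u S ≈ 0#
    vanishes S properS (i , differ) with lookup S i in eqS | lookup T i in eqT
    ... | false | true  = size-zero-vanishes u∈K′ eqT (proj₂ (≢⊤⇒nonmember T≢⊤)) size≈0 properS (inj₁ eqS)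
    ... | true  | false = size-zero-vanishes u∈K′ (proj₂ (≢⊥⇒member T≢⊥)) eqT size≈0 properS (inj₂ eqS)
    ... | true  | true  = contradiction ≡.refl differ
    ... | false | false = contradiction ≡.refl differ

  -- The ratio test of the simplex method: the largest `ε` that keeps `c - ε d` nonnegative on `Q`,
  -- together with an index where the bound is attained (`Tie`). The hypothesis `d≤0` ensures that
  -- each ratio to be compared is positive.
  module Ratio (c d : SetFunction) (Q : Subset n → Set)
    (c≥0 : ∀ S → Q S → 0# ≤ c S) (d≤0 : ∀ S → Q S → c S ≈ 0# → d S ≤ 0#) where

    Tie : Carrier → Set
    Tie ε = ∃[ S ] Q S × 0# < d S × c S ≈ ε * d S

    private
      shrink : ∀ {S ρ ε} → Q S → 0# ≤ ρ → ρ ≤ ε → 0# ≤ c S - ε * d S → 0# ≤ c S - ρ * d S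
      shrink {S} {ρ} {ε} QS 0≤ρ ρ≤ε p with ≤.total 0# (d S)
      ... | inj₁ 0≤d = ≤-respʳ
        (solve 4 (λ c ε ρ d → (c :- ε :* d) :+ (ε :- ρ) :* d := c :- ρ :* d) refl (c S) ε ρ (d S))
        (+-nonNeg p (*-nonNeg (x≤y⇒0≤y-x ρ≤ε) 0≤d))
      ... | inj₂ d≤0 = +-nonNeg (c≥0 S QS) (≤0⇒0≤- (*-nonNeg-nonPos 0≤ρ d≤0))

      ratio-list : ∀ xs → All (λ S → Q S → d S ≤ 0#) xs ⊎
        ∃[ ε ] 0# < ε × All (λ S → Q S → 0# ≤ c S - ε * d S) xs × Tie ε
      ratio-list List.[] = inj₁ All.[]
      ratio-list (S List.∷ xs) with em {P = Q S × ¬ (d S ≤ 0#)} | ratio-list xs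
      ... | no ¬p | inj₁ all = inj₁ ((λ QS → decidable-stable em λ d≰0 → ¬p (QS , d≰0)) All.∷ all)
      ... | no ¬p | inj₂ (ε , 0<ε , all , tie) = inj₂ (ε , 0<ε ,
        (λ QS → +-nonNeg (c≥0 S QS) (≤0⇒0≤- (*-nonNeg-nonPos (proj₁ 0<ε) (decidable-stable em λ d≰0 → ¬p (QS , d≰0)))))
          All.∷ all , tie)
      ... | yes (QS , d≰0) | rest with positive-inverse (≰⇒> d≰0)
      ... | κ , 0<κ , d*κ≈1 = choose rest
        where
        0<c : 0# < c S
        0<c = c≥0 S QS , λ 0≈c → d≰0 (d≤0 S QS (sym 0≈c))
        ρ : Carrier
        ρ = c S * κ
        0<ρ : 0# < ρ
        0<ρ = *-pos 0<c 0<κ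
        c≈ρd : c S ≈ ρ * d S
        c≈ρd = sym (trans (solve 3 (λ c κ d → c :* κ :* d := c :* (d :* κ)) refl (c S) κ (d S))
          (trans (*-congˡ d*κ≈1) (*-identityʳ _)))
        tieρ : Tie ρ
        tieρ = S , QS , ≰⇒> d≰0 , c≈ρd
        choose : All (λ S → Q S → d S ≤ 0#) xs ⊎ (∃[ ε ] 0# < ε × All (λ S → Q S → 0# ≤ c S - ε * d S) xs × Tie ε) →
          All (λ S → Q S → d S ≤ 0#) (S List.∷ xs) ⊎
          ∃[ ε ] 0# < ε × All (λ S → Q S → 0# ≤ c S - ε * d S) (S List.∷ xs) × Tie ε
        choose (inj₁ all) = inj₂ (ρ , 0<ρ ,
          (λ _ → ≤.reflexive (sym (trans (+-congʳ c≈ρd) (-‿inverseʳ _)))) All.∷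
          All.map (λ {R} d≤0 QR → +-nonNeg (c≥0 R QR) (≤0⇒0≤- (*-nonNeg-nonPos (proj₁ 0<ρ) (d≤0 QR)))) all , tieρ)
        choose (inj₂ (ε , 0<ε , all , tie)) with ≤.total ρ ε
        ... | inj₁ ρ≤ε = inj₂ (ρ , 0<ρ ,
          (λ _ → ≤.reflexive (sym (trans (+-congʳ c≈ρd) (-‿inverseʳ _)))) All.∷
          All.map (λ {R} p QR → shrink QR (proj₁ 0<ρ) ρ≤ε (p QR)) all , tieρ)
        ... | inj₂ ε≤ρ = inj₂ (ε , 0<ε ,
          (λ _ → ≤-respʳ (sym (trans (+-congʳ c≈ρd) (solve 3 (λ ρ ε d → ρ :* d :- ε :* d := (ρ :- ε) :* d) refl ρ ε (d S))))
            (*-nonNeg (x≤y⇒0≤y-x ε≤ρ) (proj₁ (≰⇒> d≰0)))) All.∷ all , tie)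

    ratio : (∀ S → Q S → d S ≤ 0#) ⊎ ∃[ ε ] 0# < ε × (∀ S → Q S → 0# ≤ c S - ε * d S) × Tie ε
    ratio with ratio-list (subsets n)
    ... | inj₁ all = inj₁ λ S → All.lookup all (∈-subsets S)
    ... | inj₂ (ε , 0<ε , all , tie) = inj₂ (ε , 0<ε , (λ S → All.lookup all (∈-subsets S)) , tie)

    perturbation : ∃[ ε ] 0# < ε × (∀ S → Q S → 0# ≤ c S - ε * d S)
    perturbation with ratio
    ... | inj₁ d≤0 = 1# , 0<1 , λ S QS → +-nonNeg (c≥0 S QS) (≤0⇒0≤- (*-nonNeg-nonPos 0≤1 (d≤0 S QS)))
    ... | inj₂ (ε , 0<ε , p , _) = ε , 0<ε , p

  Bal-- : ∀ u ε d → Bal u → Bal d → Bal (λ S → u S - ε * d S)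
  Bal-- u ε d u-bal d-bal i = trans (⟨⟩-distrib-- u (λ S → ε * d S) (χ⁻ i))
    (trans (+-cong (u-bal i) (-‿cong (trans (⟨⟩-scale ε d (χ⁻ i)) (trans (*-congˡ (d-bal i)) (zeroʳ ε))))) (-‿inverseʳ 0#))

  Rigid : SetFunction → Set
  Rigid u = ∀ η → (∀ m → Tight u m → ⟨ η , m ⟩ ≈ 0#) → ∃[ t ] η ≋ (λ S → t * u S)

  -- For a small positive `ε` the vector `u - ε d` still has `T` as its only possible negative set.
  -- So `u` is the sum of two valid forms, `u - ε d` and `ε d`, and where `u` vanishes both must
  -- vanish. No condition on `d` is needed at `T`, where `u` may have any sign.
  perturbation-vanishes : ∀ {T T′ u d} → InK T u → InK T′ d →
    (∀ S → Proper S → S ≢ T → u S ≈ 0# → d S ≤ 0#) → ∀ m → Tight u m → ⟨ d , m ⟩ ≈ 0#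
  perturbation-vanishes {T} {T′} {u} {d} u∈K d∈K d≤0 m (exact , tight) = x*y≈0⇒y≈0 (<⇒≉ 0<ε)
    (nonPos-sum-zeroʳ
      (InK⇒Valid {T} {λ S → u S - ε * d S} (Bal-- u ε d (bal u∈K) (bal d∈K) , λ S proper S≢T → p S (proper , S≢T)) m exact)
      (*-nonNeg-nonPos (proj₁ 0<ε) (InK⇒Valid d∈K m exact))
      (begin
        ⟨ (λ S → u S - ε * d S) , m ⟩ + ε * ⟨ d , m ⟩
          ≈⟨ +-congʳ (trans (⟨⟩-distrib-- u (λ S → ε * d S) m) (+-congˡ (-‿cong (⟨⟩-scale ε d m)))) ⟩
        (⟨ u , m ⟩ - ε * ⟨ d , m ⟩) + ε * ⟨ d , m ⟩
          ≈⟨ solve 2 (λ x y → (x :- y) :+ y := x) refl _ _ ⟩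
        ⟨ u , m ⟩ ≈⟨ tight ⟩
        0# ∎))
    where
    open Ratio u d (λ S → Proper S × S ≢ T)
      (λ S (proper , S≢T) → nonNeg u∈K S proper S≢T) (λ S (proper , S≢T) → d≤0 S proper S≢T)
    ε : Carrier
    ε = proj₁ perturbation
    0<ε : 0# < ε
    0<ε = proj₁ (proj₂ perturbation)
    p : ∀ S → Proper S × S ≢ T → 0# ≤ u S - ε * d S
    p = proj₂ (proj₂ perturbation)

  -- All summands of `u` vanish on the face, so by rigidity they are multiples of `u`. One of
  -- nonzero size is a positive multiple, since `size` is nonnegative on each cone, and it passes
  -- its membership on to `u`.
  Valid∧Rigid⇒InK : ∀ {u} → Valid u → Rigid u → size u ≈ 1# → ∃[ T ] InK T u
  Valid∧Rigid⇒InK {u} valid rigid size≈1 = T , InK-resp u≋κd (InK-scale (d∈K T) (proj₁ 0<κ))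
    where
    decomposition = Valid⇒decomposition valid
    d : Subset n → SetFunction
    d = proj₁ decomposition
    d∈K : ∀ T → InK T (d T)
    d∈K = proj₁ (proj₂ decomposition)
    pairing-d : ∀ m → ∑ (λ T → ⟨ d T , m ⟩) ≈ ⟨ u , m ⟩
    pairing-d m = trans (⟨⟩-∑ d m) (∑-cong λ S → *-congʳ (sym (proj₂ (proj₂ decomposition) S)))
    vanishes : ∀ T m → Tight u m → ⟨ d T , m ⟩ ≈ 0#
    vanishes T m (exact , tight) =
      ∑-nonPos-zero (λ T → InK⇒Valid (d∈K T) m exact) (trans (pairing-d m) tight) T
    -- Sizes add up to `size u`, which is one, so they cannot all be zero.
    nonzero : ∃[ T ] size (d T) ≉ 0#
    nonzero = decidable-stable em λ ∄T →
      1≉0 (trans (sym size≈1) (trans (sym (pairing-d 𝟙)) (∑-zero λ T → ≈-stable λ ≉0 → ∄T (T , ≉0))))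
    T : Subset n
    T = proj₁ nonzero
    t : Carrier
    t = proj₁ (rigid (d T) (vanishes T))
    d≋tu : d T ≋ (λ S → t * u S)
    d≋tu = proj₂ (rigid (d T) (vanishes T))
    t≈size : t ≈ size (d T)
    t≈size = sym (trans (size-cong d≋tu) (trans (size-scale t u) (trans (*-congˡ size≈1) (*-identityʳ t))))
    0<t : 0# < t
    0<t = ≤-respʳ (sym t≈size) (size-nonNeg (d∈K T)) , λ 0≈t → proj₂ nonzero (trans (sym t≈size) (sym 0≈t))
    κ : Carrier
    κ = proj₁ (positive-inverse 0<t)
    0<κ : 0# < κ
    0<κ = proj₁ (proj₂ (positive-inverse 0<t))
    u≋κd : (λ S → κ * d T S) ≋ u
    u≋κd S S≢⊥ = begin
      κ * d T S      ≈⟨ *-congˡ (d≋tu S S≢⊥) ⟩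
      κ * (t * u S)  ≈⟨ solve 3 (λ κ t u → κ :* (t :* u) := t :* κ :* u) refl κ t (u S) ⟩
      t * κ * u S    ≈⟨ *-congʳ (proj₂ (proj₂ (positive-inverse 0<t))) ⟩
      1# * u S       ≈⟨ *-identityˡ _ ⟩
      u S            ∎

-- From facets to indecomposable set systems.

module Systems (em : ExcludedMiddle 0ℓ) (ℝ : CompleteOrderedField) (n : ℕ) (3≤n : 3 ℕ.≤ n) where

  open CompleteOrderedField ℝ hiding (zero)
  open ExactGames ℝ n
  open Field ℝ
  open Sums ℝ n
  open Games em ℝ n
  open Cone em ℝ n 3≤n
  open import Algebra.Properties.Semiring.Sum semiring using (sum-cong-≋) renaming (∑-distrib-+ to sum-distrib-+)
  open import Relation.Binary.Reasoning.Setoid setoid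

  -- Combinations of proper sets yielding the constant r correspond to balanced
  -- vectors by taking − r as the coefficient of N.
  extend : SetFunction → Carrier → SetFunction
  extend c r S = c S + single ⊤ (- r) S

  extend-≢⊤ : ∀ c r {S} → S ≢ ⊤ → extend c r S ≈ c S
  extend-≢⊤ c r S≢⊤ = trans (+-congˡ (single-other (- r) S≢⊤)) (+-identityʳ _)

  extend-⊤ : ∀ c r → c ⊤ ≈ 0# → extend c r ⊤ ≈ - r
  extend-⊤ c r c⊤≈0 = trans (+-cong c⊤≈0 (single-same ⊤ (- r))) (+-identityˡ _)

  Bal-extend : ∀ c r → c Yields constant r → Bal (extend c r)
  Bal-extend c r yields i = begin
    ⟨ extend c r , χ⁻ i ⟩                          ≈⟨ ⟨⟩-distrib-+ c (single ⊤ (- r)) (χ⁻ i) ⟩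
    ⟨ c , χ⁻ i ⟩ + ⟨ single ⊤ (- r) , χ⁻ i ⟩       ≈⟨ +-cong (yields i) (⟨single,⟩ ⊤ (- r) (χ⁻ i)) ⟩
    r + - r * χ ⊤ i                                ≈⟨ +-congˡ (trans (*-congˡ (χ-in {⊤} (lookup-⊤ i))) (*-identityʳ _)) ⟩
    r - r                                          ≈⟨ -‿inverseʳ r ⟩
    0#                                             ∎

  mask-yields : ∀ {u} → Bal u → mask u Yields constant (- u ⊤)
  mask-yields {u} u-bal i = begin
    ⟨ mask u , χ⁻ i ⟩                                 ≈⟨ ∑-cong (λ S → *-congʳ-at S (proper? S)) ⟩
    ⟨ (λ S → u S - single ⊤ (u ⊤) S) , χ⁻ i ⟩         ≈⟨ ⟨⟩-distrib-- u (single ⊤ (u ⊤)) (χ⁻ i) ⟩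
    ⟨ u , χ⁻ i ⟩ - ⟨ single ⊤ (u ⊤) , χ⁻ i ⟩          ≈⟨ +-cong (u-bal i) (-‿cong (⟨single,⟩ ⊤ (u ⊤) (χ⁻ i))) ⟩
    0# - u ⊤ * χ ⊤ i                                  ≈⟨ +-identityˡ _ ⟩
    - (u ⊤ * χ ⊤ i)                                   ≈⟨ -‿cong (trans (*-congˡ (χ-in {⊤} (lookup-⊤ i))) (*-identityʳ _)) ⟩
    - u ⊤                                             ∎
    where
    *-congʳ-at : ∀ S → Dec (Proper S) → mask u S * χ S i ≈ (u S - single ⊤ (u ⊤) S) * χ S i
    *-congʳ-at S (yes proper) = *-congʳ (trans (mask-proper u proper) (sym (trans
      (+-congˡ (trans (-‿cong (single-other _ (proj₂ proper))) -0≈0)) (+-identityʳ _))))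
    *-congʳ-at S (no ¬proper) with improper ¬proper
    ... | inj₁ ≡.refl = trans (*-congˡ χ⊥≈0) (trans (zeroʳ _) (sym (trans (*-congˡ χ⊥≈0) (zeroʳ _))))
      where
      χ⊥≈0 : χ ⊥ i ≈ 0#
      χ⊥≈0 = χ-out {⊥} (lookup-⊥ i)
    ... | inj₂ ≡.refl = *-congʳ (trans (mask-improper u ¬proper)
      (sym (trans (+-congˡ (-‿cong (single-same ⊤ (u ⊤)))) (-‿inverseʳ _))))

  support : SetFunction → SetSystem
  support u S = Proper S × u S ≉ 0#

  ∉support⇒zero : ∀ {u S} → Proper S → S ∉ support u → u S ≈ 0#
  ∉support⇒zero proper S∉ = ≈-stable λ u≉0 → S∉ (proper , u≉0)

  mask-coefficients : ∀ u → Coefficients (support u) (mask u)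
  mask-coefficients u S S∉ with proper? S
  ... | yes proper = trans (mask-proper u proper) (∉support⇒zero {u} proper S∉)
  ... | no ¬proper = mask-improper u ¬proper

  mask-semiConic : ∀ {T u} → InK T u → SemiConic (mask u)
  mask-semiConic {T} {u} u∈K S S′ S<0 S′<0 = ≡.trans (negative⇒≡T S S<0) (≡.sym (negative⇒≡T S′ S′<0))
    where
    negative⇒≡T : ∀ S → mask u S < 0# → S ≡ T
    negative⇒≡T S (≤0 , ≉0) = decidable-stable em λ S≢T → ≉0 (≤.antisym ≤0 (nonNegative S≢T (proper? S)))
      where
      nonNegative : S ≢ T → Dec (Proper S) → 0# ≤ mask u S
      nonNegative S≢T (yes proper) = ≤-respʳ (sym (mask-proper u proper)) (nonNeg u∈K S proper S≢T)
      nonNegative S≢T (no ¬proper) = ≤.reflexive (sym (mask-improper u ¬proper))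

  support-nonempty : ∀ {u} → size u ≉ 0# → ∃[ S ] S ∈ support u
  support-nonempty {u} size≉0 = decidable-stable em λ empty → size≉0 (trans (sym (∑-mask u))
    (∑-zero λ S → mask-coefficients u S λ S∈ → empty (S , S∈)))

  support-semiBalanced : ∀ {T u} → InK T u → (∃[ S ] S ∈ support u) → SemiBalanced (support u)
  support-semiBalanced {T} {u} u∈K nonempty =
    (nonempty , ⊥-improper ∘ proj₁ , ⊤-improper ∘ proj₁) ,
    mask u , - u ⊤ , mask-coefficients u , mask-semiConic u∈K ,
    (λ S (proper , u≉0) mask≈0 → u≉0 (trans (sym (mask-proper u proper)) mask≈0)) ,
    mask-yields (bal u∈K)

  NonTrivial⇒Proper : ∀ {𝒮} → NonTrivial 𝒮 → ∀ {S} → S ∈ 𝒮 → Proper S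
  NonTrivial⇒Proper (_ , ⊥∉ , ⊤∉) S∈ = (λ { ≡.refl → ⊥∉ S∈ }) , λ { ≡.refl → ⊤∉ S∈ }

  semiConic⇒InK : ∀ {c r} → SemiConic c → c Yields constant r → ∃[ T ] InK T (extend c r)
  semiConic⇒InK {c} {r} semiConic yields with em {P = ∃[ T ] c T < 0#}
  ... | yes (T , cT<0) = T , Bal-extend c r yields , λ S (_ , S≢⊤) S≢T →
    ≤-respʳ (sym (extend-≢⊤ c r S≢⊤)) (≮⇒≥ λ cS<0 → S≢T (semiConic S T cS<0 cT<0))
  -- Without a negative coefficient, ⊥ serves as a dummy exceptional set: it leaves nonnegativity
  -- imposed at all proper sets.
  ... | no ∄T = ⊥ , Bal-extend c r yields , λ S (_ , S≢⊤) _ →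
    ≤-respʳ (sym (extend-≢⊤ c r S≢⊤)) (≮⇒≥ λ cS<0 → ∄T (S , cS<0))

  sumOver-∪ : ∀ S T x → (∀ i → lookup S i ≡ true → lookup T i ≡ false) →
              sumOver (S Sub.∪ T) x ≈ sumOver S x + sumOver T x
  sumOver-∪ S T x disjoint = trans (sum-cong-≋ pointwise)
    (sum-distrib-+ (λ i → if lookup S i then x i else 0#) (λ i → if lookup T i then x i else 0#))
    where
    pointwise : ∀ i → (if lookup (S Sub.∪ T) i then x i else 0#) ≈
                      (if lookup S i then x i else 0#) + (if lookup T i then x i else 0#)
    pointwise i rewrite lookup-∪ S T i with lookup S i | disjoint i
    ... | true  | d rewrite d ≡.refl = sym (+-identityʳ _)
    ... | false | _ = sym (+-identityˡ _)

  Fixed : SetFunction → Subset n → Set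
  Fixed u G = ∀ m x → Tight u m → Core m x → sumOver G x ≈ m G

  lookup-∁ : ∀ (S : Subset n) i → lookup (∁ S) i ≡ not (lookup S i)
  lookup-∁ S i = Vec.lookup-map i not S

  -- For a tight game all core elements give `∁ A` the same value m(N) - m(A), and by exactness one
  -- of them attains m(∁ A).
  Fixed-∁ : ∀ {u A} → Fixed u A → Fixed u (∁ A)
  Fixed-∁ {u} {A} fixed m x tight core with proj₂ (proj₁ tight) (∁ A)
  ... | y , y-core , y-tight = trans (complement x core) (trans (sym (complement y y-core)) y-tight)
    where
    complement : ∀ z → Core m z → sumOver (∁ A) z ≈ m ⊤ - m A
    complement z z-core = begin
      sumOver (∁ A) z                                ≈⟨ solve 2 (λ a b → b := (a :+ b) :- a) refl (sumOver A z) _ ⟩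
      (sumOver A z + sumOver (∁ A) z) - sumOver A z  ≈⟨ +-cong (begin
        sumOver A z + sumOver (∁ A) z
          ≈⟨ sumOver-∪ A (∁ A) z (λ i i∈A → ≡.trans (lookup-∁ A i) (≡.cong not i∈A)) ⟨
        sumOver (A Sub.∪ ∁ A) z  ≈⟨ reflexive (≡.cong (λ S → sumOver S z) (Subₚ.p∪∁p≡⊤ A)) ⟩
        sumOver ⊤ z              ≈⟨ trans (sumOver-⊤ z) (proj₁ z-core) ⟩
        m ⊤                      ∎) (-‿cong (fixed m z tight z-core)) ⟩
      m ⊤ - m A                                      ∎

  -- On the face m(G ∪ {p}) = m(G) + m({p}) whenever all core elements give G
  -- the value m(G); this is an equation different from the one defining the face.
  ¬Fixed : ∀ {u G} → Rigid u → u ⊤ ≉ 0# → Fixed u G → G ≢ ⊥ →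
           ∀ p q → p ≢ q → lookup G p ≡ false → lookup G q ≢ false
  ¬Fixed {u} {G} rigid u⊤≉0 fixed G≢⊥ p q p≢q p∉G q∉G = 1≉0 (trans (sym g-P) (trans (g≋tu P P≢⊥) (trans (*-congʳ t≈0) (zeroˡ _))))
    where
    P : Subset n
    P = ⁅ p ⁆
    p∈P : lookup P p ≡ true
    p∈P = lookup-⁅⁆-same p
    q∉P : lookup P q ≡ false
    q∉P = lookup-⁅⁆-other (p≢q ∘ ≡.sym)
    P≢⊥ : P ≢ ⊥
    P≢⊥ = member⇒≢⊥ p p∈P
    GP : Subset n
    GP = G Sub.∪ P
    q∉GP : lookup GP q ≡ false
    q∉GP = ≡.trans (lookup-∪ G P q) (≡.cong₂ _∨_ q∉G q∉P)
    P≢G : P ≢ G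
    P≢G P≡G with () ← ≡.trans (≡.sym p∈P) (≡.trans (≡.cong (λ S → lookup S p) P≡G) p∉G)
    P≢GP : P ≢ GP
    P≢GP P≡GP with ≢⊥⇒member G≢⊥
    ... | i , i∈G with i Fin.≟ p
    ... | yes ≡.refl with () ← ≡.trans (≡.sym i∈G) p∉G
    ... | no i≢p with () ← ≡.trans (≡.sym (lookup-⁅⁆-other i≢p))
      (≡.trans (≡.cong (λ S → lookup S i) P≡GP) (≡.trans (lookup-∪ G P i) (≡.cong (_∨ lookup P i) i∈G)))
    split : ∀ x → sumOver GP x ≈ sumOver G x + sumOver P x
    split x = sumOver-∪ G P x λ i i∈G → lookup-⁅⁆-other {p = p} {i} λ { ≡.refl → contradiction (≡.trans (≡.sym i∈G) p∉G) λ () }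
    g : SetFunction
    g S = single P 1# S + single G 1# S - single GP 1# S
    pairing-g : ∀ m → ⟨ g , m ⟩ ≈ m P + m G - m GP
    pairing-g m = trans (⟨⟩-distrib-- _ (single GP 1#) m) (+-cong
      (trans (⟨⟩-distrib-+ (single P 1#) (single G 1#) m)
        (+-cong (trans (⟨single,⟩ P 1# m) (*-identityˡ _)) (trans (⟨single,⟩ G 1# m) (*-identityˡ _))))
      (-‿cong (trans (⟨single,⟩ GP 1# m) (*-identityˡ _))))
    additive : ∀ m → Tight u m → m P + m G ≈ m GP
    additive m tight with proj₂ (proj₁ tight) GP | proj₂ (proj₁ tight) P
    ... | x , x-core , x-GP | y , y-core , y-P = ≤.antisym
      -- A core element attaining `m GP` gives one inequality. For the other, a core element
      -- attaining `m P` attains `m G` as well, because `G` is fixed.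
      (≤-resp (+-comm _ _) (trans (sym (split x)) x-GP) (+-mono-≤ (proj₂ x-core G) (proj₂ x-core P)))
      (≤-respʳ (trans (split y) (trans (+-cong (fixed m y tight y-core) y-P) (+-comm _ _))) (proj₂ y-core GP))
    t,g≋tu : ∃[ t ] g ≋ (λ S → t * u S)
    t,g≋tu = rigid g λ m tight → trans (pairing-g m) (trans (+-congʳ (additive m tight)) (-‿inverseʳ _))
    t : Carrier
    t = proj₁ t,g≋tu
    g≋tu : g ≋ (λ S → t * u S)
    g≋tu = proj₂ t,g≋tu
    vanish : ∀ {S} → S ≢ P → S ≢ G → S ≢ GP → g S ≈ 0#
    vanish S≢P S≢G S≢GP = trans
      (+-cong (trans (+-cong (single-other 1# S≢P) (single-other 1# S≢G)) (+-identityˡ 0#)) (-‿cong (single-other 1# S≢GP)))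
      (-‿inverseʳ 0#)
    -- `q` lies in none of the three sets, so none of them is ⊤. As `u ⊤` is nonzero, the factor `t`
    -- must then vanish, although `g` is nonzero at `P`.
    g-⊤ : g ⊤ ≈ 0#
    g-⊤ = vanish (nonmember⇒≢⊤ q q∉P ∘ ≡.sym) (nonmember⇒≢⊤ q q∉G ∘ ≡.sym) (nonmember⇒≢⊤ q q∉GP ∘ ≡.sym)
    g-P : g P ≈ 1#
    g-P = trans
      (+-cong (trans (+-cong (single-same P 1#) (single-other 1# P≢G)) (+-identityʳ 1#))
        (trans (-‿cong (single-other 1# P≢GP)) -0≈0))
      (+-identityʳ 1#)
    t≈0 : t ≈ 0#
    t≈0 = x*y≈0⇒x≈0 u⊤≉0 (trans (sym (g≋tu ⊤ (⊥≢⊤ ∘ ≡.sym))) g-⊤)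

  module FacetSystem {T u} (u∈K : InK T u) (rigid : Rigid u) (size≈1 : size u ≈ 1#) where

    𝒮 : SetSystem
    𝒮 = support u

    nonempty : ∃[ S ] S ∈ 𝒮
    nonempty = support-nonempty {u} λ size≈0 → 1≉0 (trans (sym size≈1) size≈0)

    outside-zero : ∀ {S} → u S ≈ 0# → S ∉ 𝒮
    outside-zero u≈0 (_ , u≉0) = u≉0 u≈0

    -- This says that `u` is extreme. Below, a violation of each defining property of the set system
    -- yields a vector `d` to which it applies.
    proportional : ∀ {T′ d} → InK T′ d → (∀ S → Proper S → S ≢ T → u S ≈ 0# → d S ≤ 0#) →
                   ∃[ t ] d ≋ (λ S → t * u S)
    proportional {T′} {d} d∈K d≤0 = rigid d (perturbation-vanishes u∈K d∈K d≤0)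

    -- A semi-balanced subsystem yields a vector proportional to `u`. A set of `𝒮` missing from it
    -- makes the factor zero, against the nonzero coefficients on the subsystem.
    minimal : ¬ (Σ SetSystem λ 𝒞 → SemiBalanced 𝒞 × (∀ {S} → S ∈ 𝒞 → S ∈ 𝒮) × ¬ (∀ {S} → S ∈ 𝒮 → S ∈ 𝒞))
    minimal (𝒞 , (((S₀ , S₀∈𝒞) , _) , d , r , coefficients , semiConic , nonzero , yields) , 𝒞⊆𝒮 , 𝒮⊈𝒞)
      with semiConic⇒InK semiConic yields
    ... | T′ , d̂∈K = 𝒮⊈𝒞 λ {S} S∈𝒮 → decidable-stable em λ S∉𝒞 → nonzero S₀ S₀∈𝒞 (d≈0 S∈𝒮 S∉𝒞 (proj₁ (𝒞⊆𝒮 S₀∈𝒞)))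
      where
      t,d̂≋tu : ∃[ t ] extend d r ≋ (λ S → t * u S)
      t,d̂≋tu = proportional d̂∈K λ S proper S≢T u≈0 → ≤.reflexive
        (trans (extend-≢⊤ d r (proj₂ proper)) (coefficients S (outside-zero u≈0 ∘ 𝒞⊆𝒮)))
      d≈tu : ∀ {S} → Proper S → d S ≈ proj₁ t,d̂≋tu * u S
      d≈tu {S} (S≢⊥ , S≢⊤) = trans (sym (extend-≢⊤ d r S≢⊤)) (proj₂ t,d̂≋tu S S≢⊥)
      d≈0 : ∀ {S R} → S ∈ 𝒮 → S ∉ 𝒞 → Proper R → d R ≈ 0#
      d≈0 {S} (proper , u≉0) S∉𝒞 properR = trans (d≈tu properR) (trans
        (*-congʳ (x*y≈0⇒x≈0 u≉0 (trans (sym (d≈tu proper)) (coefficients S S∉𝒞)))) (zeroˡ _))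

    -- A decomposition yields a vector that is negative at `E` and zero at all other proper sets
    -- outside `𝒮`. It is therefore proportional to `u`, which vanishes at `E`.
    indecomposable : ¬ HasDecomposition 𝒮
    indecomposable (E , E∉ , _ , _ , d , r , coefficients , yields , (dE≤0 , dE≉0) , d≥0) = dE≉0 (begin
      d E                  ≈⟨ extend-≢⊤ d r E≢⊤ ⟨
      extend d r E         ≈⟨ proj₂ t,d̂≋tu E E≢⊥ ⟩
      proj₁ t,d̂≋tu * u E   ≈⟨ trans (*-congˡ uE≈0) (zeroʳ _) ⟩
      0#                   ∎)
      where
      E≢⊥ : E ≢ ⊥
      E≢⊥ E≡⊥ = E∉ (inj₂ (inj₁ (≡.sym E≡⊥)))
      E≢⊤ : E ≢ ⊤
      E≢⊤ E≡⊤ = E∉ (inj₂ (inj₂ (≡.sym E≡⊤)))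
      uE≈0 : u E ≈ 0#
      uE≈0 = ∉support⇒zero {u} (E≢⊥ , E≢⊤) (E∉ ∘ inj₁)
      d-outside : ∀ {S} → S ∉ 𝒮 → S ≢ E → d S ≈ 0#
      d-outside {S} S∉𝒮 S≢E = coefficients S [ S∉𝒮 , S≢E ∘ ≡.sym ]′
      d̂≥0 : ∀ S → Proper S → S ≢ E → 0# ≤ extend d r S
      d̂≥0 S (_ , S≢⊤) S≢E with em {P = S ∈ 𝒮}
      ... | yes S∈𝒮 = ≤-respʳ (sym (extend-≢⊤ d r S≢⊤)) (d≥0 S (inj₁ S∈𝒮) S≢E)
      ... | no S∉𝒮  = ≤.reflexive (sym (trans (extend-≢⊤ d r S≢⊤) (d-outside S∉𝒮 S≢E)))
      d̂≤0 : ∀ S → Proper S → S ≢ T → u S ≈ 0# → extend d r S ≤ 0#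
      d̂≤0 S (_ , S≢⊤) _ u≈0 with S ≟ E
      ... | yes ≡.refl = ≤-respˡ (sym (extend-≢⊤ d r S≢⊤)) dE≤0
      ... | no S≢E = ≤.reflexive (trans (extend-≢⊤ d r S≢⊤) (d-outside (outside-zero u≈0) S≢E))
      t,d̂≋tu : ∃[ t ] extend d r ≋ (λ S → t * u S)
      t,d̂≋tu = proportional {E} (Bal-extend d r yields , d̂≥0) d̂≤0

    -- A balancing vector is proportional to `u` and has no negative proper coefficient. Hence every
    -- core element of a tight game attains the value of each set in `𝒮`. For a member `A` or its
    -- complement, whichever omits two points, this contradicts `¬Fixed`; the coefficient of `ĉ` at
    -- ⊤ is minus one, whence `u⊤≉0`.
    notBalanced : ¬ Balanced 𝒮
    notBalanced (_ , c , coefficients , conic , nonzero , yields) = contradict (two-on-one-side 3≤n A)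
      where
      A : Subset n
      A = proj₁ nonempty
      A∈𝒮 : A ∈ 𝒮
      A∈𝒮 = proj₂ nonempty
      A-proper : Proper A
      A-proper = proj₁ A∈𝒮
      ĉ : SetFunction
      ĉ = extend c 1#
      ĉ∈K : InK ⊥ ĉ
      ĉ∈K = Bal-extend c 1# (λ i → trans (yields i) (χ-in {⊤} (lookup-⊤ i))) ,
        λ S (_ , S≢⊤) _ → ≤-respʳ (sym (extend-≢⊤ c 1# S≢⊤)) (conic S)
      ĉ≤0 : ∀ S → Proper S → S ≢ T → u S ≈ 0# → ĉ S ≤ 0#
      ĉ≤0 S (_ , S≢⊤) _ u≈0 = ≤.reflexive (trans (extend-≢⊤ c 1# S≢⊤) (coefficients S (outside-zero u≈0)))
      t,ĉ≋tu : ∃[ t ] ĉ ≋ (λ S → t * u S)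
      t,ĉ≋tu = proportional ĉ∈K ĉ≤0
      u⊤≉0 : u ⊤ ≉ 0#
      u⊤≉0 u⊤≈0 = 1≉0 (begin
        1#                    ≈⟨ -‿involutive 1# ⟨
        - - 1#                ≈⟨ -‿cong (extend-⊤ c 1# (coefficients ⊤ (⊤-improper ∘ proj₁))) ⟨
        - ĉ ⊤                 ≈⟨ -‿cong (proj₂ t,ĉ≋tu ⊤ (⊥≢⊤ ∘ ≡.sym)) ⟩
        - (proj₁ t,ĉ≋tu * u ⊤) ≈⟨ -‿cong (trans (*-congˡ u⊤≈0) (zeroʳ _)) ⟩
        - 0#                  ≈⟨ -0≈0 ⟩
        0#                    ∎)
      A-fixed : Fixed u A
      A-fixed m x tight core = sym (x-y≈0⇒x≈y (x*y≈0⇒y≈0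
        (λ ĉA≈0 → nonzero A A∈𝒮 (trans (sym (extend-≢⊤ c 1# (proj₂ A-proper))) ĉA≈0))
        -- The exceptional set of `ĉ` is ⊥, where every core element is tight, so `x` can be
        -- arbitrary.
        (∑-nonPos-zero (excess-term ĉ∈K game core (trans (sumOver-⊥ x) (sym game)))
          (trans (sym (⟨⟩-excess (bal ĉ∈K) m x)) (perturbation-vanishes u∈K ĉ∈K ĉ≤0 m tight)) A)))
        where
        game : Game m
        game = proj₁ (proj₁ tight)
      contradict : ¬ (∃[ p ] ∃[ q ] p ≢ q × lookup A p ≡ lookup A q)
      contradict (p , q , p≢q , same) with lookup A p in eq
      ... | false = ¬Fixed rigid u⊤≉0 A-fixed (proj₁ A-proper) p q p≢q eq (≡.sym same)
      ... | true  = ¬Fixed rigid u⊤≉0 (Fixed-∁ A-fixed) (member⇒≢⊥ i (≡.trans (lookup-∁ A i) (≡.cong not i∉A)))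
        p q p≢q (≡.trans (lookup-∁ A p) (≡.cong not eq)) (≡.trans (lookup-∁ A q) (≡.cong not (≡.sym same)))
        where
        i = proj₁ (≢⊤⇒nonmember (proj₂ A-proper))
        i∉A = proj₂ (≢⊤⇒nonmember (proj₂ A-proper))

    indecomposableMinSemiBalanced : IndecomposableMinSemiBalanced 𝒮
    indecomposableMinSemiBalanced =
      ((support-semiBalanced u∈K nonempty , minimal) , notBalanced) , indecomposable

    isThetaOf : ∀ {θ} → (∀ S → u S ≈ - θ S) → ∑ θ ≈ 0# → θ IsThetaOf 𝒮
    isThetaOf {θ} u≈-θ ∑θ≈0 =
      mask u , - u ⊤ , mask-coefficients u , trans (∑-mask u) size≈1 , mask-semiConic u∈K , mask-yields (bal u∈K) ,
      (λ S (proper , _) → trans (θ≈-u S) (-‿cong (sym (mask-proper u proper)))) ,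
      θ≈-u ⊤ ,
      (begin
        -- The coefficient at ∅ is what remains from `∑ θ ≈ 0#` once the proper sets contribute
        -- minus one.
        θ ⊥                                        ≈⟨ solve 3 (λ a b c → a := (a :+ b :+ c) :- c :- b) refl (θ ⊥) (θ ⊤) (size θ) ⟩
        (θ ⊥ + θ ⊤ + size θ) - size θ - θ ⊤        ≈⟨ +-congʳ (+-congʳ (trans (sym (∑-split θ)) ∑θ≈0)) ⟩
        0# - size θ - θ ⊤                          ≈⟨ +-cong (trans (+-identityˡ _) (begin
          - size θ                  ≈⟨ ⟨⟩-neg θ 𝟙 ⟨
          size (λ S → - θ S)        ≈⟨ size-cong (λ S _ → u≈-θ S) ⟨
          size u                    ≈⟨ size≈1 ⟩
          1#                        ∎)) (-‿cong (θ≈-u ⊤)) ⟩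
        1# - - u ⊤                                 ∎) ,
      λ L L∉ → trans (θ≈-u L) (trans (-‿cong (∉support⇒zero {u}
        ((λ L≡⊥ → L∉ (inj₂ (inj₁ (≡.sym L≡⊥)))) , (λ L≡⊤ → L∉ (inj₂ (inj₂ (≡.sym L≡⊤))))) (L∉ ∘ inj₁))) -0≈0)
      where
      θ≈-u : ∀ S → θ S ≈ - u S
      θ≈-u S = trans (sym (-‿involutive _)) (-‿cong (sym (u≈-θ S)))

-- From indecomposable set systems to rigidity.

module Extremality (em : ExcludedMiddle 0ℓ) (ℝ : CompleteOrderedField) (n : ℕ) (3≤n : 3 ℕ.≤ n) where

  open CompleteOrderedField ℝ hiding (zero)
  open ExactGames ℝ n
  open Field ℝ
  open Sums ℝ n
  open Games em ℝ n
  open Cone em ℝ n 3≤n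
  open Systems em ℝ n 3≤n
  open import Relation.Binary.Reasoning.Setoid setoid

  infix 4 _∝_
  _∝_ : SetFunction → SetFunction → Set
  f ∝ g = ∃[ t ] f ≋ (λ S → t * g S)

  module _ {𝒮 : SetSystem} (imsb : IndecomposableMinSemiBalanced 𝒮)
    {c : SetFunction} {r : Carrier} (coefficients : Coefficients 𝒮 c) (affine : Affine c)
    (semiConic : SemiConic c) (yields : c Yields constant r) where

    private
      nonTrivial : NonTrivial 𝒮
      nonTrivial = proj₁ (proj₁ (proj₁ (proj₁ imsb)))

      Minimal : Set₁
      Minimal = ∀ 𝒞 → SemiBalanced 𝒞 → (∀ {S} → S ∈ 𝒞 → S ∈ 𝒮) → ∀ {S} → S ∈ 𝒮 → S ∈ 𝒞

      minimal : Minimal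
      minimal 𝒞 semiBalanced 𝒞⊆𝒮 {S} S∈𝒮 = decidable-stable em λ S∉𝒞 →
        proj₂ (proj₁ (proj₁ imsb)) (𝒞 , semiBalanced , 𝒞⊆𝒮 , λ 𝒮⊆𝒞 → S∉𝒞 (𝒮⊆𝒞 S∈𝒮))

      u : SetFunction
      u = extend c r

      u-proper : ∀ {S} → Proper S → u S ≈ c S
      u-proper (_ , S≢⊤) = extend-≢⊤ c r S≢⊤

      u-outside : ∀ {S} → Proper S → S ∉ 𝒮 → u S ≈ 0#
      u-outside proper S∉𝒮 = trans (u-proper proper) (coefficients _ S∉𝒮)

      supported⇒⊆ : ∀ {x} → (∀ S → Proper S → S ∉ 𝒮 → x S ≈ 0#) → ∀ {S} → S ∈ support x → S ∈ 𝒮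
      supported⇒⊆ x-outside (proper , x≉0) = decidable-stable em λ S∉𝒮 → x≉0 (x-outside _ proper S∉𝒮)

    size-u : size u ≈ 1#
    size-u = begin
      size u                          ≈⟨ ⟨⟩-distrib-+ c (single ⊤ (- r)) 𝟙 ⟩
      size c + size (single ⊤ (- r))  ≈⟨ +-congˡ (trans (⟨single,⟩ ⊤ (- r) 𝟙)
                                           (trans (*-congˡ (mask-improper (λ _ → 1#) ⊤-improper)) (zeroʳ _))) ⟩
      size c + 0#                     ≈⟨ +-identityʳ _ ⟩
      size c                          ≈⟨ +-identityˡ _ ⟨
      0# + size c                     ≈⟨ +-congʳ (trans (+-cong (coefficients ⊥ (proj₁ (proj₂ nonTrivial)))
                                           (coefficients ⊤ (proj₂ (proj₂ nonTrivial)))) (+-identityˡ 0#)) ⟨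
      c ⊥ + c ⊤ + size c              ≈⟨ ∑-split c ⟨
      ∑ c                             ≈⟨ affine ⟩
      1#                              ∎

    private
      size-u≉0 : size u ≉ 0#
      size-u≉0 size≈0 = 1≉0 (trans (sym size-u) size≈0)

    u∈K : ∃[ T ] InK T u
    u∈K = semiConic⇒InK semiConic yields

    private
      -- The coefficients defining θ are not assumed to be nonzero, but the support of `u` is a
      -- semi-balanced subsystem of `𝒮` and hence, by minimality, all of it.
      c-nonzero : AllNonZeroOn 𝒮 c
      c-nonzero S S∈𝒮 c≈0 = proj₂ (minimal (support u)
        (support-semiBalanced (proj₂ u∈K) (support-nonempty {u} size-u≉0))
        (supported⇒⊆ {u} λ S → u-outside) S∈𝒮) (trans (u-proper (NonTrivial⇒Proper nonTrivial S∈𝒮)) c≈0)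

      conic⇒Balanced : Conic c → Balanced 𝒮
      conic⇒Balanced conic =
        nonTrivial , (λ S → κ * c S) ,
        (λ S S∉𝒮 → trans (*-congˡ (coefficients S S∉𝒮)) (zeroʳ κ)) ,
        (λ S → *-nonNeg (proj₁ 0<κ) (conic S)) ,
        (λ S S∈𝒮 κc≈0 → c-nonzero S S∈𝒮 (x*y≈0⇒y≈0 (<⇒≉ 0<κ) κc≈0)) ,
        λ j → trans (⟨⟩-scale κ c (χ⁻ j)) (trans (*-congˡ (yields j))
          (trans (*-comm κ r) (trans r*κ≈1 (sym (χ-in {⊤} (lookup-⊤ j))))))
        where
        S₀ : Subset n
        S₀ = proj₁ (proj₁ nonTrivial)
        S₀∈𝒮 : S₀ ∈ 𝒮
        S₀∈𝒮 = proj₂ (proj₁ nonTrivial)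
        i : Fin n
        i = proj₁ (≢⊥⇒member (proj₁ (NonTrivial⇒Proper nonTrivial S₀∈𝒮)))
        i∈S₀ : lookup S₀ i ≡ _
        i∈S₀ = proj₂ (≢⊥⇒member (proj₁ (NonTrivial⇒Proper nonTrivial S₀∈𝒮)))
        terms : ∀ S → 0# ≤ c S * χ S i
        terms S = *-nonNeg (conic S) (0≤χ S i)
        -- `r` is the total coefficient of the sets containing `i`, and `S₀` is one of them.
        -- Dividing by `r` turns the constant into one.
        0<r : 0# < r
        0<r = ≤-respʳ (yields i) (∑-nonNeg terms) , λ 0≈r → c-nonzero S₀ S₀∈𝒮
          (trans (sym (trans (*-congˡ (χ-in {S₀} i∈S₀)) (*-identityʳ _)))
            (∑-nonNeg-zero terms (trans (yields i) (sym 0≈r)) S₀))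
        κ : Carrier
        κ = proj₁ (positive-inverse 0<r)
        0<κ : 0# < κ
        0<κ = proj₁ (proj₂ (positive-inverse 0<r))
        r*κ≈1 : r * κ ≈ 1#
        r*κ≈1 = proj₂ (proj₂ (positive-inverse 0<r))

      negative : ∃[ T ] c T < 0#
      negative = decidable-stable em λ ∄T → proj₂ (proj₁ imsb) (conic⇒Balanced λ S → ≮⇒≥ λ c<0 → ∄T (S , c<0))

      T₀ : Subset n
      T₀ = proj₁ negative

      cT₀<0 : c T₀ < 0#
      cT₀<0 = proj₂ negative

      T₀∈𝒮 : T₀ ∈ 𝒮
      T₀∈𝒮 = decidable-stable em λ T₀∉𝒮 → proj₂ cT₀<0 (coefficients T₀ T₀∉𝒮)

      T₀-proper : Proper T₀
      T₀-proper = NonTrivial⇒Proper nonTrivial T₀∈𝒮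

      uT₀≤0 : u T₀ ≤ 0#
      uT₀≤0 = ≤-respˡ (sym (u-proper T₀-proper)) (proj₁ cT₀<0)

      uT₀≉0 : u T₀ ≉ 0#
      uT₀≉0 u≈0 = proj₂ cT₀<0 (trans (sym (u-proper T₀-proper)) u≈0)

      u∈K₀ : InK T₀ u
      u∈K₀ = Bal-extend c r yields , λ S proper S≢T₀ →
        ≤-respʳ (sym (u-proper proper)) (≮⇒≥ λ c<0 → S≢T₀ (semiConic S T₀ c<0 cT₀<0))

      Supported : SetFunction → Set
      Supported x = ∀ S → Proper S → S ∉ 𝒮 → x S ≈ 0#

      u-zero⇒∉ : ∀ {S} → Proper S → u S ≈ 0# → S ∉ 𝒮
      u-zero⇒∉ proper u≈0 S∈𝒮 = c-nonzero _ S∈𝒮 (trans (sym (u-proper proper)) u≈0)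

      -- Subtracting the largest multiple of x for which the coefficients off T₀
      -- stay nonnegative removes a set from the support.
      circuit-positive : ∀ {x} → Bal x → Supported x → (∃[ S ] Proper S × S ≢ T₀ × 0# < x S) → x ∝ u
      circuit-positive {x} x-bal x-outside (S , proper , S≢T₀ , 0<xS) = [ no-tie , tie ]′ (Ratio.ratio u x Q
        (λ S (proper , S≢T₀) → nonNeg u∈K₀ S proper S≢T₀)
        (λ S (proper , _) u≈0 → ≤.reflexive (x-outside S proper (u-zero⇒∉ proper u≈0))))
        where
        Q : Subset n → Set
        Q S = Proper S × S ≢ T₀
        no-tie : (∀ S → Q S → x S ≤ 0#) → x ∝ u
        no-tie x≤0 = contradiction (x≤0 S (proper , S≢T₀)) (<⇒≱ 0<xS)
        tie : (∃[ ε ] 0# < ε × (∀ S → Q S → 0# ≤ u S - ε * x S) × (∃[ S ] Q S × 0# < x S × u S ≈ ε * x S)) → x ∝ u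
        tie (ε , 0<ε , y≥0 , S₁ , (proper₁ , S₁≢T₀) , 0<xS₁ , uS₁≈εxS₁) = κ , x≋κu
          where
          κ : Carrier
          κ = proj₁ (positive-inverse 0<ε)
          ε*κ≈1 : ε * κ ≈ 1#
          ε*κ≈1 = proj₂ (proj₂ (positive-inverse 0<ε))
          y : SetFunction
          y S = u S - ε * x S
          y∈K : InK T₀ y
          y∈K = Bal-- u ε x (bal u∈K₀) x-bal , λ S proper S≢T₀ → y≥0 S (proper , S≢T₀)
          y-outside : Supported y
          y-outside S proper S∉𝒮 = trans (+-cong (u-outside proper S∉𝒮)
            (trans (-‿cong (trans (*-congˡ (x-outside S proper S∉𝒮)) (zeroʳ ε))) -0≈0)) (+-identityˡ 0#)
          S₁∈𝒮 : S₁ ∈ 𝒮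
          S₁∈𝒮 = decidable-stable em λ S₁∉𝒮 → <⇒≉ 0<xS₁ (x-outside S₁ proper₁ S₁∉𝒮)
          empty : ¬ (∃[ S ] S ∈ support y)
          empty nonempty = proj₂ (minimal (support y) (support-semiBalanced y∈K nonempty) (supported⇒⊆ {y} y-outside) S₁∈𝒮)
            (trans (+-congʳ uS₁≈εxS₁) (-‿inverseʳ _))
          y≋0 : ∀ S → S ≢ ⊥ → y S ≈ 0#
          y≋0 = Bal-vanishing (bal y∈K) T₀-proper λ S proper _ → ∉support⇒zero {y} proper λ S∈ → empty (S , S∈)
          x≋κu : ∀ R → R ≢ ⊥ → x R ≈ κ * u R
          x≋κu R R≢⊥ = begin
            x R            ≈⟨ *-identityˡ _ ⟨
            1# * x R       ≈⟨ *-congʳ ε*κ≈1 ⟨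
            ε * κ * x R    ≈⟨ solve 3 (λ ε κ x → ε :* κ :* x := κ :* (ε :* x)) refl ε κ (x R) ⟩
            κ * (ε * x R)  ≈⟨ *-congˡ (x-y≈0⇒x≈y (y≋0 R R≢⊥)) ⟨
            κ * u R        ∎

      -- Apart from ⊥, the balanced vectors supported on `𝒮` form a line. If neither `x` nor `-x` is
      -- positive anywhere off `T₀`, then `x` vanishes there and so, by balancedness, at `T₀` and ⊤
      -- too.
      circuit : ∀ {x} → Bal x → Supported x → x ∝ u
      circuit {x} x-bal x-outside = cases em em
        where
        -x : SetFunction
        -x S = - x S
        -x-bal : Bal -x
        -x-bal i = trans (⟨⟩-neg x (χ⁻ i)) (trans (-‿cong (x-bal i)) -0≈0)
        -x-outside : Supported -x
        -x-outside S proper S∉𝒮 = trans (-‿cong (x-outside S proper S∉𝒮)) -0≈0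
        cases : Dec (∃[ S ] Proper S × S ≢ T₀ × 0# < x S) → Dec (∃[ S ] Proper S × S ≢ T₀ × 0# < -x S) → x ∝ u
        cases (yes positive) _ = circuit-positive {x} x-bal x-outside positive
        cases (no _) (yes positive) = - t , λ S S≢⊥ →
          trans (sym (-‿involutive _)) (trans (-‿cong (proj₂ -x∝u S S≢⊥)) (-‿distribˡ-* t (u S)))
          where
          -x∝u : -x ∝ u
          -x∝u = circuit-positive { -x} -x-bal -x-outside positive
          t : Carrier
          t = proj₁ -x∝u
        cases (no ¬positive) (no ¬negative) = 0# , λ S S≢⊥ →
          trans (Bal-vanishing {x} x-bal T₀-proper vanishes S S≢⊥) (sym (zeroˡ _))
          where
          vanishes : ∀ S → Proper S → S ≢ T₀ → x S ≈ 0#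
          vanishes S proper S≢T₀ = ≤.antisym
            (≮⇒≥ λ 0<x → ¬positive (S , proper , S≢T₀ , 0<x))
            (-≤0⇒0≤ (≮⇒≥ λ 0<-x → ¬negative (S , proper , S≢T₀ , 0<-x)))

      -- Otherwise `mask x` would show `E` to be exceptional within `𝒮 ∪ ｛ E ｝`, which is a
      -- decomposition.
      no-exception : ∀ {E x} → Proper E → E ∉ 𝒮 → InK E x → (∀ S → Proper S → S ∉ 𝒮 → S ≢ E → x S ≈ 0#) → 0# ≤ x E
      no-exception {E} {x} E-proper@(E≢⊥ , E≢⊤) E∉𝒮 x∈K x-outside = ≮⇒≥ λ (xE≤0 , xE≉0) → proj₂ imsb
        (E , [ E∉𝒮 , [ E≢⊥ ∘ ≡.sym , E≢⊤ ∘ ≡.sym ]′ ]′ ,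
         ((E , inj₂ ≡.refl) , [ proj₁ (proj₂ nonTrivial) , E≢⊥ ]′ , [ proj₂ (proj₂ nonTrivial) , E≢⊤ ]′) ,
         inj₂ ≡.refl , mask x , - x ⊤ ,
         (λ S S∉ → zero-off S S∉ (proper? S)) ,
         mask-yields (bal x∈K) ,
         (≤-respˡ (sym (mask-proper x E-proper)) xE≤0 , λ mask≈0 → xE≉0 (trans (sym (mask-proper x E-proper)) mask≈0)) ,
         λ S _ S≢E → nonNegative S S≢E (proper? S))
        where
        zero-off : ∀ S → S ∉ (𝒮 ∪ ｛ E ｝) → Dec (Proper S) → mask x S ≈ 0#
        zero-off S S∉ (yes proper) = trans (mask-proper x proper) (x-outside S proper (S∉ ∘ inj₁) λ S≡E → S∉ (inj₂ (≡.sym S≡E)))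
        zero-off S _  (no ¬proper) = mask-improper x ¬proper
        nonNegative : ∀ S → S ≢ E → Dec (Proper S) → 0# ≤ mask x S
        nonNegative S S≢E (yes proper) = ≤-respʳ (sym (mask-proper x proper)) (nonNeg x∈K S proper S≢E)
        nonNegative S _   (no ¬proper) = ≤.reflexive (sym (mask-improper x ¬proper))

      -- One elimination step: d E is distributed over the d T in proportion to
      -- their coefficients at E, so that E occurs in none of the results.
      module Elimination (E : Subset n) (E-proper : Proper E) (E∉𝒮 : E ∉ 𝒮)
        (d : Subset n → SetFunction) (d∈K : ∀ T → InK T (d T))
        (b : Carrier) (∑d≈bu : ∀ S → S ≢ ⊥ → ∑ (λ T → d T S) ≈ b * u S)
        (dEE<0 : d E E < 0#) where

        private
          0<-dEE : 0# < - d E E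
          0<-dEE = ≤0⇒0≤- (proj₁ dEE<0) , λ 0≈-d → proj₂ dEE<0 (trans (sym (-‿involutive _)) (trans (-‿cong (sym 0≈-d)) -0≈0))
          κ : Carrier
          κ = proj₁ (positive-inverse 0<-dEE)
          0<κ : 0# < κ
          0<κ = proj₁ (proj₂ (positive-inverse 0<-dEE))
          dEE*κ≈1 : - d E E * κ ≈ 1#
          dEE*κ≈1 = proj₂ (proj₂ (positive-inverse 0<-dEE))

        -- As `κ` inverts `- d E E`, the value at `E` is minus one, so that `d′ E` vanishes. The
        -- other values are nonnegative and sum to one, because the coefficients at `E` sum to zero;
        -- so the total of the family is unchanged.
        q : Subset n → Carrier
        q T = d T E * κ

        d′ : Subset n → SetFunction
        d′ T S = d T S + q T * d E S

        ∑d-E : ∑ (λ T → d T E) ≈ 0#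
        ∑d-E = trans (∑d≈bu E (proj₁ E-proper)) (trans (*-congˡ (u-outside E-proper E∉𝒮)) (zeroʳ b))

        d′-E : ∀ T → d′ T E ≈ 0#
        d′-E T = begin
          d T E + d T E * κ * d E E
            ≈⟨ solve 3 (λ p κ e → p :+ p :* κ :* e := p :* (:1 :- (:- e) :* κ)) refl (d T E) κ (d E E) ⟩
          d T E * (1# - - d E E * κ)  ≈⟨ *-congˡ (trans (+-congˡ (-‿cong dEE*κ≈1)) (-‿inverseʳ 1#)) ⟩
          d T E * 0#                  ≈⟨ zeroʳ _ ⟩
          0#                          ∎

        d′E≈0 : ∀ S → d′ E S ≈ 0#
        d′E≈0 S = begin
          d E S + d E E * κ * d E S
            ≈⟨ solve 3 (λ p κ e → p :+ e :* κ :* p := p :* (:1 :- (:- e) :* κ)) refl (d E S) κ (d E E) ⟩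
          d E S * (1# - - d E E * κ)  ≈⟨ *-congˡ (trans (+-congˡ (-‿cong dEE*κ≈1)) (-‿inverseʳ 1#)) ⟩
          d E S * 0#                  ≈⟨ zeroʳ _ ⟩
          0#                          ∎

        0≤q : ∀ {T} → T ≢ E → 0# ≤ q T
        0≤q {T} T≢E = *-nonNeg (nonNeg (d∈K T) E E-proper (T≢E ∘ ≡.sym)) (proj₁ 0<κ)

        d′∈K : ∀ T → InK T (d′ T)
        d′∈K T = Bal-+ (d T) (q T) (d E) (bal (d∈K T)) (bal (d∈K E)) ,
          λ S proper S≢T → nonNegative S proper S≢T (T ≟ E) (S ≟ E)
          where
          nonNegative : ∀ S → Proper S → S ≢ T → Dec (T ≡ E) → Dec (S ≡ E) → 0# ≤ d′ T S
          nonNegative S proper S≢T (yes ≡.refl) _ = ≤.reflexive (sym (d′E≈0 S))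
          nonNegative S proper S≢T (no _) (yes ≡.refl) = ≤.reflexive (sym (d′-E T))
          nonNegative S proper S≢T (no T≢E) (no S≢E) =
            +-nonNeg (nonNeg (d∈K T) S proper S≢T) (*-nonNeg (0≤q T≢E) (nonNeg (d∈K E) S proper S≢E))

        ∑d′≈bu : ∀ S → S ≢ ⊥ → ∑ (λ T → d′ T S) ≈ b * u S
        ∑d′≈bu S S≢⊥ = begin
          ∑ (λ T → d T S + q T * d E S)             ≈⟨ ∑-distrib-+ (λ T → d T S) (λ T → q T * d E S) ⟩
          ∑ (λ T → d T S) + ∑ (λ T → q T * d E S)   ≈⟨ +-cong (∑d≈bu S S≢⊥) (begin
            ∑ (λ T → d T E * κ * d E S)
              ≈⟨ ∑-cong (λ T → solve 3 (λ p κ e → p :* κ :* e := κ :* e :* p) refl (d T E) κ (d E S)) ⟩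
            ∑ (λ T → κ * d E S * d T E)   ≈⟨ *-distribˡ-∑ (κ * d E S) (λ T → d T E) ⟨
            κ * d E S * ∑ (λ T → d T E)   ≈⟨ trans (*-congˡ ∑d-E) (zeroʳ _) ⟩
            0#                            ∎) ⟩
          b * u S + 0#                              ≈⟨ +-identityʳ _ ⟩
          b * u S                                   ∎

        -- The coefficients at `E` sum to zero, so the negative `d E E` needs a positive
        -- counterpart.
        giver : ∃[ T ] T ≢ E × 0# < d T E
        giver = decidable-stable em λ ∄T → proj₂ dEE<0 (trans
          (sym (∑-single E λ T T≢E → ≤.antisym (≮⇒≥ λ 0<d → ∄T (T , T≢E , 0<d)) (nonNeg (d∈K T) E E-proper (T≢E ∘ ≡.sym))))
          ∑d-E)

        -- For a giver `T`, the sum of `d T` and a positive multiple of `d E` is `t` times `u` and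
        -- vanishes outside `𝒮`. Unless `T` is itself a proper set outside `𝒮`, both summands are
        -- nonnegative at the proper sets outside `𝒮` other than `E`, so `d E` vanishes there, and
        -- `no-exception` contradicts `d E E < 0`.
        impossible : ¬ (∀ T → d′ T ∝ u)
        impossible d′∝u = cases em
          where
          T : Subset n
          T = proj₁ giver
          T≢E : T ≢ E
          T≢E = proj₁ (proj₂ giver)
          0<dTE : 0# < d T E
          0<dTE = proj₂ (proj₂ giver)
          t : Carrier
          t = proj₁ (d′∝u T)
          d′≋tu : d′ T ≋ (λ S → t * u S)
          d′≋tu = proj₂ (d′∝u T)
          cases : ¬ Dec (Proper T × T ∉ 𝒮)
          cases (no T-inside) = <⇒≱ dEE<0 (no-exception E-proper E∉𝒮 (d∈K E) λ L L-proper L∉𝒮 L≢E →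
            x*y≈0⇒y≈0 (<⇒≉ (*-pos 0<dTE 0<κ)) (nonNeg-sum-zeroʳ
              (nonNeg (d∈K T) L L-proper λ { ≡.refl → T-inside (L-proper , L∉𝒮) })
              (*-nonNeg (0≤q T≢E) (nonNeg (d∈K E) L L-proper L≢E))
              (trans (d′≋tu L (proj₁ L-proper)) (trans (*-congˡ (u-outside L-proper L∉𝒮)) (zeroʳ t)))))
          -- Here `T` differs from `T₀`, so `d′ T` is nonnegative at `T₀` while `u` is negative
          -- there, which forces `t` to be zero. Then the sizes of both summands vanish, and with
          -- its size also `d E`.
          cases (yes (T-proper , T∉𝒮)) = proj₂ dEE<0 (size-zero (d∈K E) size-dE≈0 E (proj₁ E-proper))
            where
            size-d′≈t : size (d′ T) ≈ t
            size-d′≈t = trans (size-cong d′≋tu) (trans (size-scale t u) (trans (*-congˡ size-u) (*-identityʳ t)))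
            0≤t : 0# ≤ t
            0≤t = ≤-respʳ size-d′≈t (size-nonNeg (d′∈K T))
            t≈0 : t ≈ 0#
            t≈0 = x*y≈0⇒x≈0 uT₀≉0 (≤.antisym (*-nonNeg-nonPos 0≤t uT₀≤0)
              (≤-respʳ (d′≋tu T₀ (proj₁ T₀-proper)) (nonNeg (d′∈K T) T₀ T₀-proper λ T₀≡T → T∉𝒮 (≡.subst 𝒮 T₀≡T T₀∈𝒮))))
            size-dE≈0 : size (d E) ≈ 0#
            size-dE≈0 = x*y≈0⇒y≈0 (<⇒≉ (*-pos 0<dTE 0<κ)) (nonNeg-sum-zeroʳ (size-nonNeg (d∈K T))
              (*-nonNeg (0≤q T≢E) (size-nonNeg (d∈K E)))
              (trans (sym (size-+ (d T) (q T) (d E))) (trans size-d′≈t t≈0)))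

      -- `Es` contains every proper set outside `𝒮` at which a summand may still be nonzero. If
      -- `d E E` is not negative, the coefficients at `E` are nonnegative with sum zero and vanish.
      -- If it is negative, the recursive call on the family `d′` only serves to reach a
      -- contradiction.
      decomposition⇒∝ : (Es : List (Subset n)) (d : Subset n → SetFunction) → (∀ T → InK T (d T)) →
        (∀ S → Proper S → S ∉ 𝒮 → ¬ (S ∈ˡ Es) → ∀ T → d T S ≈ 0#) →
        ∀ b → (∀ S → S ≢ ⊥ → ∑ (λ T → d T S) ≈ b * u S) → ∀ T → d T ∝ u
      decomposition⇒∝ List.[] d d∈K d-outside b ∑d≈bu T =
        circuit {d T} (bal (d∈K T)) λ S proper S∉𝒮 → d-outside S proper S∉𝒮 (λ ()) T
      decomposition⇒∝ (E List.∷ Es) d d∈K d-outside b ∑d≈bu = cases em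
        where
        ∉-∷ : ∀ {S} → ¬ (S ∈ˡ Es) → S ≢ E → ¬ (S ∈ˡ E List.∷ Es)
        ∉-∷ S∉Es S≢E (here S≡E)   = S≢E S≡E
        ∉-∷ S∉Es S≢E (there S∈Es) = S∉Es S∈Es
        cases : Dec ((Proper E × E ∉ 𝒮) × d E E < 0#) → ∀ T → d T ∝ u
        cases (yes ((E-proper , E∉𝒮) , dEE<0)) = contradiction
          (decomposition⇒∝ Es d′ d′∈K (λ S proper S∉𝒮 S∉Es T → d′-outside S proper S∉𝒮 S∉Es T (S ≟ E)) b ∑d′≈bu) impossible
          where
          open Elimination E E-proper E∉𝒮 d d∈K b ∑d≈bu dEE<0
          d′-outside : ∀ S → Proper S → S ∉ 𝒮 → ¬ (S ∈ˡ Es) → ∀ T → Dec (S ≡ E) → d′ T S ≈ 0#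
          d′-outside S proper S∉𝒮 S∉Es T (yes ≡.refl) = d′-E T
          d′-outside S proper S∉𝒮 S∉Es T (no S≢E) =
            trans (+-cong (zero-at T) (trans (*-congˡ (zero-at E)) (zeroʳ _))) (+-identityˡ 0#)
            where
            zero-at : ∀ T → d T S ≈ 0#
            zero-at = d-outside S proper S∉𝒮 (∉-∷ S∉Es S≢E)
        cases (no ¬exceptional) = decomposition⇒∝ Es d d∈K
          (λ S proper S∉𝒮 S∉Es → d-outside′ S proper S∉𝒮 S∉Es (S ≟ E)) b ∑d≈bu
          where
          d-outside′ : ∀ S → Proper S → S ∉ 𝒮 → ¬ (S ∈ˡ Es) → Dec (S ≡ E) → ∀ T → d T S ≈ 0#
          d-outside′ S proper S∉𝒮 S∉Es (no S≢E) = d-outside S proper S∉𝒮 (∉-∷ S∉Es S≢E)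
          d-outside′ S proper S∉𝒮 S∉Es (yes ≡.refl) = ∑-nonNeg-zero (λ T → column T (S ≟ T))
            (trans (∑d≈bu S (proj₁ proper)) (trans (*-congˡ (u-outside proper S∉𝒮)) (zeroʳ b)))
            where
            column : ∀ T → Dec (S ≡ T) → 0# ≤ d T S
            column T (yes ≡.refl) = ≮⇒≥ λ dSS<0 → ¬exceptional ((proper , S∉𝒮) , dSS<0)
            column T (no S≢T) = nonNeg (d∈K T) S proper S≢T

      -- At a proper set outside `𝒮` the two coefficients sum to zero. Off `T` both are nonnegative
      -- and hence vanish, and then `no-exception` makes them nonnegative at `T` as well.
      summand⇒∝ : ∀ {T x y} → InK T x → InK T y → (λ S → x S + y S) ∝ u → x ∝ u
      summand⇒∝ {T} {x} {y} x∈K y∈K (t , x+y≋tu) = circuit {x} (bal x∈K) λ S proper S∉𝒮 → x-outside S proper S∉𝒮 (S ≟ T)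
        where
        sum≈0 : ∀ S → Proper S → S ∉ 𝒮 → x S + y S ≈ 0#
        sum≈0 S proper S∉𝒮 = trans (x+y≋tu S (proj₁ proper)) (trans (*-congˡ (u-outside proper S∉𝒮)) (zeroʳ t))
        x-off-T : ∀ S → Proper S → S ∉ 𝒮 → S ≢ T → x S ≈ 0#
        x-off-T S proper S∉𝒮 S≢T = nonNeg-sum-zeroˡ (nonNeg x∈K S proper S≢T) (nonNeg y∈K S proper S≢T) (sum≈0 S proper S∉𝒮)
        y-off-T : ∀ S → Proper S → S ∉ 𝒮 → S ≢ T → y S ≈ 0#
        y-off-T S proper S∉𝒮 S≢T = nonNeg-sum-zeroʳ (nonNeg x∈K S proper S≢T) (nonNeg y∈K S proper S≢T) (sum≈0 S proper S∉𝒮)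
        x-outside : ∀ S → Proper S → S ∉ 𝒮 → Dec (S ≡ T) → x S ≈ 0#
        x-outside S proper S∉𝒮 (no S≢T) = x-off-T S proper S∉𝒮 S≢T
        x-outside S proper S∉𝒮 (yes ≡.refl) = nonNeg-sum-zeroˡ (no-exception proper S∉𝒮 x∈K x-off-T) (no-exception proper S∉𝒮 y∈K y-off-T)
          (sum≈0 S proper S∉𝒮)

    -- Both `η` and its negative become valid after a multiple of `u` is added. Adding the
    -- decompositions of the two for each `T` makes `η` cancel and leaves a decomposition of a
    -- multiple of `u`. All its summands are multiples of `u`, so the original ones are too, and
    -- finally `η`.
    indecomposable⇒Rigid : Rigid u
    indecomposable⇒Rigid η vanishes = ∑ s - a , λ S S≢⊥ → begin
      η S                               ≈⟨ solve 3 (λ h a u → h := (h :+ a :* u) :- a :* u) refl (η S) a (u S) ⟩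
      (η S + a * u S) - a * u S         ≈⟨ +-congʳ (∑d S) ⟩
      ∑ (λ T → d T S) - a * u S         ≈⟨ +-congʳ (∑-cong (λ T → trans (proj₂ (d∝u T) S S≢⊥) (*-comm _ _))) ⟩
      ∑ (λ T → u S * s T) - a * u S     ≈⟨ +-congʳ (*-distribˡ-∑ (u S) s) ⟨
      u S * ∑ s - a * u S               ≈⟨ solve 3 (λ u s a → u :* s :- a :* u := (s :- a) :* u) refl (u S) (∑ s) a ⟩
      (∑ s - a) * u S                   ∎
      where
      u-valid : Valid u
      u-valid = InK⇒Valid u∈K₀
      upper = nonPos-on-face⇒Valid {u} {η} (λ m tight → ≤.reflexive (vanishes m tight)) u-valid
      lower = nonPos-on-face⇒Valid {u} {λ S → - η S}
        (λ m tight → ≤.reflexive (trans (⟨⟩-neg η m) (trans (-‿cong (vanishes m tight)) -0≈0))) u-valid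
      a a′ : Carrier
      a  = proj₁ upper
      a′ = proj₁ lower
      decompose  = Valid⇒decomposition (proj₂ (proj₂ upper))
      decompose′ = Valid⇒decomposition (proj₂ (proj₂ lower))
      d d′ : Subset n → SetFunction
      d  = proj₁ decompose
      d′ = proj₁ decompose′
      d∈K : ∀ T → InK T (d T)
      d∈K = proj₁ (proj₂ decompose)
      d′∈K : ∀ T → InK T (d′ T)
      d′∈K = proj₁ (proj₂ decompose′)
      ∑d : ∀ S → η S + a * u S ≈ ∑ (λ T → d T S)
      ∑d = proj₂ (proj₂ decompose)
      e : Subset n → SetFunction
      e T S = d T S + 1# * d′ T S
      ∑e : ∀ S → S ≢ ⊥ → ∑ (λ T → e T S) ≈ (a + a′) * u S
      ∑e S _ = begin
        ∑ (λ T → d T S + 1# * d′ T S)            ≈⟨ ∑-cong (λ T → +-congˡ (*-identityˡ _)) ⟩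
        ∑ (λ T → d T S + d′ T S)                 ≈⟨ ∑-distrib-+ (λ T → d T S) (λ T → d′ T S) ⟩
        ∑ (λ T → d T S) + ∑ (λ T → d′ T S)       ≈⟨ +-cong (∑d S) (proj₂ (proj₂ decompose′) S) ⟨
        (η S + a * u S) + (- η S + a′ * u S)
          ≈⟨ solve 4 (λ h a b u → (h :+ a :* u) :+ ((:- h) :+ b :* u) := (a :+ b) :* u) refl (η S) a a′ (u S) ⟩
        (a + a′) * u S                           ∎
      e∝u : ∀ T → e T ∝ u
      e∝u = decomposition⇒∝ (subsets n) e (λ T → InK-+ (d∈K T) (d′∈K T) 0≤1)
        (λ S _ _ S∉ → contradiction (∈-subsets S) S∉) (a + a′) ∑e
      d∝u : ∀ T → d T ∝ u
      d∝u T = summand⇒∝ (d∈K T) (d′∈K T)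
        (proj₁ (e∝u T) , λ S S≢⊥ → trans (+-congˡ (sym (*-identityˡ _))) (proj₂ (e∝u T) S S≢⊥))
      s : SetFunction
      s T = proj₁ (d∝u T)

-- An enumeration of the subsets.

-- The power of two is computed by doubling, in parallel with the recursion of `∑`, so that
-- `splitAt` separates the two halves.
#subsets : ℕ → ℕ
#subsets zero    = 1
#subsets (suc k) = #subsets k ℕ.+ #subsets k

toSubset : ∀ k → Fin (#subsets k) → Subset k
toSubset zero    _ = []
toSubset (suc k) j = [ (λ i → outside ∷ toSubset k i) , (λ i → inside ∷ toSubset k i) ]′ (splitAt (#subsets k) j)

index : ∀ {k} → Subset k → Fin (#subsets k)
index []                    = zero
index {suc k} (outside ∷ S) = index S ↑ˡ #subsets k
index {suc k} (inside ∷ S)  = #subsets k ↑ʳ index S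

toSubset-↑ˡ : ∀ k i → toSubset (suc k) (i ↑ˡ #subsets k) ≡ outside ∷ toSubset k i
toSubset-↑ˡ k i rewrite Fin.splitAt-↑ˡ (#subsets k) i (#subsets k) = ≡.refl

toSubset-↑ʳ : ∀ k i → toSubset (suc k) (#subsets k ↑ʳ i) ≡ inside ∷ toSubset k i
toSubset-↑ʳ k i rewrite Fin.splitAt-↑ʳ (#subsets k) (#subsets k) i = ≡.refl

toSubset-index : ∀ {k} (S : Subset k) → toSubset k (index S) ≡ S
toSubset-index []                    = ≡.refl
toSubset-index {suc k} (outside ∷ S) = ≡.trans (toSubset-↑ˡ k (index S)) (≡.cong (outside ∷_) (toSubset-index S))
toSubset-index {suc k} (inside ∷ S)  = ≡.trans (toSubset-↑ʳ k (index S)) (≡.cong (inside ∷_) (toSubset-index S))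

index-toSubset : ∀ k j → index (toSubset k j) ≡ j
index-toSubset zero zero = ≡.refl
index-toSubset (suc k) j with splitAt (#subsets k) j in eq
... | inj₁ i = ≡.trans (≡.cong (_↑ˡ #subsets k) (index-toSubset k i)) (Fin.splitAt⁻¹-↑ˡ eq)
... | inj₂ i = ≡.trans (≡.cong (#subsets k ↑ʳ_) (index-toSubset k i)) (Fin.splitAt⁻¹-↑ʳ eq)

#subsets≥2 : ∀ {k} → 1 ℕ.≤ k → ∃[ d ] #subsets k ≡ suc (suc d)
#subsets≥2 {suc k} _ = let (d , eq) = ℕₚ.m≤n⇒∃[o]m+o≡n (ℕₚ.+-mono-≤ (positive k) (positive k)) in d , ≡.sym eq
  where
  positive : ∀ k → 1 ℕ.≤ #subsets k
  positive zero    = ℕₚ.≤-refl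
  positive (suc k) = ℕₚ.≤-trans (positive k) (ℕₚ.m≤m+n _ _)

-- Kernels and dimension bounds.

module LinearAlgebra (em : ExcludedMiddle 0ℓ) (ℝ : CompleteOrderedField) (n : ℕ) where

  open CompleteOrderedField ℝ hiding (zero)
  open ExactGames ℝ n
  open Field ℝ
  open Sums ℝ n
  open import Algebra.Properties.Semiring.Sum semiring
    using (sum; sum-cong-≋; sum-replicate-zero; *-distribˡ-sum; sum-remove) renaming (∑-distrib-+ to sum-distrib-+)
  open import Relation.Binary.Reasoning.Setoid setoid

  infix 9 _·_
  _·_ : ∀ {k} → Vector Carrier k → Vector Carrier k → Carrier
  a · b = sum (λ j → a j * b j)

  ·-zeroˡ : ∀ {k} {a : Vector Carrier k} b → (∀ j → a j ≈ 0#) → a · b ≈ 0#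
  ·-zeroˡ {k} b a≈0 = trans (sum-cong-≋ (λ j → trans (*-congʳ (a≈0 j)) (zeroˡ (b j)))) (sum-replicate-zero k)

  ·-zeroʳ : ∀ {k} a {b : Vector Carrier k} → (∀ j → b j ≈ 0#) → a · b ≈ 0#
  ·-zeroʳ {k} a b≈0 = trans (sum-cong-≋ (λ j → trans (*-congˡ (b≈0 j)) (zeroʳ (a j)))) (sum-replicate-zero k)

  ·-comm : ∀ {k} (a b : Vector Carrier k) → a · b ≈ b · a
  ·-comm a b = sum-cong-≋ λ j → *-comm (a j) (b j)

  ·-minus : ∀ {k} (x : Vector Carrier k) c y b → (λ j → x j - c * y j) · b ≈ x · b - c * y · b
  ·-minus x c y b = begin
    sum (λ j → (x j - c * y j) * b j)
      ≈⟨ sum-cong-≋ (λ j → solve 4 (λ x c y b → (x :- c :* y) :* b := x :* b :+ (:- c) :* (y :* b)) refl (x j) c (y j) (b j)) ⟩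
    sum (λ j → x j * b j + - c * (y j * b j))
      ≈⟨ sum-distrib-+ (λ j → x j * b j) (λ j → - c * (y j * b j)) ⟩
    x · b + sum (λ j → - c * (y j * b j))
      ≈⟨ +-congˡ (trans (sym (*-distribˡ-sum (- c) (λ j → y j * b j))) (sym (-‿distribˡ-* c (y · b)))) ⟩
    x · b - c * y · b ∎

  -- Gaussian elimination on the first row.
  private
    kernel′ : ∀ k d (a : Fin k → Vector Carrier (suc (k ℕ.+ d))) →
              ∃[ b ] (∃[ j ] b j ≉ 0#) × (∀ i → a i · b ≈ 0#)
    kernel′ zero d a = (λ _ → 1#) , (zero , 1≉0) , λ ()
    kernel′ (suc k) d a = cases em
      where
      cases : Dec (∃[ p ] a zero p ≉ 0#) → ∃[ b ] (∃[ j ] b j ≉ 0#) × (∀ i → a i · b ≈ 0#)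
      -- A zero row is dropped together with the first unknown, which is set to zero; this preserves
      -- the surplus of unknowns.
      cases (no ∄p) = b , (suc (proj₁ (proj₁ (proj₂ rest))) , proj₂ (proj₁ (proj₂ rest))) , solves
        where
        rest = kernel′ k d (λ i j → a (suc i) (suc j))
        b : Vector Carrier _
        b = 0# Vector.∷ proj₁ rest
        solves : ∀ i → a i · b ≈ 0#
        solves zero    = ·-zeroˡ {a = a zero} b λ j → decidable-stable em λ ≉0 → ∄p (j , ≉0)
        solves (suc i) = trans (+-cong (zeroʳ _) (proj₂ (proj₂ rest) i)) (+-identityˡ 0#)
      cases (yes (p , a₀p≉0)) = b , (punchIn p j , λ bj≈0 → b′j≉0 (trans (sym (b-other j)) bj≈0)) , solves
        where
        κ : Carrier
        κ = proj₁ (inverse (a zero p) a₀p≉0)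
        a₀p*κ≈1 : a zero p * κ ≈ 1#
        a₀p*κ≈1 = proj₂ (inverse (a zero p) a₀p≉0)
        row : ∀ i → Vector Carrier (suc (k ℕ.+ d))
        row i = removeAt (a i) p
        rest = kernel′ k d (λ i j → row (suc i) j - (a (suc i) p * κ) * row zero j)
        b′ : Vector Carrier (suc (k ℕ.+ d))
        b′ = proj₁ rest
        j : Fin (suc (k ℕ.+ d))
        j = proj₁ (proj₁ (proj₂ rest))
        b′j≉0 : b′ j ≉ 0#
        b′j≉0 = proj₂ (proj₁ (proj₂ rest))
        v : Carrier
        v = - (κ * row zero · b′)
        b : Vector Carrier (suc (suc (k ℕ.+ d)))
        b = insertAt b′ p v
        b-other : ∀ j → b (punchIn p j) ≈ b′ j
        b-other j = reflexive (insertAt-punchIn b′ p v j)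
        expand : ∀ i → a i · b ≈ a i p * v + row i · b′
        expand i = trans (sum-remove {i = p} (λ j → a i j * b j))
          (+-cong (*-congˡ (reflexive (insertAt-lookup b′ p v))) (sum-cong-≋ λ j → *-congˡ {row i j} (b-other j)))
        solves : ∀ i → a i · b ≈ 0#
        solves zero = begin
          a zero · b                                             ≈⟨ expand zero ⟩
          a zero p * v + row zero · b′
            ≈⟨ solve 3 (λ a κ s → a :* (:- (κ :* s)) :+ s := (:1 :- a :* κ) :* s) refl (a zero p) κ (row zero · b′) ⟩
          (1# - a zero p * κ) * row zero · b′                    ≈⟨ *-congʳ (trans (+-congˡ (-‿cong a₀p*κ≈1)) (-‿inverseʳ 1#)) ⟩
          0# * row zero · b′                                     ≈⟨ zeroˡ _ ⟩
          0#                                                     ∎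
        solves (suc i) = begin
          a (suc i) · b                                          ≈⟨ expand (suc i) ⟩
          a (suc i) p * v + row (suc i) · b′
            ≈⟨ solve 4 (λ a κ s t → a :* (:- (κ :* s)) :+ t := t :- a :* κ :* s) refl (a (suc i) p) κ (row zero · b′) (row (suc i) · b′) ⟩
          row (suc i) · b′ - (a (suc i) p * κ) * row zero · b′   ≈⟨ ·-minus (row (suc i)) (a (suc i) p * κ) (row zero) b′ ⟨
          (λ j → row (suc i) j - (a (suc i) p * κ) * row zero j) · b′ ≈⟨ proj₂ (proj₂ rest) i ⟩
          0#                                                     ∎

  kernel : ∀ {k l} → k ℕ.< l → (a : Fin k → Vector Carrier l) →
           ∃[ b ] (∃[ j ] b j ≉ 0#) × (∀ i → a i · b ≈ 0#)
  kernel {k} k<l a with ℕₚ.m≤n⇒∃[o]m+o≡n k<l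
  ... | d , ≡.refl = kernel′ k d a

  sum-splitAt : ∀ k {l} (t : Vector Carrier (k ℕ.+ l)) → sum t ≈ sum (λ i → t (i ↑ˡ l)) + sum (λ i → t (k ↑ʳ i))
  sum-splitAt zero    t = sym (+-identityˡ _)
  sum-splitAt (suc k) t = trans (+-congˡ (sum-splitAt k (t ∘ suc))) (sym (+-assoc _ _ _))

  ∑≈sum : ∀ k (f : Subset k → Carrier) → ∑ f ≈ sum (λ j → f (toSubset k j))
  ∑≈sum zero    f = sym (+-identityʳ _)
  ∑≈sum (suc k) f = trans
    (+-cong
      (trans (∑≈sum k (λ S → f (outside ∷ S))) (sum-cong-≋ λ j → reflexive (≡.cong f (≡.sym (toSubset-↑ˡ k j)))))
      (trans (∑≈sum k (λ S → f (inside ∷ S))) (sum-cong-≋ λ j → reflexive (≡.cong f (≡.sym (toSubset-↑ʳ k j))))))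
    (sym (sum-splitAt (#subsets k) (λ j → f (toSubset (suc k) j))))

  combination : ∀ {k} → Vector Carrier k → Vector SetFunction k → SetFunction
  combination a v S = sum (λ i → a i * v i S)

  ⟨combination,⟩ : ∀ {k} (a : Vector Carrier k) v m → ⟨ combination a v , m ⟩ ≈ a · (λ i → ⟨ v i , m ⟩)
  ⟨combination,⟩ a v m = begin
    ∑ (λ S → combination a v S * m S)
      ≈⟨ ∑-cong (λ S → trans (*-comm _ _) (*-distribˡ-sum (m S) (λ i → a i * v i S))) ⟩
    ∑ (λ S → sum (λ i → m S * (a i * v i S)))    ≈⟨ ∑-sum-comm (λ S i → m S * (a i * v i S)) ⟩
    sum (λ i → ∑ (λ S → m S * (a i * v i S)))
      ≈⟨ sum-cong-≋ (λ i → trans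
           (∑-cong (λ S → solve 3 (λ m a v → m :* (a :* v) := a :* (v :* m)) refl (m S) (a i) (v i S)))
           (sym (*-distribˡ-∑ (a i) (λ S → v i S * m S)))) ⟩
    a · (λ i → ⟨ v i , m ⟩)                      ∎

  LinearlyIndependent : ∀ {k} → Vector SetFunction k → Set
  LinearlyIndependent v = ∀ a → (∀ S → combination a v S ≈ 0#) → ∀ i → a i ≈ 0#

  Annihilates : ∀ {k} → Vector SetFunction k → Pred SetFunction 0ℓ → Set
  Annihilates f A = ∀ m → m ∈ A → ∀ i → ⟨ f i , m ⟩ ≈ 0#

  module _ {k j} (v : Vector SetFunction k) (f : Vector SetFunction j) where

    ++-left : ∀ i → (v Vector.++ f) (i ↑ˡ j) ≡ v i
    ++-left i rewrite Fin.splitAt-↑ˡ k i j = ≡.refl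

    ++-right : ∀ i → (v Vector.++ f) (k ↑ʳ i) ≡ f i
    ++-right i rewrite Fin.splitAt-↑ʳ k j i = ≡.refl

    combination-++ : ∀ b S → combination b (v Vector.++ f) S ≈
      combination (λ i → b (i ↑ˡ j)) v S + combination (λ i → b (k ↑ʳ i)) f S
    combination-++ b S = trans (sum-splitAt k (λ i → b i * (v Vector.++ f) i S)) (+-cong
      (sum-cong-≋ λ i → *-congˡ (reflexive (≡.cong (λ g → g S) (++-left i))))
      (sum-cong-≋ λ i → *-congˡ (reflexive (≡.cong (λ g → g S) (++-right i)))))

  -- A combination w of the functionals f is orthogonal to A, so a relation
  -- between points of A and functionals f splits into two relations.
  dimension-upper-bound : ∀ {A : Pred SetFunction 0ℓ} {j} (f : Vector SetFunction j) →
    Annihilates f A → LinearlyIndependent f →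
    ∀ k → k ℕ.+ j ≡ suc (suc (#subsets n)) → ¬ HasIndependentPoints A k
  dimension-upper-bound {A} {j} f annihilates f-independent k k+j≡2+M (v , v∈A , v-independent) =
    proj₂ (proj₁ (proj₂ solution)) (b≈0 (splitAt k column) ≡.refl)
    where
    equations : Fin (suc (#subsets n)) → Vector Carrier (k ℕ.+ j)
    -- The extra equation makes the coefficients of the points sum to zero, as affine independence
    -- requires. It is the reason why the unknowns must exceed the number of subsets by two.
    equations zero    = Vector._++_ {m = k} (λ _ → 1#) (λ _ → 0#)
    equations (suc i) = λ c → (v Vector.++ f) c (toSubset n i)
    solution = kernel (ℕₚ.≤-reflexive (≡.sym k+j≡2+M)) equations
    b : Vector Carrier (k ℕ.+ j)
    b = proj₁ solution
    column : Fin (k ℕ.+ j)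
    column = proj₁ (proj₁ (proj₂ solution))
    bᵛ : Vector Carrier k
    bᵛ i = b (i ↑ˡ j)
    bᶠ : Vector Carrier j
    bᶠ i = b (k ↑ʳ i)
    w : SetFunction
    w = combination bᶠ f
    sum-bᵛ : sum bᵛ ≈ 0#
    sum-bᵛ = begin
      sum bᵛ                             ≈⟨ +-identityʳ _ ⟨
      sum bᵛ + 0#                        ≈⟨ +-cong
        (sum-cong-≋ λ i → sym (trans (*-congʳ (reflexive (ones i))) (*-identityˡ _)))
        (sym (·-zeroˡ {a = λ i → equations zero (k ↑ʳ i)} bᶠ (λ i → reflexive (zeros i)))) ⟩
      (λ i → equations zero (i ↑ˡ j)) · bᵛ + (λ i → equations zero (k ↑ʳ i)) · bᶠ
        ≈⟨ sum-splitAt k (λ i → equations zero i * b i) ⟨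
      equations zero · b                 ≈⟨ proj₂ (proj₂ solution) zero ⟩
      0#                                 ∎
      where
      ones : ∀ i → equations zero (i ↑ˡ j) ≡ 1#
      ones i rewrite Fin.splitAt-↑ˡ k i j = ≡.refl
      zeros : ∀ i → equations zero (k ↑ʳ i) ≡ 0#
      zeros i rewrite Fin.splitAt-↑ʳ k j i = ≡.refl
    relation : ∀ S → combination bᵛ v S + w S ≈ 0#
    relation S = begin
      combination bᵛ v S + w S           ≈⟨ combination-++ v f b S ⟨
      combination b (v Vector.++ f) S    ≈⟨ ·-comm b (λ c → (v Vector.++ f) c S) ⟩
      (λ c → (v Vector.++ f) c S) · b    ≡⟨ ≡.cong (λ R → (λ c → (v Vector.++ f) c R) · b) (toSubset-index S) ⟨
      equations (suc (index S)) · b      ≈⟨ proj₂ (proj₂ solution) (suc (index S)) ⟩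
      0#                                 ∎
    w⊥v : ∀ i → ⟨ v i , w ⟩ ≈ 0#
    w⊥v i = trans (⟨⟩-comm (v i) w) (trans (⟨combination,⟩ bᶠ f (v i)) (·-zeroʳ bᶠ (annihilates (v i) (v∈A i))))
    w·w≈0 : ⟨ w , w ⟩ ≈ 0#
    w·w≈0 = begin
      ⟨ w , w ⟩                               ≈⟨ +-identityˡ _ ⟨
      0# + ⟨ w , w ⟩                          ≈⟨ +-congʳ (trans (⟨combination,⟩ bᵛ v w) (·-zeroʳ bᵛ w⊥v)) ⟨
      ⟨ combination bᵛ v , w ⟩ + ⟨ w , w ⟩    ≈⟨ ⟨⟩-distrib-+ (combination bᵛ v) w w ⟨
      ⟨ (λ S → combination bᵛ v S + w S) , w ⟩ ≈⟨ ∑-zero (λ S → trans (*-congʳ (relation S)) (zeroˡ _)) ⟩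
      0#                                      ∎
    w≈0 : ∀ S → w S ≈ 0#
    w≈0 S = decidable-stable em λ wS≉0 → ⟨⟩-definite w w·w≈0 (S , wS≉0)
    b≈0 : ∀ s → splitAt k column ≡ s → b column ≈ 0#
    b≈0 (inj₁ i) eq = trans (reflexive (≡.cong b (≡.sym (Fin.splitAt⁻¹-↑ˡ eq))))
      (v-independent bᵛ sum-bᵛ (λ S → trans (sym (trans (+-congˡ (w≈0 S)) (+-identityʳ _))) (relation S)) i)
    b≈0 (inj₂ i) eq = trans (reflexive (≡.cong b (≡.sym (Fin.splitAt⁻¹-↑ʳ eq)))) (f-independent bᶠ w≈0 i)

  orthogonal : ∀ {l} → l ℕ.< #subsets n → (f : Vector SetFunction l) →
               ∃[ η ] (∃[ S ] η S ≉ 0#) × (∀ i → ⟨ f i , η ⟩ ≈ 0#)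
  orthogonal l<M f = η , (toSubset n column , ηS≉0) , λ i → trans (∑≈sum n (λ S → f i S * η S))
    (trans (sum-cong-≋ λ c → *-congˡ (reflexive (≡.cong b (index-toSubset n c)))) (proj₂ (proj₂ solution) i))
    where
    solution = kernel l<M (λ i c → f i (toSubset n c))
    b : Vector Carrier (#subsets n)
    b = proj₁ solution
    η : SetFunction
    η S = b (index S)
    column : Fin (#subsets n)
    column = proj₁ (proj₁ (proj₂ solution))
    ηS≉0 : η (toSubset n column) ≉ 0#
    ηS≉0 η≈0 = proj₂ (proj₁ (proj₂ solution)) (trans (reflexive (≡.cong b (≡.sym (index-toSubset n column)))) η≈0)

  module _ {A : Pred SetFunction 0ℓ} {j} (f : Vector SetFunction j)
    (spanning : ∀ η → (∀ m → m ∈ A → ⟨ η , m ⟩ ≈ 0#) → (∀ i → ⟨ f i , η ⟩ ≈ 0#) → ∀ S → η S ≈ 0#) where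

    -- `spanning` says in terms of orthogonality that `A` and `f` together span the whole space. As
    -- long as there is room, some nonzero `η` is orthogonal to `f` and to the vectors chosen so
    -- far; an `m` in `A` not orthogonal to `η` then extends the family.
    independent-vectors : ∀ k → k ℕ.+ j ℕ.≤ #subsets n →
      Σ (Vector SetFunction k) λ v → (∀ i → v i ∈ A) × LinearlyIndependent v
    independent-vectors zero _ = (λ ()) , (λ ()) , λ _ _ ()
    independent-vectors (suc k) k+j<M = m Vector.∷ v , (λ { zero → m∈A ; (suc i) → v∈A i }) , independent
      where
      previous = independent-vectors k (ℕₚ.<⇒≤ k+j<M)
      v : Vector SetFunction k
      v = proj₁ previous
      v∈A : ∀ i → v i ∈ A
      v∈A = proj₁ (proj₂ previous)
      solution = orthogonal k+j<M (v Vector.++ f)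
      η : SetFunction
      η = proj₁ solution
      η⊥v : ∀ i → ⟨ v i , η ⟩ ≈ 0#
      η⊥v i = ≡.subst (λ g → ⟨ g , η ⟩ ≈ 0#) (++-left v f i) (proj₂ (proj₂ solution) (i ↑ˡ j))
      η⊥f : ∀ i → ⟨ f i , η ⟩ ≈ 0#
      η⊥f i = ≡.subst (λ g → ⟨ g , η ⟩ ≈ 0#) (++-right v f i) (proj₂ (proj₂ solution) (k ↑ʳ i))
      new : ∃[ m ] m ∈ A × ⟨ η , m ⟩ ≉ 0#
      new = decidable-stable em λ ∄m → proj₂ (proj₁ (proj₂ solution))
        (spanning η (λ m m∈A → decidable-stable em λ ≉0 → ∄m (m , m∈A , ≉0)) η⊥f (proj₁ (proj₁ (proj₂ solution))))
      m : SetFunction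
      m = proj₁ new
      m∈A : m ∈ A
      m∈A = proj₁ (proj₂ new)
      independent : LinearlyIndependent (m Vector.∷ v)
      independent a relation = a≈0
        where
        a₀≈0 : a zero ≈ 0#
        a₀≈0 = x*y≈0⇒x≈0 (proj₂ (proj₂ new)) (begin
          a zero * ⟨ η , m ⟩                                      ≈⟨ *-congˡ (⟨⟩-comm η m) ⟩
          a zero * ⟨ m , η ⟩                                      ≈⟨ +-identityʳ _ ⟨
          a zero * ⟨ m , η ⟩ + 0#                                 ≈⟨ +-congˡ (·-zeroʳ (a ∘ suc) η⊥v) ⟨
          a zero * ⟨ m , η ⟩ + (a ∘ suc) · (λ i → ⟨ v i , η ⟩)    ≈⟨ ⟨combination,⟩ a (m Vector.∷ v) η ⟨
          ⟨ combination a (m Vector.∷ v) , η ⟩                    ≈⟨ ∑-zero (λ S → trans (*-congʳ (relation S)) (zeroˡ _)) ⟩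
          0#                                                      ∎)
        a≈0 : ∀ i → a i ≈ 0#
        a≈0 zero    = a₀≈0
        a≈0 (suc i) = proj₂ (proj₂ previous) (a ∘ suc)
          (λ S → trans (sym (trans (+-congʳ (trans (*-congʳ a₀≈0) (zeroˡ _))) (+-identityˡ _))) (relation S)) i

    -- The origin as an additional point turns linear into affine independence.
    dimension-lower-bound : (λ _ → 0#) ∈ A → ∀ k → k ℕ.+ j ℕ.≤ #subsets n → HasIndependentPoints A (suc k)
    dimension-lower-bound 0∈A k k+j≤M with independent-vectors k k+j≤M
    ... | v , v∈A , v-independent = (λ _ → 0#) Vector.∷ v , (λ { zero → 0∈A ; (suc i) → v∈A i }) , independent
      where
      independent : AffinelyIndependent ((λ _ → 0#) Vector.∷ v)
      independent a sum-a relation = a≈0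
        where
        tail≈0 : ∀ i → a (suc i) ≈ 0#
        tail≈0 = v-independent (a ∘ suc) λ S → trans (sym (trans (+-congʳ (zeroʳ _)) (+-identityˡ _))) (relation S)
        a≈0 : ∀ i → a i ≈ 0#
        a≈0 zero = trans (sym (trans (+-congˡ (trans (sum-cong-≋ tail≈0) (sum-replicate-zero k))) (+-identityʳ _))) sum-a
        a≈0 (suc i) = tail≈0 i

  fewer-points : ∀ {A k l} → k ℕ.≤ l → HasIndependentPoints A l → HasIndependentPoints A k
  fewer-points {A} {k} k≤l points with ℕₚ.m≤n⇒∃[o]m+o≡n k≤l
  ... | o , ≡.refl = drop o (≡.subst (HasIndependentPoints A) (ℕₚ.+-comm k o) points)
    where
    drop : ∀ o → HasIndependentPoints A (o ℕ.+ k) → HasIndependentPoints A k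
    drop zero    points = points
    drop (suc o) (v , v∈A , independent) = drop o (v ∘ suc , v∈A ∘ suc , λ a sum-a relation i →
      independent (0# Vector.∷ a) (trans (+-identityˡ _) sum-a)
        (λ S → trans (+-cong (zeroˡ _) (relation S)) (+-identityˡ 0#)) (suc i))

-- Facets and rigidity.

module Facets (em : ExcludedMiddle 0ℓ) (ℝ : CompleteOrderedField) (n : ℕ) (3≤n : 3 ℕ.≤ n) where

  open CompleteOrderedField ℝ hiding (zero)
  open ExactGames ℝ n
  open Field ℝ
  open Sums ℝ n
  open Games em ℝ n
  open Cone em ℝ n 3≤n
  open Systems em ℝ n 3≤n
  open Extremality em ℝ n 3≤n
  open LinearAlgebra em ℝ n
  open import Relation.Binary.Reasoning.Setoid setoid

  Valid⇒size-nonNeg : ∀ {u} → Valid u → 0# ≤ size u × (size u ≈ 0# → ∀ S → S ≢ ⊥ → u S ≈ 0#)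
  Valid⇒size-nonNeg {u} valid = ≤-respʳ sizes (∑-nonNeg λ T → size-nonNeg (d∈K T)) ,
    λ size≈0 S S≢⊥ → trans (∑d S) (∑-zero λ T →
      size-zero (d∈K T) (∑-nonNeg-zero (λ T → size-nonNeg (d∈K T)) (trans sizes size≈0) T) S S≢⊥)
    where
    decomposition = Valid⇒decomposition valid
    d : Subset n → SetFunction
    d = proj₁ decomposition
    d∈K : ∀ T → InK T (d T)
    d∈K = proj₁ (proj₂ decomposition)
    ∑d : ∀ S → u S ≈ ∑ (λ T → d T S)
    ∑d = proj₂ (proj₂ decomposition)
    sizes : ∑ (λ T → size (d T)) ≈ size u
    sizes = trans (⟨⟩-∑ d 𝟙) (∑-cong λ S → *-congʳ (sym (∑d S)))

  -- The cone of exact games is full-dimensional away from ∅. Here this follows from Farkas: `η` and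
  -- its negative are both valid, so the size of `η` is both nonnegative and nonpositive, and size
  -- zero forces `η` to vanish.
  vanishing-on-Exact : ∀ η → (∀ m → Exact m → ⟨ η , m ⟩ ≈ 0#) → ∀ S → S ≢ ⊥ → η S ≈ 0#
  vanishing-on-Exact η vanishes = proj₂ (Valid⇒size-nonNeg {η} valid)
    (≤.antisym (0≤-⇒≤0 (≤-respʳ (⟨⟩-neg η 𝟙) (proj₁ (Valid⇒size-nonNeg { -η} -valid)))) (proj₁ (Valid⇒size-nonNeg {η} valid)))
    where
    -η : SetFunction
    -η S = - η S
    valid : Valid η
    valid m exact = ≤.reflexive (vanishes m exact)
    -valid : Valid -η
    -valid m exact = ≤.reflexive (trans (⟨⟩-neg η m) (trans (-‿cong (vanishes m exact)) -0≈0))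

  zero-game : SetFunction
  zero-game _ = 0#

  zero-exact : Exact zero-game
  zero-exact = refl , λ S → (λ _ → 0#) ,
    ((trans (sym (sumOver-⊤ _)) (sumOver-zero ⊤)) , λ T → ≤.reflexive (sym (sumOver-zero T))) , sumOver-zero S

  -- The form that annihilates all games; it accounts for the one dimension by which `Exact` falls
  -- short of the whole space.
  e⊥ : SetFunction
  e⊥ = single ⊥ 1#

  ⟨e⊥,⟩ : ∀ m → ⟨ e⊥ , m ⟩ ≈ m ⊥
  ⟨e⊥,⟩ m = trans (⟨single,⟩ ⊥ 1# m) (*-identityˡ _)

  Exact-upper-bound : ¬ HasIndependentPoints Exact (suc (#subsets n))
  Exact-upper-bound = dimension-upper-bound {Exact} (λ _ → e⊥) (λ m exact _ → trans (⟨e⊥,⟩ m) (proj₁ exact)) independent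
    (suc (#subsets n)) (ℕₚ.+-comm (suc (#subsets n)) 1)
    where
    independent : LinearlyIndependent {1} (λ _ → e⊥)
    independent a relation zero = trans (sym (trans (+-identityʳ _) (trans (*-congˡ (single-same ⊥ 1#)) (*-identityʳ _)))) (relation ⊥)

  Exact-lower-bound : ∀ k → suc k ℕ.≤ #subsets n → HasIndependentPoints Exact (suc k)
  Exact-lower-bound k k<M = dimension-lower-bound {Exact} (λ (_ : Fin 1) → e⊥) spanning zero-exact k
    (≡.subst (ℕ._≤ #subsets n) (ℕₚ.+-comm 1 k) k<M)
    where
    spanning : ∀ η → (∀ m → Exact m → ⟨ η , m ⟩ ≈ 0#) → (∀ (_ : Fin 1) → ⟨ e⊥ , η ⟩ ≈ 0#) → ∀ S → η S ≈ 0#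
    spanning η vanishes ⟨e⊥,η⟩≈0 S = value (S ≟ ⊥)
      where
      value : Dec (S ≡ ⊥) → η S ≈ 0#
      value (yes ≡.refl) = trans (sym (⟨e⊥,⟩ η)) (⟨e⊥,η⟩≈0 zero)
      value (no S≢⊥)     = vanishing-on-Exact η vanishes S S≢⊥

  module _ {θ : SetFunction} (θ≉0 : ∃[ S ] S ≢ ⊥ × θ S ≉ 0#) where

    private
      M≥2 = #subsets≥2 (ℕₚ.≤-trans (s≤s z≤n) 3≤n)

      independent-pair : ∀ a b → (∀ S → a * e⊥ S + b * θ S ≈ 0#) → a ≈ 0# × b ≈ 0#
      independent-pair a b relation = a≈0 , b≈0
        where
        b≈0 : b ≈ 0#
        b≈0 = let (S , S≢⊥ , θS≉0) = θ≉0 in x*y≈0⇒x≈0 θS≉0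
          (trans (sym (trans (+-congʳ (trans (*-congˡ (single-other 1# S≢⊥)) (zeroʳ a))) (+-identityˡ _))) (relation S))
        a≈0 : a ≈ 0#
        a≈0 = trans (sym (trans (+-cong (trans (*-congˡ (single-same ⊥ 1#)) (*-identityʳ a)) (trans (*-congʳ b≈0) (zeroˡ _)))
          (+-identityʳ a))) (relation ⊥)

    -- If `η` were not a multiple of `θ` away from ⊥, then `e⊥`, `θ` and `η` would be three
    -- independent forms annihilating the face, one more than a facet admits.
    facet⇒Rigid : FacetDefining Exact θ → Rigid θ
    facet⇒Rigid (_ , d , (face-points , _) , _ , ¬Exact-points) η vanishes = decidable-stable em λ ¬η∝θ →
      dimension-upper-bound {TightFace Exact θ} functionals annihilates (independent ¬η∝θ) k k+3≡2+M (fewer-points {TightFace Exact θ} k≤1+d face-points)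
      where
      k : ℕ
      -- One less than the number of subsets, which is the number of affinely independent points in
      -- a facet. The hypothesis provides some dimension `d`; the independent points of `Exact` show
      -- that it is large enough.
      k = suc (proj₁ M≥2)
      M≡1+k : #subsets n ≡ suc k
      M≡1+k = proj₂ M≥2
      k≤1+d : k ℕ.≤ suc d
      k≤1+d = ℕₚ.≮⇒≥ λ 1+d<k → ¬Exact-points (Exact-lower-bound (suc (suc d))
        (≡.subst (suc (suc (suc d)) ℕ.≤_) (≡.sym M≡1+k) (s≤s 1+d<k)))
      k+3≡2+M : k ℕ.+ 3 ≡ suc (suc (#subsets n))
      k+3≡2+M = ≡.trans (ℕₚ.+-comm k 3) (≡.cong (λ l → suc (suc l)) (≡.sym M≡1+k))
      functionals : Vector SetFunction 3
      functionals = e⊥ Vector.∷ θ Vector.∷ η Vector.∷ Vector.[]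
      annihilates : Annihilates functionals (TightFace Exact θ)
      annihilates m (exact , tight) zero             = trans (⟨e⊥,⟩ m) (proj₁ exact)
      annihilates m (exact , tight) (suc zero)       = tight
      annihilates m (exact , tight) (suc (suc zero)) = vanishes m (exact , tight)
      independent : ¬ (∃[ t ] η ≋ (λ S → t * θ S)) → LinearlyIndependent functionals
      independent ¬η∝θ a relation = a≈0
        where
        a₀ a₁ a₂ : Carrier
        a₀ = a zero
        a₁ = a (suc zero)
        a₂ = a (suc (suc zero))
        a₂≈0 : a₂ ≈ 0#
        a₂≈0 = decidable-stable em λ a₂≉0 → let (κ , a₂*κ≈1) = inverse a₂ a₂≉0 in
          ¬η∝θ (- (κ * a₁) , λ S S≢⊥ → begin
            η S                                           ≈⟨ *-identityˡ _ ⟨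
            1# * η S                                      ≈⟨ *-congʳ a₂*κ≈1 ⟨
            a₂ * κ * η S
              ≈⟨ solve 5 (λ a₁ a₂ κ h t → a₂ :* κ :* h := κ :* (:0 :+ (a₁ :* t :+ (a₂ :* h :+ :0))) :+ (:- (κ :* a₁)) :* t) refl
                   a₁ a₂ κ (η S) (θ S) ⟩
            κ * (0# + (a₁ * θ S + (a₂ * η S + 0#))) + - (κ * a₁) * θ S
              ≈⟨ +-congʳ (trans (*-congˡ (trans (+-congʳ (sym (trans (*-congˡ (single-other 1# S≢⊥)) (zeroʳ a₀)))) (relation S))) (zeroʳ κ)) ⟩
            0# + - (κ * a₁) * θ S                         ≈⟨ +-identityˡ _ ⟩
            - (κ * a₁) * θ S                              ∎)
        pair : a₀ ≈ 0# × a₁ ≈ 0#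
        pair = independent-pair a₀ a₁ λ S → trans
          (+-congˡ (sym (trans (+-congˡ (trans (+-congʳ (trans (*-congʳ a₂≈0) (zeroˡ _))) (+-identityˡ 0#))) (+-identityʳ _))))
          (relation S)
        a≈0 : ∀ i → a i ≈ 0#
        a≈0 zero             = proj₁ pair
        a≈0 (suc zero)       = proj₂ pair
        a≈0 (suc (suc zero)) = a₂≈0

    -- The forms `e⊥` and `θ` bound the dimension of the face from above. For the lower bound, let
    -- `η` vanish on the face and be orthogonal to both: by rigidity it is a multiple of `θ` away
    -- from ⊥, hence orthogonal to itself and zero.
    Rigid⇒facet : ValidFor Exact θ → Rigid θ → FacetDefining Exact θ
    Rigid⇒facet valid rigid = valid , d ,
      (dimension-lower-bound {TightFace Exact θ} functionals spanning (zero-exact , ∑-zero (λ S → zeroʳ _)) d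
         (ℕₚ.≤-reflexive (≡.trans (ℕₚ.+-comm d 2) (≡.sym M≡2+d))) ,
       dimension-upper-bound {TightFace Exact θ} functionals annihilates independent (suc (suc d))
         (≡.trans (ℕₚ.+-comm (suc (suc d)) 2) (≡.cong (λ l → suc (suc l)) (≡.sym M≡2+d)))) ,
      (Exact-lower-bound (suc d) (ℕₚ.≤-reflexive (≡.sym M≡2+d)) ,
       ≡.subst (λ l → ¬ HasIndependentPoints Exact (suc l)) M≡2+d Exact-upper-bound)
      where
      d : ℕ
      d = proj₁ M≥2
      M≡2+d : #subsets n ≡ suc (suc d)
      M≡2+d = proj₂ M≥2
      functionals : Vector SetFunction 2
      functionals = e⊥ Vector.∷ θ Vector.∷ Vector.[]
      annihilates : Annihilates functionals (TightFace Exact θ)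
      annihilates m (exact , tight) zero       = trans (⟨e⊥,⟩ m) (proj₁ exact)
      annihilates m (exact , tight) (suc zero) = tight
      independent : LinearlyIndependent functionals
      independent a relation = λ { zero → proj₁ pair ; (suc zero) → proj₂ pair }
        where
        pair : a zero ≈ 0# × a (suc zero) ≈ 0#
        pair = independent-pair (a zero) (a (suc zero)) λ S → trans (+-congˡ (sym (+-identityʳ _))) (relation S)
      spanning : ∀ η → (∀ m → m ∈ TightFace Exact θ → ⟨ η , m ⟩ ≈ 0#) → (∀ i → ⟨ functionals i , η ⟩ ≈ 0#) → ∀ S → η S ≈ 0#
      spanning η vanishes orthogonal S = decidable-stable em λ ηS≉0 → ⟨⟩-definite η η·η≈0 (S , ηS≉0)
        where
        t : Carrier
        t = proj₁ (rigid η vanishes)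
        η≋tθ : η ≋ (λ S → t * θ S)
        η≋tθ = proj₂ (rigid η vanishes)
        η·η≈0 : ⟨ η , η ⟩ ≈ 0#
        η·η≈0 = begin
          ⟨ η , η ⟩                   ≈⟨ ⟨⟩-cong {η} {λ S → t * θ S} {η} η≋tθ (trans (sym (⟨e⊥,⟩ η)) (orthogonal zero)) ⟩
          ⟨ (λ S → t * θ S) , η ⟩     ≈⟨ ⟨⟩-scale t θ η ⟩
          t * ⟨ θ , η ⟩               ≈⟨ *-congˡ (orthogonal (suc zero)) ⟩
          t * 0#                      ≈⟨ zeroʳ t ⟩
          0#                          ∎

  Rigid-resp : ∀ {u v} → (∀ S → S ≢ ⊥ → v S ≈ - u S) → Rigid u → Rigid v
  Rigid-resp {u} {v} v≋-u rigid η vanishes = - t , λ S S≢⊥ → begin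
    η S               ≈⟨ η≋tu S S≢⊥ ⟩
    t * u S           ≈⟨ solve 2 (λ t u → t :* u := (:- t) :* (:- u)) refl t (u S) ⟩
    - t * - u S       ≈⟨ *-congˡ (v≋-u S S≢⊥) ⟨
    - t * v S         ∎
    where
    tight : ∀ m → Tight u m → Tight v m
    tight m (exact , ⟨u,m⟩≈0) = exact , trans (⟨⟩-cong {v} {λ S → - u S} {m} v≋-u (proj₁ exact))
      (trans (⟨⟩-neg u m) (trans (-‿cong ⟨u,m⟩≈0) -0≈0))
    t : Carrier
    t = proj₁ (rigid η λ m tight-u → vanishes m (tight m tight-u))
    η≋tu : η ≋ (λ S → t * u S)
    η≋tu = proj₂ (rigid η λ m tight-u → vanishes m (tight m tight-u))

-- The two directions of the equivalence for a normalised θ.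

open import Data.Nat.Base using (_≤_)

theorem18 : ExcludedMiddle 0ℓ → (ℝ : CompleteOrderedField) (n : ℕ) → 3 ≤ n →
    let open CompleteOrderedField ℝ
        open ExactGames ℝ n
    in (θ : SetFunction) → ∑ θ ≈ 0# → ∑-such-that properNonempty? θ ≈ - 1# →
       FacetDefining Exact θ ⇔
         (Σ SetSystem λ 𝒮 → IndecomposableMinSemiBalanced 𝒮 × θ IsThetaOf 𝒮)
theorem18 em ℝ n 3≤n θ ∑θ≈0 ∑-proper≈-1 = mk⇔ to from
  where
  open CompleteOrderedField ℝ hiding (zero)
  open ExactGames ℝ n
  open Field ℝ
  open Sums ℝ n
  open Games em ℝ n
  open Cone em ℝ n 3≤n
  open Systems em ℝ n 3≤n
  open Extremality em ℝ n 3≤n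
  open Facets em ℝ n 3≤n
  open import Relation.Binary.Reasoning.Setoid setoid

  u : SetFunction
  u S = - θ S

  size≈1 : size u ≈ 1#
  size≈1 = begin
    size u      ≈⟨ ⟨⟩-neg θ 𝟙 ⟩
    - size θ    ≈⟨ -‿cong (trans (sym (∑-mask θ)) ∑-proper≈-1) ⟩
    - - 1#      ≈⟨ -‿involutive 1# ⟩
    1#          ∎

  θ≉0 : ∃[ S ] S ≢ ⊥ × θ S ≉ 0#
  θ≉0 = decidable-stable em λ ∄S → 1≉0 (trans (sym size≈1) (trans
    (size-cong {u} {λ _ → 0#} λ S S≢⊥ → trans (-‿cong (decidable-stable em λ ≉0 → ∄S (S , S≢⊥ , ≉0))) -0≈0)
    (∑-zero λ S → zeroˡ _)))

  to : FacetDefining Exact θ → Σ SetSystem λ 𝒮 → IndecomposableMinSemiBalanced 𝒮 × θ IsThetaOf 𝒮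
  to facet = 𝒮 , indecomposableMinSemiBalanced , isThetaOf {θ} (λ _ → refl) ∑θ≈0
    where
    rigid : Rigid u
    rigid = Rigid-resp {θ} {u} (λ _ _ → refl) (facet⇒Rigid θ≉0 facet)
    valid : Valid u
    valid m exact = ≤-respˡ (sym (⟨⟩-neg θ m)) (0≤⇒-≤0 (proj₁ facet m exact))
    open FacetSystem (proj₂ (Valid∧Rigid⇒InK valid rigid size≈1)) rigid size≈1

  from : (Σ SetSystem λ 𝒮 → IndecomposableMinSemiBalanced 𝒮 × θ IsThetaOf 𝒮) → FacetDefining Exact θ
  from (𝒮 , imsb , c , r , coefficients , affine , semiConic , yields , θ-𝒮 , θ-⊤ , _ , θ-other) =
    Rigid⇒facet θ≉0 valid (Rigid-resp {extend c r} {θ} θ≋-ĉ (indecomposable⇒Rigid imsb coefficients affine semiConic yields))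
    where
    nonTrivial : NonTrivial 𝒮
    nonTrivial = proj₁ (proj₁ (proj₁ (proj₁ imsb)))
    θ≋-ĉ : ∀ S → S ≢ ⊥ → θ S ≈ - extend c r S
    θ≋-ĉ S S≢⊥ = value (S ≟ ⊤) em
      where
      value : Dec (S ≡ ⊤) → Dec (S ∈ 𝒮) → θ S ≈ - extend c r S
      value (yes ≡.refl) _ = trans θ-⊤ (sym (trans
        (-‿cong (extend-⊤ c r (coefficients ⊤ (proj₂ (proj₂ nonTrivial))))) (-‿involutive r)))
      value (no S≢⊤) (yes S∈𝒮) = trans (θ-𝒮 S S∈𝒮) (-‿cong (sym (extend-≢⊤ c r S≢⊤)))
      value (no S≢⊤) (no S∉𝒮) = trans
        (θ-other S [ S∉𝒮 , [ S≢⊥ ∘ ≡.sym , S≢⊤ ∘ ≡.sym ]′ ]′)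
        (sym (trans (-‿cong (trans (extend-≢⊤ c r S≢⊤) (coefficients S S∉𝒮))) -0≈0))
    valid : ValidFor Exact θ
    valid m exact = ≤-respʳ
      (sym (trans (⟨⟩-cong {θ} {λ S → - extend c r S} {m} θ≋-ĉ (proj₁ exact)) (⟨⟩-neg (extend c r) m)))
      (≤0⇒0≤- (InK⇒Valid (proj₂ (u∈K imsb coefficients affine semiConic yields)) m exact))
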